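{- Let $T$ be a first-order theory. Then $T$ is rosy if and only if thorn-forking in $T$ satisfies symmetry, i.e. for all tuples $a,b$ and all sets $A$: $tp(a/Ab)$ does not thorn-fork over $A$ if and only if $tp(b/Aa)$ does not thorn-fork over $A$.
   Context: We work in a monster model $\mathcal C^{eq}$ of $T$; tuples may be tuples of imaginaries. Strong dividing: a formula $\delta(x,a)$ strongly divides over $A$ if $tp(a/A)$ is non-algebraic and $\{\delta(x,a')\}_{a'\models tp(a/A)}$ is $k$-inconsistent for some $k\in\mathbb N$. Thorn-dividing (written þ-dividing): $\delta(x,a)$ thorn-divides over $A$ if there is a tuple $c$ such that $\delta(x,a)$ strongly divides over $Ac$. Thorn-forking: a formula thorn-forks over $A$ if it implies a finite disjunction of formulas each of which thorn-divides over $A$; a type thorn-divides (thorn-forks) over $A$ if it contains (implies) a formula that does. Thorn-rank: given a formula $\phi$, a finite set $\Delta$ of formulas in variables $x;y$, a finite set $\Pi$ of formulas in variables $y;z$ ($z$ possibly of infinite length), and a number $k$, define $\operatorname{th}(\phi,\Delta,\Pi,k)$ inductively: (1) it is $\ge 0$ if $\phi$ is consistent; (2) for $\lambda$ limit it is $\ge\lambda$ iff it is $\ge\alpha$ for all $\alpha<\lambda$; (3) it is $\ge\alpha+1$ iff there are $\delta\in\Delta$, $\pi(y;z)\in\Pi$ and parameters $c$ such that (a) $\operatorname{th}(\phi\wedge\delta(x,a),\Delta,\Pi,k)\ge\alpha$ for infinitely many $a\models\pi(y;c)$, and (b) $\{\delta(x,a)\}_{a\models\pi(y;c)}$ is $k$-inconsistent.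 A theory is rosy if all of its thorn-ranks are defined (i.e. ordinal-valued). -}

module Defs where

open import Data.Empty using (⊥)
open import Data.Fin using (Fin)
open import Data.List using (List)
open import Data.List.Membership.Propositional using (_∈_)
open import Data.List.Relation.Unary.All using (All)
open import Data.List.Relation.Unary.Any using (Any)
open import Data.Maybe using (Maybe; just; nothing)
open import Data.Nat using (ℕ)
open import Data.Product using (Σ-syntax; ∃-syntax; _×_; _,_)
open import Data.Sum using (_⊎_; inj₁; inj₂; [_,_]; [_,_]′)
open import Function using (_∘_; id)
open import Function.Bundles using (_⇔_; Inverse)
open import Level using (Level; Lift; lower; _⊔_; 0ℓ) renaming (suc to lsuc)
open import Relation.Binary.Bundles using (Setoid)
open import Relation.Binary.PropositionalEquality using (_≡_)
open import Relation.Binary.Structures using (IsEquivalence)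
open import Relation.Nullary using (¬_)
open import Relation.Unary using (Pred)

record Language ℓ : Set (lsuc ℓ) where
  field
    Sort   : Set ℓ
    Fun    : Set ℓ
    Rel    : Set ℓ
    arityᶠ : Fun → ℕ
    domᶠ   : (f : Fun) → Fin (arityᶠ f) → Sort
    codᶠ   : Fun → Sort
    arityᴿ : Rel → ℕ
    domᴿ   : (R : Rel) → Fin (arityᴿ R) → Sort

-- A sorted tuple of variables.  The index type may be infinite, so that
-- infinite tuples and types in infinitely many variables are covered; a
-- formula mentions only finitely many of the variables.
record Ctx i {s} (S : Set s) : Set (lsuc i ⊔ s) where
  constructor ctx
  field
    Index : Set i
    sort  : Index → S

open Ctx public

module _ {s} {S : Set s} where

  ε : Ctx 0ℓ S
  ε = ctx ⊥ λ ()

  fin : ∀ {n} → (Fin n → S) → Ctx 0ℓ S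
  fin σ = ctx (Fin _) σ

  infixl 6 _⊕_
  _⊕_ : ∀ {i j} → Ctx i S → Ctx j S → Ctx (i ⊔ j) S
  Γ ⊕ Δ = ctx (Index Γ ⊎ Index Δ) [ sort Γ , sort Δ ]′

  infixl 6 _▹_
  _▹_ : ∀ {i} → Ctx i S → S → Ctx i S
  Γ ▹ σ = ctx (Maybe (Index Γ)) λ { (just x) → sort Γ x ; nothing → σ }

module _ {ℓ} (L : Language ℓ) where
  open Language L

  data Term {i} (Γ : Ctx i Sort) : Sort → Set (ℓ ⊔ i) where
    var : (x : Index Γ) → Term Γ (sort Γ x)
    app : (f : Fun) → ((j : Fin (arityᶠ f)) → Term Γ (domᶠ f j)) → Term Γ (codᶠ f)

  infix  8 _≐_
  infixr 7 _∧′_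
  data Formula {i} (Γ : Ctx i Sort) : Set (ℓ ⊔ i) where
    _≐_  : ∀ {σ} → Term Γ σ → Term Γ σ → Formula Γ
    rel  : (R : Rel) → ((j : Fin (arityᴿ R)) → Term Γ (domᴿ R j)) → Formula Γ
    ¬′_  : Formula Γ → Formula Γ
    _∧′_ : Formula Γ → Formula Γ → Formula Γ
    ∃′   : (σ : Sort) → Formula (Γ ▹ σ) → Formula Γ

  Theory : Set (lsuc ℓ)
  Theory = Pred (Formula ε) ℓ

-- Carriers are setoids, and the equality symbol is interpreted by the
-- setoid equality; this provides the quotients needed for imaginaries.
record Structure {ℓ} (L : Language ℓ) c : Set (ℓ ⊔ lsuc c) where
  open Language L
  field
    setoid : Sort → Setoid c c

  ∣_∣ : Sort → Set c
  ∣ σ ∣ = Setoid.Carrier (setoid σ)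

  infix 4 _≈_
  _≈_ : ∀ {σ} → ∣ σ ∣ → ∣ σ ∣ → Set c
  _≈_ {σ} = Setoid._≈_ (setoid σ)

  field
    ⟦_⟧ᶠ     : (f : Fun) → ((j : Fin (arityᶠ f)) → ∣ domᶠ f j ∣) → ∣ codᶠ f ∣
    ⟦_⟧ᴿ     : (R : Rel) → ((j : Fin (arityᴿ R)) → ∣ domᴿ R j ∣) → Set c
    ⟦⟧ᶠ-cong : ∀ f {xs ys} → (∀ j → xs j ≈ ys j) → ⟦ f ⟧ᶠ xs ≈ ⟦ f ⟧ᶠ ys
    ⟦⟧ᴿ-resp : ∀ R {xs ys} → (∀ j → xs j ≈ ys j) → ⟦ R ⟧ᴿ xs → ⟦ R ⟧ᴿ ys

module Semantics {ℓ c : Level} {L : Language ℓ} (M : Structure L c) where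
  open Language L
  open Structure M

  Tuple : ∀ {i} → Ctx i Sort → Set (i ⊔ c)
  Tuple Γ = (x : Index Γ) → ∣ sort Γ x ∣

  infix 4 _≈ₜ_
  _≈ₜ_ : ∀ {i} {Γ : Ctx i Sort} → Tuple Γ → Tuple Γ → Set (i ⊔ c)
  v ≈ₜ w = ∀ x → v x ≈ w x

  infixl 6 _++_
  _++_ : ∀ {i j} {Γ : Ctx i Sort} {Δ : Ctx j Sort} →
         Tuple Γ → Tuple Δ → Tuple (Γ ⊕ Δ)
  v ++ w = [ v , w ]

  infixl 6 _▸_
  _▸_ : ∀ {i} {Γ : Ctx i Sort} {σ} → Tuple Γ → ∣ σ ∣ → Tuple (Γ ▹ σ)
  (v ▸ m) (just x) = v x
  (v ▸ m) nothing  = m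

  eval : ∀ {i} {Γ : Ctx i Sort} {σ} → Term L Γ σ → Tuple Γ → ∣ σ ∣
  eval (var x)    v = v x
  eval (app f ts) v = ⟦ f ⟧ᶠ λ j → eval (ts j) v

  infix 4 ⊨_[_]
  ⊨_[_] : ∀ {i} {Γ : Ctx i Sort} → Formula L Γ → Tuple Γ → Set c
  ⊨ t ≐ u    [ v ] = eval t v ≈ eval u v
  ⊨ rel R ts [ v ] = ⟦ R ⟧ᴿ λ j → eval (ts j) v
  ⊨ ¬′ φ     [ v ] = ¬ (⊨ φ [ v ])
  ⊨ φ ∧′ ψ   [ v ] = (⊨ φ [ v ]) × (⊨ ψ [ v ])
  ⊨ ∃′ σ φ   [ v ] = ∃[ m ] (⊨ φ [ v ▸ m ])

  ≈ₜ-sym : ∀ {i} {Γ : Ctx i Sort} {v w : Tuple Γ} → v ≈ₜ w → w ≈ₜ v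
  ≈ₜ-sym e x = Setoid.sym (setoid _) (e x)

  eval-cong : ∀ {i} {Γ : Ctx i Sort} {σ} (t : Term L Γ σ) {v w : Tuple Γ} →
              v ≈ₜ w → eval t v ≈ eval t w
  eval-cong (var x)    e = e x
  eval-cong (app f ts) e = ⟦⟧ᶠ-cong f λ j → eval-cong (ts j) e

  ⊨-resp : ∀ {i} {Γ : Ctx i Sort} (φ : Formula L Γ) {v w : Tuple Γ} →
           v ≈ₜ w → ⊨ φ [ v ] → ⊨ φ [ w ]
  ⊨-resp (_≐_ {σ} t u) e p = trans (sym (eval-cong t e)) (trans p (eval-cong u e))
    where open Setoid (setoid σ) using (sym; trans)
  ⊨-resp (rel R ts) e p       = ⟦⟧ᴿ-resp R (λ j → eval-cong (ts j) e) p
  ⊨-resp (¬′ φ)     e p       = λ q → p (⊨-resp φ (≈ₜ-sym e) q)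
  ⊨-resp (φ ∧′ ψ)   e (p , q) = ⊨-resp φ e p , ⊨-resp ψ e q
  ⊨-resp (∃′ σ φ)   e (m , p) = m , ⊨-resp φ e′ p
    where
    e′ : _ ▸ m ≈ₜ _ ▸ m
    e′ (just x) = e x
    e′ nothing  = Setoid.refl (setoid σ)

-- "Small" means indexed by a type in Set ℓ, where ℓ is the level of the
-- language; the universe Set ℓ plays the role of the large cardinal κ for
-- which the monster is κ-saturated and strongly κ-homogeneous.

module _ {ℓ c} {L : Language ℓ} (M : Structure L c) where
  open Language L
  open Structure M
  open Semantics M

  infix 4 _⊨ᵀ_
  _⊨ᵀ_ : Theory L → Set (ℓ ⊔ c)
  _⊨ᵀ_ T = ∀ φ → T φ → ⊨ φ [ (λ ()) ]

  Saturated : Set (lsuc ℓ ⊔ c)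
  Saturated =
    (X Θ : Ctx ℓ Sort) (A : Tuple Θ) (p : Pred (Formula L (X ⊕ Θ)) ℓ) →
    (∀ φs → All p φs → ∃[ x ] All (λ φ → ⊨ φ [ x ++ A ]) φs) →
    ∃[ x ] (∀ φ → p φ → ⊨ φ [ x ++ A ])

  record Automorphism : Set (ℓ ⊔ c) where
    field
      bijection : ∀ σ → Inverse (setoid σ) (setoid σ)

    ⟨_⟩ : ∀ {σ} → ∣ σ ∣ → ∣ σ ∣
    ⟨_⟩ {σ} = Inverse.to (bijection σ)

    field
      fun-hom : ∀ f xs → ⟨ ⟦ f ⟧ᶠ xs ⟩ ≈ ⟦ f ⟧ᶠ λ j → ⟨ xs j ⟩
      rel-hom : ∀ R xs → ⟦ R ⟧ᴿ xs ⇔ ⟦ R ⟧ᴿ λ j → ⟨ xs j ⟩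

  StronglyHomogeneous : Set (lsuc ℓ ⊔ c)
  StronglyHomogeneous =
    (X : Ctx ℓ Sort) (a b : Tuple X) →
    (∀ (φ : Formula L X) → ⊨ φ [ a ] ⇔ ⊨ φ [ b ]) →
    Σ[ α ∈ Automorphism ] (∀ x → Automorphism.⟨_⟩ α (a x) ≈ b x)

record MonsterModel {ℓ} {L : Language ℓ} (T : Theory L) c : Set (lsuc (ℓ ⊔ c)) where
  field
    structure           : Structure L c
    models              : structure ⊨ᵀ T
    saturated           : Saturated structure
    stronglyHomogeneous : StronglyHomogeneous structure

-- M^eq has the sorts of M and, for each ∅-definable
-- equivalence relation E on finite tuples, a sort of E-classes with the
-- projection onto it.  A class is given by a representative, with E as
-- the setoid equality.

module Imaginaries {ℓ c : Level} {L : Language ℓ} (M : Structure L c) where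
  open Language L
  open Structure M
  open Semantics M

  record DefinableEquivalence : Set (ℓ ⊔ c) where
    field
      arity         : ℕ
      dom           : Fin arity → Sort
      E             : Formula L (fin dom ⊕ fin dom)
      isEquivalence : IsEquivalence λ (v w : Tuple (fin dom)) → ⊨ E [ v ++ w ]

  open DefinableEquivalence

  eqLanguage : Language (ℓ ⊔ c)
  eqLanguage = record
    { Sort   = Sort ⊎ DefinableEquivalence
    ; Fun    = Fun ⊎ DefinableEquivalence
    ; Rel    = Lift c Rel
    ; arityᶠ = [ arityᶠ , arity ]
    ; domᶠ   = [ (λ f → inj₁ ∘ domᶠ f) , (λ e → inj₁ ∘ dom e) ]
    ; codᶠ   = [ inj₁ ∘ codᶠ , inj₂ ]′
    ; arityᴿ = arityᴿ ∘ lower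
    ; domᴿ   = λ R → inj₁ ∘ domᴿ (lower R)
    }

  quotient : DefinableEquivalence → Setoid c c
  quotient e = record
    { Carrier       = Tuple (fin (dom e))
    ; _≈_           = λ v w → ⊨ E e [ v ++ w ]
    ; isEquivalence = isEquivalence e
    }

  ≈ₜ⇒E : ∀ e {v w : Tuple (fin (dom e))} → v ≈ₜ w → ⊨ E e [ v ++ w ]
  ≈ₜ⇒E e v≈w = ⊨-resp (E e)
    [ (λ x → Setoid.refl (setoid _)) , v≈w ]
    (IsEquivalence.refl (isEquivalence e))

  eqStructure : Structure eqLanguage c
  eqStructure = record
    { setoid   = [ setoid , quotient ]′
    ; ⟦_⟧ᶠ     = [ ⟦_⟧ᶠ , (λ e → id) ]
    ; ⟦_⟧ᴿ     = ⟦_⟧ᴿ ∘ lower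
    ; ⟦⟧ᶠ-cong = [ (λ f → ⟦⟧ᶠ-cong f) , (λ e → ≈ₜ⇒E e) ]
    ; ⟦⟧ᴿ-resp = λ R → ⟦⟧ᴿ-resp (lower R)
    }

infix 9 _ᵉᑫ
_ᵉᑫ : ∀ {ℓ c} {L : Language ℓ} (M : Structure L c) →
      Structure (Imaginaries.eqLanguage M) c
M ᵉᑫ = Imaginaries.eqStructure M

-- `lim` is the supremum of a family, so that every ordinal of cardinality
-- bounded by Set o is represented.
data Ordinal o : Set (lsuc o) where
  zero : Ordinal o
  suc  : Ordinal o → Ordinal o
  lim  : (I : Set o) → (I → Ordinal o) → Ordinal o

-- To be used with M = 𝒞^eq, so that "consistent" can be read as "realised
-- in M".  Small sets are ranges of tuples indexed in Set κ; κ is separate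
-- from the level of L because L^eq lives at a higher level than L.

module Thorn (κ : Level) {ℓ c} {L : Language ℓ} (M : Structure L c) where
  open Language L
  open Semantics M

  -- Keeping ∧ on top of instances avoids renaming variables to merge the
  -- two parameter tuples.
  infixr 7 _∧ᵖ_
  data ParamFormula {i} (X : Ctx i Sort) : Set (i ⊔ ℓ ⊔ c) where
    _⟨_⟩ : ∀ {n} {Y : Fin n → Sort} →
           Formula L (X ⊕ fin Y) → Tuple (fin Y) → ParamFormula X
    _∧ᵖ_ : ParamFormula X → ParamFormula X → ParamFormula X

  infix 4 ⊨ᵖ_[_]
  ⊨ᵖ_[_] : ∀ {i} {X : Ctx i Sort} → ParamFormula X → Tuple X → Set c
  ⊨ᵖ φ ⟨ b ⟩ [ x ] = ⊨ φ [ x ++ b ]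
  ⊨ᵖ φ ∧ᵖ ψ  [ x ] = (⊨ᵖ φ [ x ]) × (⊨ᵖ ψ [ x ])

  Consistent : ∀ {i} {X : Ctx i Sort} → ParamFormula X → Set (i ⊔ c)
  Consistent φ = ∃[ x ] (⊨ᵖ φ [ x ])

  record Type {i} (X : Ctx i Sort) : Set (i ⊔ ℓ ⊔ lsuc (κ ⊔ c)) where
    field
      {Params} : Ctx κ Sort
      params   : Tuple Params
      formulas : Pred (Formula L (X ⊕ Params)) c

  tp : ∀ {i} {X : Ctx i Sort} {Θ : Ctx κ Sort} → Tuple X → Tuple Θ → Type X
  tp a A = record { params = A ; formulas = λ φ → ⊨ φ [ a ++ A ] }

  infix 4 _⊨ₜ_
  _⊨ₜ_ : ∀ {i} {X : Ctx i Sort} → Tuple X → Type X → Set (i ⊔ κ ⊔ ℓ ⊔ c)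
  x ⊨ₜ p = ∀ φ → formulas φ → ⊨ φ [ x ++ params ]
    where open Type p

  module _ {i} {X : Ctx i Sort} where

    Finite : ∀ {r} → Pred (Tuple X) r → Set (i ⊔ c ⊔ r)
    Finite P = ∃[ xs ] (∀ x → P x → Any (x ≈ₜ_) xs)

    Infinite : ∀ {r} → Pred (Tuple X) r → Set (i ⊔ c ⊔ r)
    Infinite P = ¬ Finite P

    Algebraic : Type X → Set (i ⊔ κ ⊔ ℓ ⊔ c)
    Algebraic p = Finite (_⊨ₜ p)

  -- The family {δ(x,a)}, a ∈ P, is indexed by the tuples a themselves: no
  -- k distinct a ∈ P have a common solution.
  KInconsistent : ∀ {i r n} {X : Ctx i Sort} {Y : Fin n → Sort} →
                  ℕ → Formula L (X ⊕ fin Y) → Pred (Tuple (fin Y)) r →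
                  Set (i ⊔ c ⊔ r)
  KInconsistent k δ P =
    ∀ (a : Fin k → Tuple (fin _)) → (∀ j → P (a j)) →
    (∀ j₁ j₂ → ¬ j₁ ≡ j₂ → ¬ (a j₁ ≈ₜ a j₂)) →
    ¬ (∃[ x ] (∀ j → ⊨ δ [ x ++ a j ]))

  module _ {i} {X : Ctx i Sort} where

    StronglyDivides : ∀ {n} {Y : Fin n → Sort} {Θ : Ctx κ Sort} →
                      Formula L (X ⊕ fin Y) → Tuple (fin Y) → Tuple Θ →
                      Set (i ⊔ κ ⊔ ℓ ⊔ c)
    StronglyDivides δ a A =
      ¬ Algebraic (tp a A) × ∃[ k ] KInconsistent k δ (_⊨ₜ tp a A)

    ThornDivides : ∀ {n} {Y : Fin n → Sort} {Θ : Ctx κ Sort} →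
                   Formula L (X ⊕ fin Y) → Tuple (fin Y) → Tuple Θ →
                   Set (i ⊔ lsuc κ ⊔ ℓ ⊔ c)
    ThornDivides δ a A =
      Σ[ Z ∈ Ctx κ Sort ] Σ[ c ∈ Tuple Z ] StronglyDivides δ a (A ++ c)

    record ThornDividing {Θ : Ctx κ Sort} (A : Tuple Θ) :
                         Set (i ⊔ lsuc κ ⊔ ℓ ⊔ c) where
      field
        {n}     : ℕ
        {Y}     : Fin n → Sort
        δ       : Formula L (X ⊕ fin Y)
        a       : Tuple (fin Y)
        divides : ThornDivides δ a A

    ThornForks : ∀ {Θ : Ctx κ Sort} → ParamFormula X → Tuple Θ →
                 Set (i ⊔ lsuc κ ⊔ ℓ ⊔ c)
    ThornForks φ A =
      Σ[ ds ∈ List (ThornDividing A) ]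
        (∀ x → ⊨ᵖ φ [ x ] →
          Any (λ d → ⊨ ThornDividing.δ d [ x ++ ThornDividing.a d ]) ds)

    TypeThornForks : ∀ {Θ : Ctx κ Sort} → Type X → Tuple Θ →
                     Set (i ⊔ lsuc κ ⊔ ℓ ⊔ c)
    TypeThornForks p A =
      Σ[ φ ∈ ParamFormula X ] (∀ x → x ⊨ₜ p → ⊨ᵖ φ [ x ]) × ThornForks φ A

  ThornForkingSymmetric : Set (lsuc κ ⊔ ℓ ⊔ c)
  ThornForkingSymmetric =
    (X Y Θ : Ctx κ Sort) (a : Tuple X) (b : Tuple Y) (A : Tuple Θ) →
    (¬ TypeThornForks (tp a (A ++ b)) A) ⇔ (¬ TypeThornForks (tp b (A ++ a)) A)

  module _ {m n} {X : Fin m → Sort} {Y : Fin n → Sort} {Z : Ctx κ Sort}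
           (Δ : List (Formula L (fin X ⊕ fin Y)))
           (Π : List (Formula L (fin Y ⊕ Z)))
           (k : ℕ)
           where

    -- th(φ, Δ, Π, k) ≥ α
    RankAtLeast : ∀ {o} → ParamFormula (fin X) → Ordinal o → Set (κ ⊔ ℓ ⊔ c ⊔ o)
    RankAtLeast {o} φ zero = Lift (κ ⊔ ℓ ⊔ o) (Consistent φ)
    RankAtLeast φ (suc α) =
      ∃[ δ ] ∃[ π ] δ ∈ Δ × π ∈ Π × Σ[ c ∈ Tuple Z ]
        (Infinite λ a → (⊨ π [ a ++ c ]) × RankAtLeast (φ ∧ᵖ δ ⟨ a ⟩) α)
        × KInconsistent k δ (λ a → ⊨ π [ a ++ c ])
    -- Consistency is implied by the other conjunct unless I is empty.
    RankAtLeast φ (lim I α) = Consistent φ × (∀ j → RankAtLeast φ (α j))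

    RankEquals : ∀ {o} → ParamFormula (fin X) → Ordinal o → Set (κ ⊔ ℓ ⊔ c ⊔ o)
    RankEquals φ α = RankAtLeast φ α × ¬ RankAtLeast φ (suc α)

  -- An inconsistent formula has no rank ≥ 0 and is disregarded.
  Rosy : Set (lsuc (κ ⊔ ℓ ⊔ c))
  Rosy =
    ∀ {m n} {X : Fin m → Sort} {Y : Fin n → Sort} {Z : Ctx κ Sort}
    (Δ : List (Formula L (fin X ⊕ fin Y))) (Π : List (Formula L (fin Y ⊕ Z)))
    (k : ℕ) (φ : ParamFormula (fin X)) → Consistent φ →
    Σ[ α ∈ Ordinal (κ ⊔ ℓ ⊔ c) ] RankEquals Δ Π k φ α

{-# OPTIONS --safe #-}
-- Rosy ⇒ symmetric.  Suppose that tp(a/Ab) does not thorn-fork over A while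
-- ψ(y,a) ∈ tp(b/Aa) implies ⋁ⱼ δⱼ(y,dⱼ), where δⱼ(y,dⱼ) strongly divides over
-- A eⱼ.  Iterating extension gives realisations aᵢ of tp(a/Ab), listed with
-- each new one first, and (dⁱ,eⁱ) with aᵢdⁱeⁱ ≡ ade over A such that dⁱⱼ is not
-- algebraic over A eⁱⱼ a₀…aᵢ₋₁.  Put Ψᵢ = ψ(y,a₀) ∧ … ∧ ψ(y,aᵢ).  Then Ψᵢ₊₁
-- implies ⋁ⱼ (Ψᵢ ∧ δⱼ(y,dⁱ⁺¹ⱼ)), and each dⁱ⁺¹ⱼ has infinitely many conjugates
-- over the parameters of Ψᵢ.  Since the rank of a disjunction is attained by
-- a disjunct, th(Ψᵢ) ≥ α + 1 as soon as th(Ψᵢ₊₁) ≥ α, so all Ψᵢ have rank ≥ α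
-- for every ordinal α.
--
-- Symmetric ⇒ rosy.  If a formula has rank ≥ r for all r ∈ ℕ, compactness
-- yields x and a sequence βᵢ = (dᵢ,cᵢ) such that δ(x,dᵢ) holds, π(·;cᵢ) makes δ
-- k-inconsistent, and dᵢ is not algebraic over cᵢ β₀…βᵢ₋₁; only finitely many
-- values of dᵢ have to be avoided at a time, and each node of the rank offers
-- infinitely many.  Let A be the sequence and β = (d,c) a limit of it over A x.
-- Then tp(β/Ax) is finitely satisfiable in A, hence does not thorn-fork over A,
-- whereas δ(x,d) strongly divides over A c.

module Submission where

open import Axiom.ExcludedMiddle using (ExcludedMiddle)
open import Axiom.Extensionality.Propositional using (Extensionality)
open import Data.Empty using (⊥)
open import Data.Fin as Fin using (Fin; zero; suc)
import Data.Fin.Properties as Fin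
open import Data.List using (List; []; _∷_; map; concat; tabulate; allFin; cartesianProduct; length; lookup)
  renaming (_++_ to _++ˡ_)
open import Data.List.Membership.Propositional using (_∈_)
open import Data.List.Membership.Propositional.Properties
  using (∈-++⁺ˡ; ∈-++⁺ʳ; ∈-concat⁺′; ∈-tabulate⁺; ∈-map⁺; ∈-allFin;
    ∈-cartesianProduct⁺; ∈-cartesianProduct⁻)
open import Data.List.Relation.Unary.All as All using (All; []; _∷_)
import Data.List.Relation.Unary.All.Properties as All
open import Data.List.Relation.Unary.Any as Any using (Any; here; there; index)
import Data.List.Relation.Unary.Any.Properties as Any
open import Data.Maybe using (Maybe; just; nothing)
open import Data.Nat using (ℕ; zero; suc; _≤_; _<_; _+_; z≤n; s≤s) renaming (_⊔_ to _⊔ⁿ_)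
import Data.Nat.Properties as ℕ
open import Data.Product using (Σ; Σ-syntax; ∃; ∃-syntax; _×_; _,_; proj₁; proj₂)
open import Data.Product.Function.NonDependent.Propositional using (_×-⇔_)
open import Data.Sum using (_⊎_; inj₁; inj₂)
open import Data.Unit using (⊤)
open import Function using (_∘_; case_of_)
open import Function.Bundles using (_⇔_; mk⇔; Equivalence)
open import Function.Construct.Composition using (_⇔-∘_)
open import Function.Construct.Identity using (⇔-id)
open import Function.Related.TypeIsomorphisms using (¬-cong-⇔)
open import Level using (Level; Lift; lift; _⊔_; 0ℓ; Setω) renaming (suc to lsuc)
open import Relation.Binary.Bundles using (Setoid)
open import Relation.Binary.PropositionalEquality using (_≡_; refl; sym; trans; cong; subst)
open import Relation.Nullary using (¬_; Dec; yes; no; contradiction)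
open import Relation.Nullary.Decidable using (True; toWitness; fromWitness)
open import Relation.Unary using (Pred)
open import Defs

open Equivalence using (to; from)

-- Ranks and dividing formulas take finite tuples, whereas realisations, bases and parameter sets
-- may be infinite. So formulas are moved to the finitely many variables that occur in them, and the
-- others keep default values, since a sort may be empty. Freeness and non-forking are not given by
-- small sets of formulas over the parameters at hand; compactness therefore yields a point in the
-- closure of each condition (`Adherent`), which is enough because any failure is witnessed by a
-- single formula. Conjugation is inclusion of types (`_≼_`), extended by saturation. New
-- realisations are put in front because independence is available in one direction only: if the
-- type of the new one over the rest does not thorn-fork over `A`, the old divisors stay
-- non-algebraic over it. Put behind the others, its own divisors would have to be free from the old
-- realisations, which is the converse independence.

Classical : Setω
Classical = ∀ {p : Level} → ExcludedMiddle p

module _ (em : Classical) where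

  by-contradiction : ∀ {p} {P : Set p} → ¬ ¬ P → P
  by-contradiction {P = P} ¬¬p with em {P = P}
  ... | yes p = p
  ... | no ¬p = contradiction ¬p ¬¬p

-- Finite selections of variables

record Selection {i} (I : Set i) : Set i where
  field
    size      : ℕ
    pick      : Fin size → I
    injective : ∀ {p q} → pick p ≡ pick q → p ≡ q

open Selection

infix 4 _∈ˢ_
_∈ˢ_ : ∀ {i} {I : Set i} → I → Selection I → Set i
x ∈ˢ S = ∃[ p ] pick S p ≡ x

module _ (em : Classical) {i} {I : Set i} where

  -- Duplicates have to go because `extend` writes values back to the selected variables: a variable
  -- picked twice could receive two values.
  select : (l : List I) → Σ[ S ∈ Selection I ] (∀ x → x ∈ l → x ∈ˢ S)
  select [] = record { size = 0 ; pick = λ () ; injective = λ { {()} } } , λ x ()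
  select (y ∷ l) with select l
  ... | S , cover with em {P = y ∈ˢ S}
  ...   | yes y∈S = S , λ { x (here refl) → y∈S ; x (there x∈l) → cover x x∈l }
  ...   | no  y∉S = S′ , λ { x (here refl) → zero , refl
                          ; x (there x∈l) → suc (proj₁ (cover x x∈l)) , proj₂ (cover x x∈l) }
    where
    pick′ : Fin (suc (size S)) → I
    pick′ zero    = y
    pick′ (suc p) = pick S p
    inj′ : ∀ {p q} → pick′ p ≡ pick′ q → p ≡ q
    inj′ {zero}  {zero}  e = refl
    inj′ {zero}  {suc q} e = contradiction (q , sym e) y∉S
    inj′ {suc p} {zero}  e = contradiction (p , e) y∉S
    inj′ {suc p} {suc q} e = cong suc (injective S e)
    S′ : Selection I
    S′ = record { size = suc (size S) ; pick = pick′ ; injective = inj′ }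

justs : ∀ {i} {I : Set i} → List (Maybe I) → List I
justs []             = []
justs (just x ∷ l)   = x ∷ justs l
justs (nothing ∷ l)  = justs l

∈-justs : ∀ {i} {I : Set i} {x : I} {l} → just x ∈ l → x ∈ justs l
∈-justs {l = just _ ∷ l}  (here refl) = here refl
∈-justs {l = just _ ∷ l}  (there p)   = there (∈-justs p)
∈-justs {l = nothing ∷ l} (there p)   = ∈-justs p

-- Occurrences of variables, substitution and its semantics

Sub : ∀ {ℓ i j} (L : Language ℓ) → Ctx i (Language.Sort L) → Ctx j (Language.Sort L) → Set (ℓ ⊔ i ⊔ j)
Sub L Γ Δ = ∀ x → Term L Δ (sort Γ x)

module _ {ℓ} {L : Language ℓ} where
  open Language L

  infix 4 _∈ᵗ_ _∈ᶠ_

  _∈ᵗ_ : ∀ {i} {Γ : Ctx i Sort} {σ} → Index Γ → Term L Γ σ → Set i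
  x ∈ᵗ var y    = x ≡ y
  x ∈ᵗ app f ts = ∃[ j ] (x ∈ᵗ ts j)

  _∈ᶠ_ : ∀ {i} {Γ : Ctx i Sort} → Index Γ → Formula L Γ → Set i
  x ∈ᶠ t ≐ u    = x ∈ᵗ t ⊎ x ∈ᵗ u
  x ∈ᶠ rel R ts = ∃[ j ] (x ∈ᵗ ts j)
  x ∈ᶠ ¬′ φ     = x ∈ᶠ φ
  x ∈ᶠ φ ∧′ ψ   = x ∈ᶠ φ ⊎ x ∈ᶠ ψ
  x ∈ᶠ ∃′ σ φ   = just x ∈ᶠ φ

  private
    union : ∀ {i a} {I : Set i} {n} {P : Fin n → I → Set a} →
            (∀ j → Σ[ l ∈ List I ] (∀ x → P j x → x ∈ l)) →
            Σ[ l ∈ List I ] (∀ x → ∃[ j ] P j x → x ∈ l)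
    union ls = concat (tabulate (proj₁ ∘ ls)) , λ { x (j , p) →
      ∈-concat⁺′ (proj₂ (ls j) x p) (∈-tabulate⁺ j) }

    union₂ : ∀ {i a b} {I : Set i} {P : I → Set a} {Q : I → Set b} →
             Σ[ l ∈ List I ] (∀ x → P x → x ∈ l) →
             Σ[ l ∈ List I ] (∀ x → Q x → x ∈ l) →
             Σ[ l ∈ List I ] (∀ x → P x ⊎ Q x → x ∈ l)
    union₂ (l , p) (m , q) = l ++ˡ m , λ { x (inj₁ u) → ∈-++⁺ˡ (p x u)
                                       ; x (inj₂ u) → ∈-++⁺ʳ l (q x u) }

  variables-term : ∀ {i} {Γ : Ctx i Sort} {σ} (t : Term L Γ σ) →
                   Σ[ l ∈ List (Index Γ) ] (∀ x → x ∈ᵗ t → x ∈ l)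
  variables-term (var y)    = y ∷ [] , λ { x refl → here refl }
  variables-term (app f ts) = union (λ j → variables-term (ts j))

  variables : ∀ {i} {Γ : Ctx i Sort} (φ : Formula L Γ) →
              Σ[ l ∈ List (Index Γ) ] (∀ x → x ∈ᶠ φ → x ∈ l)
  variables (t ≐ u)    = union₂ (variables-term t) (variables-term u)
  variables (rel R ts) = union (λ j → variables-term (ts j))
  variables (¬′ φ)     = variables φ
  variables (φ ∧′ ψ)   = union₂ (variables φ) (variables ψ)
  variables (∃′ σ φ)   = justs (proj₁ (variables φ)) , λ x p → ∈-justs (proj₂ (variables φ) (just x) p)

  -- Substitutions only have to be defined on the variables that occur;
  -- this also moves a formula to a finite subcontext.
  subᵗ : ∀ {i j} {Γ : Ctx i Sort} {Δ : Ctx j Sort} {σ} (t : Term L Γ σ) →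
         (∀ x → x ∈ᵗ t → Term L Δ (sort Γ x)) → Term L Δ σ
  subᵗ (var x)    s = s x refl
  subᵗ (app f ts) s = app f λ j → subᵗ (ts j) λ x p → s x (j , p)

  weaken : ∀ {i} {Γ : Ctx i Sort} {σ τ} → Term L Γ σ → Term L (Γ ▹ τ) σ
  weaken t = subᵗ t λ x _ → var (just x)

  under : ∀ {i j a} {Γ : Ctx i Sort} {Δ : Ctx j Sort} {σ} (P : Index (Γ ▹ σ) → Set a) →
          (∀ x → P (just x) → Term L Δ (sort Γ x)) → ∀ x → P x → Term L (Δ ▹ σ) (sort (Γ ▹ σ) x)
  under P s (just x) p = weaken (s x p)
  under P s nothing  p = var nothing

  subᶠ : ∀ {i j} {Γ : Ctx i Sort} {Δ : Ctx j Sort} (φ : Formula L Γ) →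
         (∀ x → x ∈ᶠ φ → Term L Δ (sort Γ x)) → Formula L Δ
  subᶠ (t ≐ u)    s = subᵗ t (λ x → s x ∘ inj₁) ≐ subᵗ u (λ x → s x ∘ inj₂)
  subᶠ (rel R ts) s = rel R λ j → subᵗ (ts j) λ x p → s x (j , p)
  subᶠ (¬′ φ)     s = ¬′ subᶠ φ s
  subᶠ (φ ∧′ ψ)   s = subᶠ φ (λ x → s x ∘ inj₁) ∧′ subᶠ ψ (λ x → s x ∘ inj₂)
  subᶠ (∃′ σ φ)   s = ∃′ σ (subᶠ φ (under (_∈ᶠ φ) s))

  sub : ∀ {i j} {Γ : Ctx i Sort} {Δ : Ctx j Sort} → Formula L Γ → Sub L Γ Δ → Formula L Δ
  sub φ s = subᶠ φ λ x _ → s x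

  exchange : ∀ {i j} {Γ : Ctx i Sort} {Δ : Ctx j Sort} → Sub L (Γ ⊕ Δ) (Δ ⊕ Γ)
  exchange (inj₁ x) = var (inj₂ x)
  exchange (inj₂ y) = var (inj₁ y)

  rightˢ : ∀ {h i j} {X : Ctx h Sort} {Γ : Ctx i Sort} {Δ : Ctx j Sort} → Sub L Γ Δ → Sub L (X ⊕ Γ) (X ⊕ Δ)
  rightˢ s (inj₁ x) = var (inj₁ x)
  rightˢ s (inj₂ y) = subᵗ (s y) λ x _ → var (inj₂ x)

  infixr 7 _∧⁺_
  _∧⁺_ : ∀ {i} {Γ : Ctx i Sort} → Formula L Γ → List (Formula L Γ) → Formula L Γ
  φ ∧⁺ []       = φ
  φ ∧⁺ (ψ ∷ ψs) = φ ∧′ (ψ ∧⁺ ψs)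

  ∃ᵇ : ∀ {i} {Γ : Ctx i Sort} n {W : Fin n → Sort} → Formula L (Γ ⊕ fin W) → Formula L Γ
  ∃ᵇ zero φ        = sub φ λ { (inj₁ x) → var x ; (inj₂ ()) }
  ∃ᵇ (suc n) {W} φ = ∃′ (W zero) (∃ᵇ n {W ∘ suc} (sub φ λ
    { (inj₁ x)       → var (inj₁ (just x))
    ; (inj₂ zero)    → var (inj₁ nothing)
    ; (inj₂ (suc q)) → var (inj₂ q) }))

module Sub-semantics {ℓ c} {L : Language ℓ} (M : Structure L c) where
  open Language L
  open Structure M
  open Semantics M

  ≈-refl : ∀ {σ} {x : ∣ σ ∣} → x ≈ x
  ≈-refl = Setoid.refl (setoid _)

  ≈-sym : ∀ {σ} {x y : ∣ σ ∣} → x ≈ y → y ≈ x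
  ≈-sym = Setoid.sym (setoid _)

  ≈-trans : ∀ {σ} {x y z : ∣ σ ∣} → x ≈ y → y ≈ z → x ≈ z
  ≈-trans = Setoid.trans (setoid _)

  ≡⇒≈ : ∀ {σ} {x y : ∣ σ ∣} → x ≡ y → x ≈ y
  ≡⇒≈ refl = ≈-refl

  eval-sub : ∀ {i j} {Γ : Ctx i Sort} {Δ : Ctx j Sort} {σ} (t : Term L Γ σ)
             {s : ∀ x → x ∈ᵗ t → Term L Δ (sort Γ x)} {v : Tuple Δ} {w : Tuple Γ} →
             (∀ x p → eval (s x p) v ≈ w x) → eval (subᵗ t s) v ≈ eval t w
  eval-sub (var x)    e = e x refl
  eval-sub (app f ts) e = ⟦⟧ᶠ-cong f λ j → eval-sub (ts j) λ x p → e x (j , p)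

  ⊨-subᶠ : ∀ {i j} {Γ : Ctx i Sort} {Δ : Ctx j Sort} (φ : Formula L Γ)
           {s : ∀ x → x ∈ᶠ φ → Term L Δ (sort Γ x)} {v : Tuple Δ} {w : Tuple Γ} →
           (∀ x p → eval (s x p) v ≈ w x) → (⊨ subᶠ φ s [ v ]) ⇔ (⊨ φ [ w ])
  ⊨-subᶠ (t ≐ u) {s} {v} {w} e = mk⇔
    (λ h → ≈-trans (≈-sym et) (≈-trans h eu))
    (λ h → ≈-trans et (≈-trans h (≈-sym eu)))
    where
    et = eval-sub t {v = v} {w} λ x p → e x (inj₁ p)
    eu = eval-sub u {v = v} {w} λ x p → e x (inj₂ p)
  ⊨-subᶠ (rel R ts) {s} {v} {w} e = mk⇔
    (⟦⟧ᴿ-resp R es) (⟦⟧ᴿ-resp R λ j → ≈-sym (es j))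
    where
    es = λ j → eval-sub (ts j) {v = v} {w} λ x p → e x (j , p)
  ⊨-subᶠ (¬′ φ)   e = ¬-cong-⇔ (⊨-subᶠ φ e)
  ⊨-subᶠ (φ ∧′ ψ) e = ⊨-subᶠ φ (λ x p → e x (inj₁ p)) ×-⇔ ⊨-subᶠ ψ (λ x p → e x (inj₂ p))
  ⊨-subᶠ (∃′ σ φ) {s} {v} {w} e = mk⇔
    (λ { (m , h) → m , to   (⊨-subᶠ φ (e′ m)) h })
    (λ { (m , h) → m , from (⊨-subᶠ φ (e′ m)) h })
    where
    e′ : ∀ m x p → eval (under (_∈ᶠ φ) s x p) (v ▸ m) ≈ (w ▸ m) x
    e′ m (just x) p = ≈-trans (eval-sub (s x p) λ y _ → ≈-refl) (e x p)
    e′ m nothing  p = ≈-refl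

  ⊨-sub : ∀ {i j} {Γ : Ctx i Sort} {Δ : Ctx j Sort} (φ : Formula L Γ)
          {s : Sub L Γ Δ} {v : Tuple Δ} {w : Tuple Γ} →
          (∀ x → eval (s x) v ≡ w x) → (⊨ sub φ s [ v ]) ⇔ (⊨ φ [ w ])
  ⊨-sub φ e = ⊨-subᶠ φ λ x _ → ≡⇒≈ (e x)

  ⊨-≡ : ∀ {i} {Γ : Ctx i Sort} (φ : Formula L Γ) {v w : Tuple Γ} →
        (∀ x → v x ≡ w x) → ⊨ φ [ v ] → ⊨ φ [ w ]
  ⊨-≡ φ e = ⊨-resp φ λ x → ≡⇒≈ (e x)

  ⊨-exchange : ∀ {i j} {Γ : Ctx i Sort} {Δ : Ctx j Sort} (φ : Formula L (Γ ⊕ Δ))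
               {v : Tuple Γ} {w : Tuple Δ} → (⊨ sub φ exchange [ w ++ v ]) ⇔ (⊨ φ [ v ++ w ])
  ⊨-exchange φ = ⊨-sub φ λ { (inj₁ x) → refl ; (inj₂ y) → refl }

  ⊨-right : ∀ {h i j} {X : Ctx h Sort} {Γ : Ctx i Sort} {Δ : Ctx j Sort} (φ : Formula L (X ⊕ Γ))
            {s : Sub L Γ Δ} {x : Tuple X} {v : Tuple Δ} {w : Tuple Γ} →
            (∀ y → eval (s y) v ≡ w y) → (⊨ sub φ (rightˢ s) [ x ++ v ]) ⇔ (⊨ φ [ x ++ w ])
  ⊨-right φ {s} {x} {v} e = ⊨-subᶠ φ λ
    { (inj₁ z) _ → ≈-refl
    ; (inj₂ y) _ → ≈-trans (eval-sub (s y) {v = x ++ v} {v} λ _ _ → ≈-refl) (≡⇒≈ (e y)) }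

  ⊨-∧⁺ : ∀ {i} {Γ : Ctx i Sort} φ (φs : List (Formula L Γ)) {v : Tuple Γ} →
         (⊨ φ ∧⁺ φs [ v ]) ⇔ All (λ ψ → ⊨ ψ [ v ]) (φ ∷ φs)
  ⊨-∧⁺ φ []       = mk⇔ (_∷ []) All.head
  ⊨-∧⁺ φ (ψ ∷ ψs) = mk⇔ (λ { (h , hs) → h ∷ to (⊨-∧⁺ ψ ψs) hs })
                        (λ { (h ∷ hs) → h , from (⊨-∧⁺ ψ ψs) hs })

  ⊨-∃ᵇ : ∀ {i} {Γ : Ctx i Sort} n {W : Fin n → Sort} (φ : Formula L (Γ ⊕ fin W)) {v : Tuple Γ} →
         (⊨ ∃ᵇ n φ [ v ]) ⇔ (∃[ w ] (⊨ φ [ v ++ w ]))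
  ⊨-∃ᵇ zero φ {v} = mk⇔
    (λ h → (λ ()) , to (⊨-sub φ λ { (inj₁ x) → refl ; (inj₂ ()) }) h)
    (λ { (w , h) → from (⊨-sub φ λ { (inj₁ x) → refl ; (inj₂ ()) }) h })
  ⊨-∃ᵇ (suc n) {W} φ {v} = mk⇔
    (λ { (m , h) → let w , h′ = to (⊨-∃ᵇ n {W ∘ suc} _) h in
           cons m w , to (⊨-sub φ λ { (inj₁ x) → refl ; (inj₂ zero) → refl ; (inj₂ (suc q)) → refl }) h′ })
    (λ { (w , h) → w zero , from (⊨-∃ᵇ n {W ∘ suc} _)
           (w ∘ suc , from (⊨-sub φ λ { (inj₁ x) → refl ; (inj₂ zero) → refl ; (inj₂ (suc q)) → refl }) h) })
    where
    cons : ∣ W zero ∣ → Tuple (fin (W ∘ suc)) → Tuple (fin W)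
    cons m w zero    = m
    cons m w (suc q) = w q

-- Definable predicates

Copies : ∀ {a i s} {S : Set s} → Set a → Ctx i S → Ctx (a ⊔ i) S
Copies I Γ = ctx (I × Index Γ) (sort Γ ∘ proj₂)

infixl 7 _↾_
_↾_ : ∀ {i s} {S : Set s} (Γ : Ctx i S) → Selection (Index Γ) → Ctx 0ℓ S
Γ ↾ S = fin (sort Γ ∘ pick S)

Enumeration : ∀ {i} → Set i → Set i
Enumeration I = Σ[ S ∈ Selection I ] (∀ x → x ∈ˢ S)

inj₂s : ∀ {a b} {A : Set a} {B : Set b} → List (A ⊎ B) → List B
inj₂s []           = []
inj₂s (inj₁ x ∷ l) = inj₂s l
inj₂s (inj₂ x ∷ l) = x ∷ inj₂s l

∈-inj₂s : ∀ {a b} {A : Set a} {B : Set b} {x : B} {l : List (A ⊎ B)} → inj₂ x ∈ l → x ∈ inj₂s l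
∈-inj₂s {l = inj₁ _ ∷ l} (there p)   = ∈-inj₂s p
∈-inj₂s {l = inj₂ _ ∷ l} (here refl) = here refl
∈-inj₂s {l = inj₂ _ ∷ l} (there p)   = there (∈-inj₂s p)

module Definability (em : Classical) {ℓ c} {L : Language ℓ} (M : Structure L c) where
  open Language L
  open Structure M
  open Semantics M
  open Sub-semantics M

  enumerate : ∀ {i} {I : Set i} (l : List I) → (∀ x → x ∈ l) → Enumeration I
  enumerate l all = let S , cover = select em l in S , λ x → cover x (all x)

  enumerate-Fin : ∀ {n} → Enumeration (Fin n)
  enumerate-Fin {n} = enumerate (allFin n) ∈-allFin

  enumerate-Σ : ∀ {i j} {J : Set j} {I : J → Set i} →
                Enumeration J → (∀ j → Enumeration (I j)) → Enumeration (Σ J I)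
  enumerate-Σ {J = J} {I} (S , s) T = enumerate
    (concat (map row (allFin (size S)))) λ { (j , x) → member (s j) (proj₂ (T j) x) }
    where
    row : Fin (size S) → List (Σ J I)
    row p = map (λ q → pick S p , pick (proj₁ (T (pick S p))) q) (allFin _)
    member : ∀ {j x} → j ∈ˢ S → x ∈ˢ proj₁ (T j) → (j , x) ∈ concat (map row (allFin _))
    member (p , refl) (q , refl) = ∈-concat⁺′ (∈-map⁺ _ (∈-allFin q)) (∈-map⁺ row (∈-allFin p))

  parameters : ∀ {i j} {Γ : Ctx i Sort} {Δ : Ctx j Sort} (φ : Formula L (Γ ⊕ Δ)) →
               Σ[ S ∈ Selection (Index Δ) ] (∀ x → inj₂ x ∈ᶠ φ → x ∈ˢ S)
  parameters φ =
    let l , vars = variables φ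
        S , cover = select em (inj₂s l)
    in S , λ x p → cover x (∈-inj₂s (vars (inj₂ x) p))

  module _ {j} {P : Ctx j Sort} (S : Selection (Index P)) where

    at : ∀ {i} {Γ : Ctx i Sort} {x} → x ∈ˢ S → Term L (Γ ⊕ P ↾ S) (sort P x)
    at (p , refl) = var (inj₂ p)

    eval-at : ∀ {i} {Γ : Ctx i Sort} {x} (p : x ∈ˢ S) {v : Tuple Γ} {t : Tuple (P ↾ S)} {z : Tuple P} →
              (∀ q → t q ≈ z (pick S q)) → eval (at {Γ = Γ} p) (v ++ t) ≈ z x
    eval-at (p , refl) e = e p

    module _ {i} {Γ : Ctx i Sort} (φ : Formula L (Γ ⊕ P)) (cover : ∀ x → inj₂ x ∈ᶠ φ → x ∈ˢ S) where

      finitize-sub : ∀ x → x ∈ᶠ φ → Term L (Γ ⊕ P ↾ S) (sort (Γ ⊕ P) x)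
      finitize-sub (inj₁ x) p = var (inj₁ x)
      finitize-sub (inj₂ y) p = at (cover y p)

      -- A formula mentions finitely many of the parameters `P`, and `ParamFormula` and dividing
      -- formulas admit no more.
      finitize : Formula L (Γ ⊕ P ↾ S)
      finitize = subᶠ φ finitize-sub

      ⊨-finitize : {v : Tuple Γ} {t : Tuple (P ↾ S)} {z : Tuple P} → (∀ q → t q ≈ z (pick S q)) →
                   (⊨ finitize [ v ++ t ]) ⇔ (⊨ φ [ v ++ z ])
      ⊨-finitize {v} {t} {z} e = ⊨-subᶠ φ λ
        { (inj₁ x) p → ≈-refl ; (inj₂ y) p → eval-at (cover y p) {v = v} {t} {z} e }

    -- The default may use the proof that the variable is not selected, so it is vacuous when `S`
    -- exhausts the index type and no element of a sort is at hand.
    extend : Tuple (P ↾ S) → (∀ x → ¬ x ∈ˢ S → ∣ sort P x ∣) → Tuple P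
    extend t g x with em {P = x ∈ˢ S}
    ... | yes (p , refl) = t p
    ... | no  x∉S        = g x x∉S

    extend-in : ∀ t g p → extend t g (pick S p) ≡ t p
    extend-in t g p with em {P = pick S p ∈ˢ S}
    ... | no x∉S = contradiction (p , refl) x∉S
    -- Excluded middle returns some position `q`, not necessarily `p`. Injectivity identifies the
    -- two, and the remaining loop `e` is `refl` by axiom K.
    ... | yes (q , e) with injective S e
    ...   | refl with e
    ...     | refl = refl

  -- Predicates keep their Agda form; the formula is carried along so that they can be transferred
  -- along types and limits.
  record Def {i r} (Γ : Ctx i Sort) (P : Tuple Γ → Set r) : Set (i ⊔ r ⊔ ℓ ⊔ c) where
    constructor def
    field
      formula : Formula L Γ
      defines : ∀ v → (⊨ formula [ v ]) ⇔ P v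

    holds : ∀ {v} → P v → ⊨ formula [ v ]
    holds = from (defines _)

    meaning : ∀ {v} → ⊨ formula [ v ] → P v
    meaning = to (defines _)

  open Def public

  ⟦_⟧ : ∀ {i} {Γ : Ctx i Sort} (φ : Formula L Γ) → Def Γ (λ v → ⊨ φ [ v ])
  ⟦ φ ⟧ = def φ λ v → ⇔-id _

  module _ {i} {Γ : Ctx i Sort} where

    mapᵈ : ∀ {r r′} {P : Tuple Γ → Set r} {Q : Tuple Γ → Set r′} → Def Γ P → (∀ v → P v ⇔ Q v) → Def Γ Q
    mapᵈ (def φ d) e = def φ λ v → e v ⇔-∘ d v

    ¬ᵈ_ : ∀ {r} {P : Tuple Γ → Set r} → Def Γ P → Def Γ (λ v → ¬ P v)
    ¬ᵈ (def φ d) = def (¬′ φ) λ v → ¬-cong-⇔ (d v)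

    infixr 7 _×ᵈ_
    _×ᵈ_ : ∀ {r r′} {P : Tuple Γ → Set r} {Q : Tuple Γ → Set r′} →
           Def Γ P → Def Γ Q → Def Γ (λ v → P v × Q v)
    def φ d ×ᵈ def ψ e = def (φ ∧′ ψ) λ v → d v ×-⇔ e v

    ≈ᵈ : ∀ {σ} (t u : Term L Γ σ) → Def Γ (λ v → eval t v ≈ eval u v)
    ≈ᵈ t u = ⟦ t ≐ u ⟧

    ⊤ᵈ : Formula L Γ → Def Γ (λ _ → ⊤)
    ⊤ᵈ φ = def (¬′ (φ ∧′ ¬′ φ)) λ v → mk⇔ _ λ _ (p , ¬p) → ¬p p

    -- The additional formula covers the empty conjunction: a language may
    -- have no formula at all in a given context.
    ∀ᵈ : ∀ {r n} {P : Fin n → Tuple Γ → Set r} → Formula L Γ →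
         (∀ j → Def Γ (P j)) → Def Γ (λ v → ∀ j → P j v)
    ∀ᵈ {n = zero}  φ d = mapᵈ (⊤ᵈ φ) λ v → mk⇔ (λ _ ()) _
    ∀ᵈ {n = suc n} φ d = mapᵈ (d zero ×ᵈ ∀ᵈ φ (d ∘ suc)) λ v →
      mk⇔ (λ { (p , ps) zero → p ; (p , ps) (suc j) → ps j }) (λ ps → ps zero , ps ∘ suc)

    Πᵈ : ∀ {a r} {I : Set a} {P : I → Tuple Γ → Set r} → Enumeration I → Formula L Γ →
         (∀ j → Def Γ (P j)) → Def Γ (λ v → ∀ j → P j v)
    Πᵈ {P = P} (S , s) φ d = mapᵈ (∀ᵈ φ (d ∘ pick S)) λ v →
      mk⇔ (λ ps j → let p , e = s j in subst (λ j → P j v) e (ps p)) (_∘ pick S)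

    -- The premise does not depend on the valuation, so it is decided once, outside the language.
    →ᵈ : ∀ {a r} {A : Set a} {P : Tuple Γ → Set r} → Formula L Γ → (A → Def Γ P) → Def Γ (λ v → A → P v)
    →ᵈ {A = A} φ d with em {P = A}
    ... | yes x = mapᵈ (d x) λ v → mk⇔ (λ p _ → p) (λ f → f x)
    ... | no ¬x = mapᵈ (⊤ᵈ φ) λ v → mk⇔ (λ _ x → contradiction x ¬x) _

  subᵈ : ∀ {i j r} {Γ : Ctx i Sort} {Δ : Ctx j Sort} {P : Tuple Γ → Set r} → Def Γ P →
         (s : Sub L Γ Δ) {f : Tuple Δ → Tuple Γ} → (∀ v x → eval (s x) v ≡ f v x) →
         Def Δ (λ v → P (f v))
  subᵈ (def φ d) s e = def (sub φ s) λ v → d _ ⇔-∘ ⊨-sub φ (e v)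

  module _ {i j r} {Γ : Ctx i Sort} {Δ : Ctx j Sort} {P : Tuple (Γ ⊕ Δ) → Set r} (d : Def (Γ ⊕ Δ) P) where

    private
      ∃-selected : (S : Selection (Index Δ)) → (∀ x → inj₂ x ∈ᶠ formula d → x ∈ˢ S) →
                   (∀ x → ¬ x ∈ˢ S → ∣ sort Δ x ∣) → Def Γ (λ v → ∃[ z ] P (v ++ z))
      ∃-selected S cover g = def (∃ᵇ (size S) φ) λ v → mk⇔
        (λ h → let t , h′ = to (⊨-∃ᵇ (size S) φ) h in
          extend S t g , meaning d (to (⊨-finitize S (formula d) cover
            {z = extend S t g} λ q → ≡⇒≈ (sym (extend-in S t g q))) h′))
        (λ { (z , h) → from (⊨-∃ᵇ (size S) φ)
          (z ∘ pick S , from (⊨-finitize S (formula d) cover {z = z} λ q → ≈-refl) (holds d h)) })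
        where
        φ = finitize S (formula d) cover

    ∃ᵈ : Enumeration (Index Δ) → Def Γ (λ v → ∃[ z ] P (v ++ z))
    ∃ᵈ (S , s) = ∃-selected S (λ x _ → s x) λ x x∉S → contradiction (s x) x∉S

    -- Sorts may be empty, hence the default tuple.
    ∃ᵈ-default : Tuple Δ → Def Γ (λ v → ∃[ z ] P (v ++ z))
    ∃ᵈ-default g =
      let S , cover = parameters (formula d) in ∃-selected S cover λ x _ → g x

-- Unlike in Saturated, κ is independent of the level of the language: the
-- language of imaginaries lives at a higher level than its small tuples.
κ-Saturated : ∀ κ {ℓ c} {L : Language ℓ} → Structure L c → Set (lsuc κ ⊔ ℓ ⊔ c)
κ-Saturated κ {L = L} M =
  (X Θ : Ctx κ Sort) (A : Tuple Θ) (p : Pred (Formula L (X ⊕ Θ)) 0ℓ) →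
  (∀ φs → All p φs → ∃[ x ] All (λ φ → ⊨ φ [ _++_ {Γ = X} x A ]) φs) →
  ∃[ x ] (∀ φ → p φ → ⊨ φ [ _++_ {Γ = X} x A ])
  where
  open Language L
  open Semantics M

-- Compactness and conjugation

module Compactness (em : Classical) (κ : Level) {ℓ c} {L : Language ℓ}
  (M : Structure L c) (sat : κ-Saturated κ M) where
  open Language L
  open Structure M
  open Semantics M
  open Sub-semantics M
  open Definability em M

  -- ξ lies in the closure of D for the topology whose closed sets are
  -- definable over q by partial types.
  Adherent : ∀ {i j r} {V : Ctx i Sort} {Q : Ctx j Sort} → Tuple Q → (Tuple V → Set r) → Tuple V → Set _
  Adherent {V = V} {Q} q D ξ =
    (ψs : List (Formula L (V ⊕ Q))) → All (λ ψ → ⊨ ψ [ ξ ++ q ]) ψs →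
    ∃[ ξ′ ] D ξ′ × All (λ ψ → ⊨ ψ [ ξ′ ++ q ]) ψs

  module _ {i j r s} {V : Ctx i Sort} {Q : Ctx j Sort} {q : Tuple Q} {D : Tuple V → Set r} {ξ : Tuple V}
           (adh : Adherent q D ξ) {P : Tuple (V ⊕ Q) → Set s} (d : Def (V ⊕ Q) P) where

    approximate : P (ξ ++ q) → ∃[ ξ′ ] D ξ′ × P (ξ′ ++ q)
    approximate p with adh (formula d ∷ []) (holds d p ∷ [])
    ... | ξ′ , h , ψ ∷ [] = ξ′ , h , meaning d ψ

    closed : (∀ ξ′ → D ξ′ → P (ξ′ ++ q)) → P (ξ ++ q)
    closed h = by-contradiction em λ ¬p →
      let ξ′ , h′ , ψs = adh ((¬′ formula d) ∷ []) ((λ p → ¬p (meaning d p)) ∷ [])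
      in All.head ψs (holds d (h ξ′ h′))

  -- The sets `C i` may be undefinable. The type to be realised consists of all formulas that hold
  -- throughout some `C i`, and `∙` makes it finitely satisfiable. A realisation adheres to each
  -- `C i`: if finitely many formulas true of it had no common solution in `C i`, the negation of
  -- their conjunction would be in the type.
  compactness : ∀ {a r} {V Q : Ctx κ Sort} (q : Tuple Q) {I : Set a} (C : I → Tuple V → Set r)
                (i₀ : I) (_∙_ : I → I → I) →
                (∀ i j ξ → C (i ∙ j) ξ → C i ξ × C j ξ) → (∀ i → ∃ (C i)) →
                ∃[ ξ ] (∀ i → Adherent q (C i) ξ)
  compactness {V = V} {Q} q {I} C i₀ _∙_ split nonempty = ξ , adherent
    where
    p : Pred (Formula L (V ⊕ Q)) 0ℓ
    -- `True` of a decision lives at level 0, whatever the levels of `I` and `C`, as `κ-Saturated`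
    -- demands.
    p ψ = True (em {P = ∃[ i ] (∀ ξ → C i ξ → ⊨ ψ [ ξ ++ q ])})
    common : ∀ ψs → All p ψs → ∃[ i ] (∀ ξ → C i ξ → All (λ ψ → ⊨ ψ [ ξ ++ q ]) ψs)
    common [] [] = i₀ , λ _ _ → []
    common (ψ ∷ ψs) (h ∷ hs) with toWitness {a? = em} h | common ψs hs
    ... | i , f | j , g = i ∙ j , λ ξ x → let y , z = split i j ξ x in f ξ y ∷ g ξ z
    solution = sat V Q q p λ ψs hs →
      let i , f = common ψs hs ; ξ , x = nonempty i in ξ , f ξ x
    ξ = proj₁ solution
    adherent : ∀ i → Adherent q (C i) ξ
    adherent i [] [] = let ξ′ , x = nonempty i in ξ′ , x , []
    adherent i (ψ ∷ ψs) hs = by-contradiction em λ none →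
      proj₂ solution (¬′ (ψ ∧⁺ ψs))
        (fromWitness {a? = em} (i , λ ξ′ x h → none (ξ′ , x , to (⊨-∧⁺ ψ ψs) h)))
        (from (⊨-∧⁺ ψ ψs) hs)

  -- Adding no variable, it raises a context of level 0 to level `κ`, at which saturation and
  -- `ThornForkingSymmetric` are stated.
  εκ : Ctx κ Sort
  εκ = ctx (Lift κ ⊥) λ ()

  pad : ∀ {i} {V : Ctx i Sort} → Tuple V → Tuple (V ⊕ εκ)
  pad v = v ++ λ ()

  compactness₀ : ∀ {a r} {V : Ctx 0ℓ Sort} {Q : Ctx κ Sort} (q : Tuple Q) {I : Set a}
                 (C : I → Tuple V → Set r) (i₀ : I) (_∙_ : I → I → I) →
                 (∀ i j ξ → C (i ∙ j) ξ → C i ξ × C j ξ) → (∀ i → ∃ (C i)) →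
                 ∃[ ξ ] (∀ i → Adherent q (C i) ξ)
  compactness₀ {V = V} {Q} q C i₀ _∙_ split nonempty
    with compactness {V = V ⊕ εκ} q (λ i ξ → C i (ξ ∘ inj₁)) i₀ _∙_ (λ i j ξ → split i j _)
           (λ i → let ξ , x = nonempty i in pad ξ , x)
  ... | ξ , adh = ξ ∘ inj₁ , λ i ψs hs →
    let ξ′ , x , hs′ = adh i (map (λ ψ → sub ψ widen) ψs) (mapped ψs hs)
    in ξ′ ∘ inj₁ , x , unmapped ψs hs′
    where
    widen : Sub L (V ⊕ Q) ((V ⊕ εκ) ⊕ Q)
    widen (inj₁ x) = var (inj₁ (inj₁ x))
    widen (inj₂ y) = var (inj₂ y)
    ⊨-widen : ∀ ψ {ξ} → (⊨ sub ψ widen [ ξ ++ q ]) ⇔ (⊨ ψ [ (ξ ∘ inj₁) ++ q ])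
    ⊨-widen ψ = ⊨-sub ψ λ { (inj₁ x) → refl ; (inj₂ y) → refl }
    mapped : ∀ {ξ} ψs → All (λ ψ → ⊨ ψ [ (ξ ∘ inj₁) ++ q ]) ψs →
             All (λ ψ → ⊨ ψ [ ξ ++ q ]) (map (λ ψ → sub ψ widen) ψs)
    mapped [] [] = []
    mapped (ψ ∷ ψs) (h ∷ hs) = from (⊨-widen ψ) h ∷ mapped ψs hs
    unmapped : ∀ {ξ} ψs → All (λ ψ → ⊨ ψ [ ξ ++ q ]) (map (λ ψ → sub ψ widen) ψs) →
               All (λ ψ → ⊨ ψ [ (ξ ∘ inj₁) ++ q ]) ψs
    unmapped [] [] = []
    unmapped (ψ ∷ ψs) (h ∷ hs) = to (⊨-widen ψ) h ∷ unmapped ψs hs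

  infix 4 _≼_
  -- This is equality of types over the empty set: an inclusion between complete types suffices,
  -- since formulas can be negated.
  _≼_ : ∀ {i} {P : Ctx i Sort} → Tuple P → Tuple P → Set _
  _≼_ {P = P} q q′ = (φ : Formula L P) → ⊨ φ [ q ] → ⊨ φ [ q′ ]

  module _ {i} {P : Ctx i Sort} where

    ≼-sym : {q q′ : Tuple P} → q ≼ q′ → q′ ≼ q
    ≼-sym e φ h = by-contradiction em λ ¬h → e (¬′ φ) ¬h h

    transport : ∀ {r} {D : Tuple P → Set r} {q q′ : Tuple P} → Def P D → q ≼ q′ → D q → D q′
    transport d e = meaning d ∘ e (formula d) ∘ holds d

    ≼-sub : ∀ {j} {R : Ctx j Sort} (s : Sub L R P) {q q′ : Tuple P} {p p′ : Tuple R} →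
            (∀ x → eval (s x) q ≡ p x) → (∀ x → eval (s x) q′ ≡ p′ x) → q ≼ q′ → p ≼ p′
    ≼-sub s f f′ e φ = to (⊨-sub φ f′) ∘ e (sub φ s) ∘ from (⊨-sub φ f)

  module _ {Q : Ctx κ Sort} {q q′ : Tuple Q} (e : q ≼ q′) where

    private
      module Extend {i} {Z : Ctx i Sort} (c : Tuple Z) where
        True-of : Set _
        True-of = Σ[ φs ∈ List (Formula L (Q ⊕ Z)) ] All (λ φ → ⊨ φ [ q ++ c ]) φs
        C : True-of → Tuple Z → Set _
        C (φs , _) c′ = All (λ φ → ⊨ φ [ q′ ++ c′ ]) φs
        _∙_ : True-of → True-of → True-of
        (φs , hs) ∙ (ψs , ks) = φs ++ˡ ψs , All.++⁺ hs ks
        split : ∀ i j ξ → C (i ∙ j) ξ → C i ξ × C j ξ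
        split (φs , _) j ξ = All.++⁻ φs
        nonempty : ∀ i → ∃ (C i)
        nonempty ([] , _) = c , []
        nonempty (φ ∷ φs , hs) =
          let c′ , h = transport (∃ᵈ-default ⟦ φ ∧⁺ φs ⟧ c) e (c , from (⊨-∧⁺ φ φs) hs)
          in c′ , to (⊨-∧⁺ φ φs) h
        conclusion : ∀ {c′} → (∀ i → Adherent q′ (C i) c′) → q ++ c ≼ q′ ++ c′
        conclusion adh φ h = to (⊨-exchange φ) (closed (adh (φ ∷ [] , h ∷ [])) ⟦ sub φ exchange ⟧
          λ { ξ′ (h′ ∷ []) → from (⊨-exchange φ) h′ })

    -- A finite part of the type of `c` over `q` has a solution over `q′` because its existential
    -- closure is in the type of `q`; saturation then realises the whole type.
    homogeneous : {Z : Ctx κ Sort} (c : Tuple Z) → ∃[ c′ ] (q ++ c ≼ q′ ++ c′)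
    homogeneous c = let c′ , adh = compactness q′ C ([] , []) _∙_ split nonempty in c′ , conclusion adh
      where open Extend c

    homogeneous₀ : {Z : Ctx 0ℓ Sort} (c : Tuple Z) → ∃[ c′ ] (q ++ c ≼ q′ ++ c′)
    homogeneous₀ c = let c′ , adh = compactness₀ q′ C ([] , []) _∙_ split nonempty in c′ , conclusion adh
      where open Extend c

-- Counting solutions, and algebraicity formula by formula

module Counting (em : Classical) (κ : Level) {ℓ c} {L : Language ℓ} (M : Structure L c) where
  open Language L
  open Structure M
  open Semantics M
  open Sub-semantics M
  open Definability em M
  open Thorn κ M

  module _ {i} {X : Ctx i Sort} where

    Distinct : ∀ {k} → (Fin k → Tuple X) → Set _
    Distinct ys = ∀ j₁ j₂ → ¬ j₁ ≡ j₂ → ¬ (ys j₁ ≈ₜ ys j₂)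

    -- Finiteness with an explicit bound can be written as a formula (`fewerᵈ`), unlike `Finite`,
    -- and hence passes to conjugates and limits.
    Fewer : ∀ {r} → ℕ → Pred (Tuple X) r → Set _
    Fewer k P = (ys : Fin k → Tuple X) → (∀ j → P (ys j)) → ¬ Distinct ys

    ¬fewer : ∀ {r k} {P : Pred (Tuple X) r} → ¬ Fewer k P → ∃[ ys ] (∀ (j : Fin k) → P (ys j)) × Distinct ys
    ¬fewer ¬f = by-contradiction em λ none → ¬f λ ys ps d → none (ys , ps , d)

    fewer-⊆ : ∀ {r s k} {P : Pred (Tuple X) r} {Q : Pred (Tuple X) s} →
              (∀ x → P x → Q x) → Fewer k Q → Fewer k P
    fewer-⊆ f g ys ps = g ys λ j → f (ys j) (ps j)

    finite-⊆ : ∀ {r s} {P : Pred (Tuple X) r} {Q : Pred (Tuple X) s} →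
               (∀ x → P x → Q x) → Finite Q → Finite P
    finite-⊆ f (xs , cover) = xs , λ x → cover x ∘ f x

    finite⇒fewer : ∀ {r} {P : Pred (Tuple X) r} → Finite P → ∃[ k ] Fewer k P
    finite⇒fewer (xs , cover) = suc (length xs) , λ ys ps distinct →
      let f = λ j → cover (ys j) (ps j)
          i , j , i<j , e = Fin.pigeonhole (ℕ.n<1+n _) (λ j → index (f j))
      in distinct i j (Fin.<⇒≢ i<j) λ x →
           ≈-trans (Any.lookup-index (f i) x)
             (subst (λ p → lookup xs p x ≈ ys j x) (sym e) (≈-sym (Any.lookup-index (f j) x)))

    fewer⇒finite : ∀ {r} k {P : Pred (Tuple X) r} → Fewer k P → Finite P
    -- The empty family is distinct, so no predicate has fewer than 0 elements.
    fewer⇒finite zero        f = contradiction (λ ()) (f (λ ()) λ ())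
    fewer⇒finite (suc k) {P} f with em {P = ∃ P}
    ... | no none = [] , λ x p → contradiction (x , p) none
    ... | yes (y , p) =
      let xs , cover = fewer⇒finite k {λ x → P x × ¬ (x ≈ₜ y)} fewer
      in y ∷ xs , λ x q → case em {P = x ≈ₜ y} of λ
           { (yes e) → here e ; (no ne) → there (cover x (q , ne)) }
      where
      fewer : Fewer k (λ x → P x × ¬ (x ≈ₜ y))
      fewer ys ps distinct = f ys′ ps′ distinct′
        where
        ys′ : Fin (suc k) → Tuple X
        ys′ zero    = y
        ys′ (suc j) = ys j
        ps′ : ∀ j → P (ys′ j)
        ps′ zero    = p
        ps′ (suc j) = proj₁ (ps j)
        distinct′ : Distinct ys′
        distinct′ zero     zero     ne _ = ne refl
        distinct′ zero     (suc j₂) ne e = proj₂ (ps j₂) (≈ₜ-sym e)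
        distinct′ (suc j₁) zero     ne e = proj₂ (ps j₁) e
        distinct′ (suc j₁) (suc j₂) ne e = distinct j₁ j₂ (ne ∘ cong suc) e

    infinite⇒many : ∀ {r} {P : Pred (Tuple X) r} → Infinite P →
                    ∀ k → ∃[ ys ] (∀ (j : Fin k) → P (ys j)) × Distinct ys
    infinite⇒many {P = P} inf k = ¬fewer {P = P} λ f → inf (fewer⇒finite k f)

    finite-⋃ : ∀ {r n} {P : Fin n → Pred (Tuple X) r} → (∀ j → Finite (P j)) → Finite (λ x → ∃[ j ] P j x)
    finite-⋃ {n = zero}  f = [] , λ { x (() , _) }
    finite-⋃ {n = suc n} f =
      let xs , cover = f zero ; ys , cover′ = finite-⋃ (f ∘ suc)
      in xs ++ˡ ys , λ { x (zero , p) → Any.++⁺ˡ (cover x p)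
                       ; x (suc j , p) → Any.++⁺ʳ xs (cover′ x (j , p)) }

    infinite-∖ : ∀ {r s} {P : Pred (Tuple X) r} {Q : Pred (Tuple X) s} →
                 Infinite P → Finite Q → ∃[ x ] P x × ¬ Q x
    infinite-∖ {P = P} {Q} inf (xs , cover) = by-contradiction em λ none →
      inf (xs , λ x p → cover x (by-contradiction em λ ¬q → none (x , p , ¬q)))

  kInconsistent-≤ : ∀ {i r n} {X : Ctx i Sort} {Y : Fin n → Sort} {k k′ δ} {P : Pred (Tuple (fin Y)) r} →
                    k ≤ k′ → KInconsistent {X = X} k δ P → KInconsistent k′ δ P
  kInconsistent-≤ k≤k′ inc a ps distinct (x , h) =
    inc (a ∘ ι) (ps ∘ ι) (λ j₁ j₂ ne → distinct _ _ (ne ∘ Fin.inject≤-injective k≤k′ k≤k′ j₁ j₂)) (x , h ∘ ι)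
    where ι = λ j → Fin.inject≤ j k≤k′

  distinctᵈ : ∀ {i n k} {Γ : Ctx i Sort} {Y : Fin n → Sort} → Formula L Γ →
              (t : ∀ j q → Term L Γ (Y q)) →
              Def Γ (λ v → Distinct {X = fin Y} {k} λ j q → eval (t j q) v)
  distinctᵈ φ t = ∀ᵈ φ λ j₁ → ∀ᵈ φ λ j₂ → →ᵈ φ λ _ → ¬ᵈ ∀ᵈ φ λ q → ≈ᵈ (t j₁ q) (t j₂ q)

  module _ {i n} {C : Ctx i Sort} {Y : Fin n → Sort} (θ : Formula L (fin Y ⊕ C)) where

    private
      copy : ∀ {a j} {K : Set a} {Γ : Ctx j Sort} (s : Sub L C Γ) (t : ∀ q → K → Term L Γ (Y q)) →
             K → Sub L (fin Y ⊕ C) Γ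
      copy s t j (inj₁ q) = t q j
      copy s t j (inj₂ x) = s x

    -- Supplies the formula in context `C` that the conjunctions below need in case they are empty.
    sentence : Formula L C
    sentence = ∃ᵇ n (sub θ exchange)

    fewerᵈ : ∀ k → Def C (λ v → Fewer k λ y → ⊨ θ [ y ++ v ])
    fewerᵈ k = mapᵈ (¬ᵈ ∃ᵈ solutions (enumerate-Σ enumerate-Fin λ _ → enumerate-Fin))
      λ v → mk⇔ (λ h ys ps d → h ((λ (j , q) → ys j q) , ps , d))
                λ { h (z , ps , d) → h (λ j q → z (j , q)) ps d }
      where
      ψ = sub sentence (var ∘ inj₁)
      solutions : Def (C ⊕ Copies (Fin k) (fin Y)) (λ v →
        (∀ j → ⊨ θ [ (λ q → v (inj₂ (j , q))) ++ (v ∘ inj₁) ]) × Distinct λ j q → v (inj₂ (j , q)))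
      solutions =
        ∀ᵈ ψ (λ j → subᵈ ⟦ θ ⟧ (copy (var ∘ inj₁) (λ q j → var (inj₂ (j , q))) j)
          λ { v (inj₁ q) → refl ; v (inj₂ x) → refl })
        ×ᵈ distinctᵈ ψ λ j q → var (inj₂ (j , q))

    kInconsistentᵈ : ∀ k {m} {X : Fin m → Sort} (δ : Formula L (fin X ⊕ fin Y)) →
                     Def C (λ v → KInconsistent k δ λ y → ⊨ θ [ y ++ v ])
    kInconsistentᵈ k {X = X} δ = mapᵈ
      (¬ᵈ ∃ᵈ
        (∃ᵈ solutions enumerate-Fin)
        (enumerate-Σ enumerate-Fin λ _ → enumerate-Fin))
      λ v → mk⇔ (λ h ys ps d (x , hs) → h ((λ (j , q) → ys j q) , x , ps , d , hs))
                λ { h (z , x , ps , d , hs) → h (λ j q → z (j , q)) ps d (x , hs) }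
      where
      ψ = sub sentence (var ∘ inj₁ ∘ inj₁)
      solutions : Def ((C ⊕ Copies (Fin k) (fin Y)) ⊕ fin X) (λ v →
        (∀ j → ⊨ θ [ (λ q → v (inj₁ (inj₂ (j , q)))) ++ (v ∘ inj₁ ∘ inj₁) ]) ×
        Distinct (λ j q → v (inj₁ (inj₂ (j , q)))) ×
        (∀ j → ⊨ δ [ (v ∘ inj₂) ++ (λ q → v (inj₁ (inj₂ (j , q)))) ]))
      solutions =
        ∀ᵈ ψ (λ j → subᵈ ⟦ θ ⟧ (copy (var ∘ inj₁ ∘ inj₁) (λ q j → var (inj₁ (inj₂ (j , q)))) j)
          λ { v (inj₁ q) → refl ; v (inj₂ x) → refl })
        ×ᵈ distinctᵈ ψ (λ j q → var (inj₁ (inj₂ (j , q))))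
        ×ᵈ ∀ᵈ ψ (λ j → subᵈ ⟦ δ ⟧ (λ { (inj₁ x) → var (inj₂ x) ; (inj₂ q) → var (inj₁ (inj₂ (j , q))) })
          λ { v (inj₁ q) → refl ; v (inj₂ x) → refl })

    fewer-resp : ∀ {k v w} → v ≈ₜ w → Fewer k (λ y → ⊨ θ [ y ++ v ]) → Fewer k (λ y → ⊨ θ [ y ++ w ])
    fewer-resp {v = v} {w} e = fewer-⊆ λ y → ⊨-resp θ {y ++ w} {y ++ v} λ
      { (inj₁ q) → ≈-refl ; (inj₂ x) → ≈-sym (e x) }

    algebraicᵈ : ∀ k → Def (fin Y ⊕ C) (λ v → ⊨ θ [ v ] × Fewer k λ y → ⊨ θ [ y ++ (v ∘ inj₂) ])
    algebraicᵈ k = ⟦ θ ⟧ ×ᵈ subᵈ (fewerᵈ k) (var ∘ inj₂) λ v x → refl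

  module _ {n} {Y : Fin n → Sort} where

    -- Tested formula by formula, the notion makes sense over parameters of any level and passes
    -- along inclusions of types; saturation links it to `Algebraic` over small parameters.
    NonAlgebraic : ∀ {i} {P : Ctx i Sort} → Tuple (fin Y) → Tuple P → Set _
    NonAlgebraic {P = P} d C = (θ : Formula L (fin Y ⊕ P)) (k : ℕ) →
                               ⊨ θ [ d ++ C ] → ¬ Fewer k (λ y → ⊨ θ [ y ++ C ])

    nonAlgebraic-sub : ∀ {i j} {P : Ctx i Sort} {R : Ctx j Sort} (s : Sub L P R)
                       {d : Tuple (fin Y)} {C : Tuple P} {C′ : Tuple R} →
                       (∀ x → eval (s x) C′ ≡ C x) → NonAlgebraic d C′ → NonAlgebraic d C
    nonAlgebraic-sub s e na θ k h f =
      na (sub θ (rightˢ s)) k (from (⊨-right θ {x = _} e) h) (fewer-⊆ (λ y → to (⊨-right θ {x = y} e)) f)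

    nonAlgebraic-≼ : ∀ {i} {P : Ctx i Sort} {d d′ : Tuple (fin Y)} {C C′ : Tuple P} →
                     (∀ φ → ⊨ φ [ d′ ++ C′ ] → ⊨ φ [ d ++ C ]) → NonAlgebraic d C → NonAlgebraic d′ C′
    nonAlgebraic-≼ e na θ k h f =
      let h′ , f′ = meaning (algebraicᵈ θ k) (e (formula (algebraicᵈ θ k)) (holds (algebraicᵈ θ k) (h , f)))
      in na θ k h′ f′

    ¬algebraic⇒nonAlgebraic : {P : Ctx κ Sort} {d : Tuple (fin Y)} {C : Tuple P} →
                              ¬ Algebraic (tp d C) → NonAlgebraic d C
    ¬algebraic⇒nonAlgebraic na θ k h f = na (finite-⊆ (λ y t → t θ h) (fewer⇒finite k f))

-- Thorn-forking: localisation to formulas, and extension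

module Forking (em : Classical) (κ : Level) {ℓ c} {L : Language ℓ}
  (M : Structure L c) (sat : κ-Saturated κ M) where
  open Language L
  open Structure M
  open Semantics M
  open Sub-semantics M
  open Definability em M
  open Compactness em κ M sat
  open Counting em κ M
  open Thorn κ M

  module _ {n} {Y : Fin n → Sort} {P : Ctx κ Sort} (d : Tuple (fin Y)) (C : Tuple P)
           (φ₀ : Formula L (fin Y ⊕ P)) where

    private
      -- Compactness starts from some formula of the type, and a language may have none in this
      -- context; given any `φ₀`, it or its negation belongs to the type.
      formula-of-type : Σ[ φ ∈ Formula L (fin Y ⊕ P) ] (⊨ φ [ d ++ C ])
      formula-of-type with em {P = ⊨ φ₀ [ d ++ C ]}
      ... | yes h = φ₀ , h
      ... | no ¬h = ¬′ φ₀ , ¬h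

    type-compactness : ∀ {r} {W : Ctx κ Sort} k {D : Tuple (W ⊕ Copies (Fin k) (fin Y)) → Set r} →
      Def ((W ⊕ Copies (Fin k) (fin Y)) ⊕ P) (λ v → D (v ∘ inj₁)) →
      ((π : Formula L (fin Y ⊕ P)) → ⊨ π [ d ++ C ] →
        ∃[ w ] D w × (∀ j → ⊨ π [ (λ q → w (inj₂ (j , q))) ++ C ])) →
      ∃[ w ] D w × (∀ j → (λ q → w (inj₂ (j , q))) ⊨ₜ tp d C)
    type-compactness {W = W} k {D} dᵈ h =
      let w , adh = compactness C {I = Σ[ π ∈ Formula L (fin Y ⊕ P) ] (⊨ π [ d ++ C ])}
            (λ (π , _) w → D w × (∀ j → ⊨ π [ (λ q → w (inj₂ (j , q))) ++ C ]))
            formula-of-type (λ (π , p) (ρ , r) → π ∧′ ρ , p , r)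
            (λ _ _ w (x , f) → (x , proj₁ ∘ f) , (x , proj₂ ∘ f)) (λ (π , p) → h π p)
      in w , closed (adh formula-of-type) dᵈ (λ _ → proj₁)
           , λ j π p → closed (adh (π , p)) (instanceᵈ π j) λ _ x → proj₂ x j
      where
      instanceᵈ : ∀ π j → Def ((W ⊕ Copies (Fin k) (fin Y)) ⊕ P)
                              (λ v → ⊨ π [ (λ q → v (inj₁ (inj₂ (j , q)))) ++ (v ∘ inj₂) ])
      instanceᵈ π j = subᵈ ⟦ π ⟧ (λ { (inj₁ q) → var (inj₁ (inj₂ (j , q))) ; (inj₂ x) → var (inj₂ x) })
        λ { v (inj₁ q) → refl ; v (inj₂ x) → refl }

    -- If the type had fewer than `k` realisations, each of its formulas would still have `k`
    -- distinct solutions, and a limit of these families would be `k` distinct realisations.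
    nonAlgebraic⇒¬algebraic : NonAlgebraic d C → ¬ Algebraic (tp d C)
    nonAlgebraic⇒¬algebraic na alg =
      let k , fewer = finite⇒fewer alg
          w , distinct , types = type-compactness {W = εκ} k
            {D = λ w → Distinct λ j q → w (inj₂ (j , q))}
            (distinctᵈ (sub (sentence φ₀) (var ∘ inj₂)) λ j q → var (inj₁ (inj₂ (j , q))))
            (λ π p → let ys , ps , distinct = ¬fewer {P = λ y → ⊨ π [ y ++ C ]} (na π k p) in
              (λ { (inj₂ (j , q)) → ys j q }) , distinct , ps)
      in fewer _ types distinct

    -- Strong dividing speaks of all realisations of a type, the rank of one formula `π`. If
    -- `k`-inconsistency failed for every formula of the type, compactness would give `k` distinct
    -- conjugates with a common solution.
    inconsistency-formula : ∀ {X : Ctx κ Sort} (δ : Formula L (X ⊕ fin Y)) k →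
      KInconsistent k δ (_⊨ₜ tp d C) →
      Σ[ π ∈ Formula L (fin Y ⊕ P) ] (⊨ π [ d ++ C ]) × KInconsistent k δ (λ a → ⊨ π [ a ++ C ])
    inconsistency-formula {X} δ k inc = by-contradiction em λ none →
      let w , (distinct , sol) , types = type-compactness {W = X} k
            {D = λ w → Distinct (λ j q → w (inj₂ (j , q))) ×
                       (∀ j → ⊨ δ [ (w ∘ inj₁) ++ (λ q → w (inj₂ (j , q))) ])}
            (distinctᵈ ψ (λ j q → var (inj₁ (inj₂ (j , q)))) ×ᵈ ∀ᵈ ψ λ j →
              subᵈ ⟦ δ ⟧ (λ { (inj₁ x) → var (inj₁ (inj₁ x)) ; (inj₂ q) → var (inj₁ (inj₂ (j , q))) })
                λ { v (inj₁ x) → refl ; v (inj₂ q) → refl })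
            (λ π p → by-contradiction em λ none′ → none (π , p , λ a ps distinct (x , hs) →
              none′ (x ++ (λ (j , q) → a j q) , (distinct , λ j →
                ⊨-≡ δ (λ { (inj₁ x) → refl ; (inj₂ q) → refl }) (hs j)) , ps)))
      in inc (λ j q → w (inj₂ (j , q))) types distinct (w ∘ inj₁ , sol)
      where
      ψ = sub (sentence φ₀) (var ∘ inj₂)

  module _ {i} {X : Ctx i Sort} where

    to-parameters : ∀ {j} {P : Ctx j Sort} (φ : Formula L (X ⊕ P)) (q : Tuple P) →
                    Σ[ φ′ ∈ ParamFormula X ] (∀ x → (⊨ᵖ φ′ [ x ]) ⇔ (⊨ φ [ x ++ q ]))
    to-parameters φ q = let S , cover = parameters φ in
      finitize S φ cover ⟨ q ∘ pick S ⟩ , λ x → ⊨-finitize S φ cover λ _ → ≈-refl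

    Covers : {Θ : Ctx κ Sort} {A : Tuple Θ} → List (ThornDividing {X = X} A) → Tuple X → Set _
    Covers ds x = Any (λ d → ⊨ ThornDividing.δ d [ x ++ ThornDividing.a d ]) ds

    -- An empty divisor is algebraic, so a thorn-dividing formula exhibits a sort and thus an
    -- equation, in any context.
    some-formula : ∀ {j} {Γ : Ctx j Sort} {Θ : Ctx κ Sort} {A : Tuple Θ} →
                   ThornDividing {X = X} A → Formula L Γ
    some-formula d = from-tuple (ThornDividing.a d) (proj₁ (proj₂ (proj₂ (ThornDividing.divides d))))
      where
      from-tuple : ∀ {j} {Γ : Ctx j Sort} {n} {Y : Fin n → Sort} {P : Ctx κ Sort} {C : Tuple P}
                   (a : Tuple (fin Y)) → ¬ Algebraic (tp a C) → Formula L Γ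
      from-tuple {n = zero}      a na = contradiction (a ∷ [] , λ _ _ → here λ ()) na
      from-tuple {n = suc _} {Y} a na = ∃′ (Y zero) (var nothing ≐ var nothing)

    NotForking : ∀ {j} {Q : Ctx j Sort} {Θ : Ctx κ Sort} → Tuple X → Tuple Q → Tuple Θ → Set _
    NotForking {Q = Q} a q A = (φ : Formula L (X ⊕ Q)) → ⊨ φ [ a ++ q ] →
      (ds : List (ThornDividing {X = X} A)) → ¬ (∀ x → ⊨ φ [ x ++ q ] → Covers ds x)

  module _ {X Θ P : Ctx κ Sort} {A : Tuple Θ} {a : Tuple X} {B : Tuple P} where

    private
      Formulas-of-type : Set _
      Formulas-of-type = Σ[ φs ∈ List (Formula L (X ⊕ P)) ] All (λ φ → ⊨ φ [ a ++ B ]) φs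

    -- No finite part of the type is covered by finitely many dividing formulas. Their parameters
    -- may lie outside `q`, so avoiding them is not expressed over `B` and `q`; yet adherence
    -- suffices, as a formula over `q` true of `a′` also holds at a point that avoids them.
    extension : ¬ TypeThornForks (tp a B) A → {Q : Ctx κ Sort} (q : Tuple Q) →
                ∃[ a′ ] (∀ φ → ⊨ φ [ a ++ B ] → ⊨ φ [ a′ ++ B ]) × NotForking a′ q A
    extension nf {Q} q =
      let a′ , adh = compactness (B ++ q) {I = Formulas-of-type × List (ThornDividing A)} C
            (([] , []) , []) (λ ((φs , hs) , ds) ((ψs , ks) , es) → (φs ++ˡ ψs , All.++⁺ hs ks) , ds ++ˡ es)
            (λ { ((φs , _) , ds) _ x (hs , ¬d) →
              (All.++⁻ˡ φs hs , ¬d ∘ Any.++⁺ˡ) , (All.++⁻ʳ φs hs , ¬d ∘ Any.++⁺ʳ ds) })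
            nonempty
      in a′
       , (λ φ h → closed (adh ((φ ∷ [] , h ∷ []) , []))
           (subᵈ ⟦ φ ⟧ (λ { (inj₁ x) → var (inj₁ x) ; (inj₂ y) → var (inj₂ (inj₁ y)) })
             {λ v → (v ∘ inj₁) ++ (v ∘ inj₂ ∘ inj₁)} λ { v (inj₁ x) → refl ; v (inj₂ y) → refl })
           λ { x (h ∷ [] , _) → h })
       , λ φ h ds cover →
           let x , (_ , ¬d) , h′ = approximate (adh (([] , []) , ds))
                 (subᵈ ⟦ φ ⟧ (λ { (inj₁ x) → var (inj₁ x) ; (inj₂ y) → var (inj₂ (inj₂ y)) })
                   {λ v → (v ∘ inj₁) ++ (v ∘ inj₂ ∘ inj₂)} λ { v (inj₁ x) → refl ; v (inj₂ y) → refl })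
                 h
           in ¬d (cover x h′)
      where
      C : Formulas-of-type × List (ThornDividing A) → Tuple X → Set _
      C ((φs , _) , ds) x = All (λ φ → ⊨ φ [ x ++ B ]) φs × ¬ Covers ds x
      -- The empty conjunction has to become a formula, too. As `ds` covers `a`, it is nonempty, and
      -- its first member yields a tautology.
      parameter-formula : ∀ φs ds → All (λ φ → ⊨ φ [ a ++ B ]) φs → Covers ds a →
        Σ[ φ ∈ ParamFormula X ] (∀ x → (⊨ᵖ φ [ x ]) ⇔ All (λ φ → ⊨ φ [ x ++ B ]) φs)
      parameter-formula (φ ∷ φs) _ _ _ =
        let φ′ , e = to-parameters (φ ∧⁺ φs) B in φ′ , λ x → ⊨-∧⁺ φ φs ⇔-∘ e x
      parameter-formula [] (d ∷ _) _ _ =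
        (¬′ (δ ∧′ ¬′ δ)) ⟨ ThornDividing.a d ⟩ , λ x → mk⇔ (λ _ → []) λ _ (p , ¬p) → ¬p p
        where open ThornDividing d using (δ)
      nonempty : ∀ i → ∃ (C i)
      nonempty ((φs , hs) , ds) = by-contradiction em λ none →
        let cover = λ x h → by-contradiction em λ ¬d → none (x , h , ¬d)
            φ , e = parameter-formula φs ds hs (cover a hs)
        in nf (φ , (λ x t → from (e x) (All.map (λ {φ} → t φ) hs)) , ds , λ x → cover x ∘ to (e x))

    -- The formula `χ` of the definition is only implied by the type and has parameters of its own.
    -- If every formula of the type had a solution outside `ds`, a limit of such solutions would
    -- realise the type, hence be covered; the covering disjunct, a formula over the divisors of
    -- `ds`, would then hold at one of these solutions.
    forking-formula : TypeThornForks (tp a B) A →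
      Σ[ φ ∈ Formula L (X ⊕ P) ] (⊨ φ [ a ++ B ]) ×
      Σ[ ds ∈ List (ThornDividing A) ] (∀ x → ⊨ φ [ x ++ B ] → Covers ds x)
    forking-formula (χ , implies , ds , cover) = by-contradiction em λ none →
      let x , adh = compactness (B ++ parameter) {I = Σ[ φ ∈ Formula L (X ⊕ P) ] (⊨ φ [ a ++ B ])}
            (λ (φ , _) x → (⊨ φ [ x ++ B ]) × ¬ Covers ds x) i₀ (λ (φ , h) (ψ , k) → φ ∧′ ψ , h , k)
            (λ _ _ x ((h , k) , ¬d) → (h , ¬d) , (k , ¬d))
            (λ (φ , h) → by-contradiction em λ none′ → none (φ , h , ds , λ x hx →
              by-contradiction em λ ¬d → none′ (x , hx , ¬d)))
          covered = cover x (implies x λ φ h → closed (adh (φ , h))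
            (subᵈ ⟦ φ ⟧ (λ { (inj₁ x) → var (inj₁ x) ; (inj₂ y) → var (inj₂ (inj₁ y)) })
              {λ v → (v ∘ inj₁) ++ (v ∘ inj₂ ∘ inj₁)} λ { v (inj₁ x) → refl ; v (inj₂ y) → refl })
            λ _ → proj₁)
          j = index covered
          x′ , (_ , ¬d) , h = approximate (adh i₀) (divider j) (Any.lookup-index covered)
      in ¬d (lookup⁻ j h)
      where
      J = Fin (length ds)
      D = lookup ds
      parameter : Tuple (ctx (Σ[ j ∈ J ] Fin (ThornDividing.n (D j))) λ (j , q) → ThornDividing.Y (D j) q)
      parameter (j , q) = ThornDividing.a (D j) q
      divider : ∀ j → Def (X ⊕ (P ⊕ _)) (λ v →
        ⊨ ThornDividing.δ (D j) [ (v ∘ inj₁) ++ (λ q → v (inj₂ (inj₂ (j , q)))) ])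
      divider j = subᵈ ⟦ ThornDividing.δ (D j) ⟧
        (λ { (inj₁ x) → var (inj₁ x) ; (inj₂ q) → var (inj₂ (inj₂ (j , q))) })
        λ { v (inj₁ x) → refl ; v (inj₂ q) → refl }
      lookup⁻ : ∀ {x} j → ⊨ ThornDividing.δ (D j) [ x ++ ThornDividing.a (D j) ] → Covers ds x
      lookup⁻ {x} = go ds
        where
        go : ∀ ds j → ⊨ ThornDividing.δ (lookup ds j) [ x ++ ThornDividing.a (lookup ds j) ] → Covers ds x
        go (d ∷ ds) zero    h = here h
        go (d ∷ ds) (suc j) h = there (go ds j h)
      head : ∀ {x} → Covers ds x → ThornDividing A
      head p = lookup ds (index p)
      i₀ : Σ[ φ ∈ Formula L (X ⊕ P) ] (⊨ φ [ a ++ B ])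
      i₀ = let φ = some-formula (head (cover a (implies a λ _ h → h))) in
        case em {P = ⊨ φ [ a ++ B ]} of λ { (yes h) → φ , h ; (no ¬h) → ¬′ φ , ¬h }

-- Divisors stay non-algebraic over an independent realisation

module Algebraicity (em : Classical) (κ : Level) {ℓ c} {L : Language ℓ}
  (M : Structure L c) (sat : κ-Saturated κ M) where
  open Language L
  open Structure M
  open Semantics M
  open Sub-semantics M
  open Definability em M
  open Compactness em κ M sat
  open Counting em κ M
  open Forking em κ M sat
  open Thorn κ M

  module _ {Θ Z X : Ctx κ Sort} {A : Tuple Θ} {z : Tuple Z} {n} {Y : Fin n → Sort} {d : Tuple (fin Y)} where

    private
      C : Tuple (Θ ⊕ Z)
      C = A ++ z

      E : Ctx κ Sort
      E = fin Y ⊕ (Θ ⊕ Z)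

      module _ (a : Tuple X) (na : NonAlgebraic d C) (θ : Formula L (fin Y ⊕ ((Θ ⊕ Z) ⊕ X))) (k : ℕ) where

        abstract
          few : Def (X ⊕ E) (λ v → let w = (v ∘ inj₂ ∘ inj₂) ++ (v ∘ inj₁) in
                  (⊨ θ [ (v ∘ inj₂ ∘ inj₁) ++ w ]) × Fewer k (λ y → ⊨ θ [ y ++ w ]))
          few = subᵈ (algebraicᵈ θ k)
            (λ { (inj₁ q)        → var (inj₂ (inj₁ q))
             ; (inj₂ (inj₁ x)) → var (inj₂ (inj₂ x))
             ; (inj₂ (inj₂ x)) → var (inj₁ x) })
            {λ v → (v ∘ inj₂ ∘ inj₁) ++ ((v ∘ inj₂ ∘ inj₂) ++ (v ∘ inj₁))}
            λ { v (inj₁ q) → refl ; v (inj₂ (inj₁ x)) → refl ; v (inj₂ (inj₂ x)) → refl }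

          selection : Σ[ S ∈ Selection (Index E) ]
            (∀ x → x ∈ map inj₁ (allFin n) ++ˡ inj₂s (proj₁ (variables (formula few))) → x ∈ˢ S)
          selection = select em _

        φ : Formula L (X ⊕ E)
        φ = formula few

        S : Selection (Index E)
        S = proj₁ selection

        cover : ∀ x → inj₂ x ∈ᶠ φ → x ∈ˢ S
        cover x p = proj₂ selection x (∈-++⁺ʳ (map inj₁ (allFin n)) (∈-inj₂s (proj₂ (variables φ) (inj₂ x) p)))

        all-of-Y : ∀ q → inj₁ q ∈ˢ S
        all-of-Y q = proj₂ selection (inj₁ q) (∈-++⁺ˡ (∈-map⁺ inj₁ (∈-allFin q)))

        -- The divisor of a dividing formula is finite, so it consists of `d` and of the entries of
        -- `C` that occur in `φ`. The latter are fixed over `C`, so the conjugates of `d̂`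
        -- correspond to those of `d`.
        d̂ : Tuple (E ↾ S)
        d̂ = (d ++ C) ∘ pick S

        δ : Formula L (X ⊕ E ↾ S)
        δ = finitize S φ cover

        expand : Tuple (E ↾ S) → Tuple E
        expand t = extend S t λ x _ → (d ++ C) x

        constants : ∀ {t} → t ⊨ₜ tp d̂ C → ∀ x → expand t (inj₂ x) ≈ C x
        constants {t} type x = go (inj₂ x) (var x) refl
          where
          -- The position is generalised to `y`, its value being named by a term `u`, so that
          -- `pick S p ≡ y` can be matched with `refl`.
          go : ∀ y (u : Term L (Θ ⊕ Z) (sort E y)) → eval u C ≡ (d ++ C) y → expand t y ≈ eval u C
          go y u e with em {P = y ∈ˢ S}
          ... | no _ = ≡⇒≈ (sym e)
          ... | yes (p , refl) =
            ≈-trans (type (var (inj₁ p) ≐ subᵗ u λ x _ → var (inj₂ x))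
                      (≈-trans (≡⇒≈ (sym e)) (≈-sym (right d̂))))
                    (right t)
            where
            right : ∀ t → eval (subᵗ u (λ x _ → var (inj₂ x))) (t ++ C) ≈ eval u C
            right t = eval-sub u λ _ _ → ≈-refl

        expand-agrees : ∀ {t d′} → (∀ p → (d′ ++ C) (pick S p) ≈ t p) → ∀ {y} → y ∈ˢ S → (d′ ++ C) y ≈ expand t y
        expand-agrees {t} e (p , refl) = ≈-trans (e p) (≡⇒≈ (sym (extend-in S t _ p)))

        non-algebraic : ¬ Algebraic (tp d̂ C)
        non-algebraic (ts , all) = nonAlgebraic⇒¬algebraic d C φ₀ na
          (map (λ t → expand t ∘ inj₁) ts , λ d′ type → Any.map⁺ (Any.map
            (λ e q → expand-agrees {d′ = d′} e (all-of-Y q))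
            (all ((d′ ++ C) ∘ pick S) λ χ h → to (⊨-picked χ) (type (sub χ picked) (from (⊨-picked χ) h)))))
          where
          φ₀ : Formula L E
          φ₀ = formula (∃ᵈ-default {Γ = E} {X}
            ⟦ sub θ (λ { (inj₁ q)        → var (inj₁ (inj₁ q))
                       ; (inj₂ (inj₁ x)) → var (inj₁ (inj₂ x))
                       ; (inj₂ (inj₂ x)) → var (inj₂ x) }) ⟧ a)
          picked : Sub L (E ↾ S ⊕ (Θ ⊕ Z)) E
          picked (inj₁ p) = var (pick S p)
          picked (inj₂ x) = var (inj₂ x)
          ⊨-picked : ∀ χ {d′} → (⊨ sub χ picked [ d′ ++ C ]) ⇔ (⊨ χ [ ((d′ ++ C) ∘ pick S) ++ C ])
          ⊨-picked χ = ⊨-sub χ λ { (inj₁ p) → refl ; (inj₂ x) → refl }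

        -- The bound on the solutions of `θ` is part of `φ` and is read off the instance `j₀`. It
        -- serves all instances because their parameters from `C` are the same, which also forces
        -- distinct divisors to differ in their `Y`-part.
        inconsistent : Fin k → KInconsistent k δ (_⊨ₜ tp d̂ C)
        inconsistent j₀ ts types distinct (x , hs) =
          fewer-resp θ {w = C ++ x} (λ { (inj₁ v) → constants (types j₀) v ; (inj₂ v) → ≈-refl })
            (proj₂ (meaning few (solved j₀)))
            (λ j q → expand (ts j) (inj₁ q))
            (λ j → ⊨-resp θ (λ { (inj₁ q) → ≈-refl
                               ; (inj₂ (inj₁ v)) → constants (types j) v
                               ; (inj₂ (inj₂ v)) → ≈-refl }) (proj₁ (meaning few (solved j))))
            λ j₁ j₂ ne e → distinct j₁ j₂ ne λ p →
              ≈-trans (≡⇒≈ (sym (extend-in S (ts j₁) _ p)))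
                (≈-trans (same j₁ j₂ e (pick S p)) (≡⇒≈ (extend-in S (ts j₂) _ p)))
          where
          solved : ∀ j → ⊨ φ [ x ++ expand (ts j) ]
          solved j = to (⊨-finitize S φ cover λ q → ≡⇒≈ (sym (extend-in S (ts j) _ q))) (hs j)
          same : ∀ j₁ j₂ → (∀ q → expand (ts j₁) (inj₁ q) ≈ expand (ts j₂) (inj₁ q)) →
                 ∀ y → expand (ts j₁) y ≈ expand (ts j₂) y
          same j₁ j₂ e (inj₁ q) = e q
          same j₁ j₂ e (inj₂ v) = ≈-trans (constants (types j₁) v) (≈-sym (constants (types j₂) v))

        thorn-dividing : Fin k → ThornDividing {X = X} A
        thorn-dividing j₀ = record
          { δ = δ ; a = d̂ ; divides = Z , z , non-algebraic , k , inconsistent j₀ }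

    -- The formula expressing that d is algebraic over A z a strongly
    -- divides over A z, since a has only finitely many witnesses d to offer.
    nonAlgebraic-extend : {a : Tuple X} {j : Level} {Q : Ctx j Sort} {q : Tuple Q} →
      NonAlgebraic d (A ++ z) → NotForking a q A →
      (s : Sub L E Q) → (∀ x → eval (s x) q ≡ (d ++ (A ++ z)) x) → NonAlgebraic d ((A ++ z) ++ a)
    nonAlgebraic-extend {a} na nf s e θ k h f =
      nf (sub (φ a na θ k) (rightˢ s))
        (from (⊨-right (φ a na θ k) {x = _} e) (holds (few a na θ k)
          (h , f)))
        (thorn-dividing a na θ k (index-of k {P = λ y → ⊨ θ [ y ++ ((A ++ z) ++ a) ]} f) ∷ [])
        λ x h′ → here (from (⊨-finitize (S a na θ k) (φ a na θ k) (cover a na θ k) λ _ → ≈-refl)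
          (to (⊨-right (φ a na θ k) {x = x} e) h′))
      where
      index-of : ∀ k {r} {P : Pred (Tuple (fin Y)) r} → Fewer k P → Fin k
      index-of zero    f = contradiction (λ ()) (f (λ ()) λ ())
      index-of (suc k) f = zero

-- Properties of the thorn-rank

module Rank (em : Classical) (κ : Level) {ℓ c} {L : Language ℓ}
  (M : Structure L c) (sat : κ-Saturated κ M) where
  open Language L
  open Structure M
  open Semantics M
  open Sub-semantics M
  open Definability em M
  open Compactness em κ M sat
  open Counting em κ M
  open Thorn κ M

  module _ {m n} {X : Fin m → Sort} {Y : Fin n → Sort} {Z : Ctx κ Sort}
           (Δ : List (Formula L (fin X ⊕ fin Y))) (Π : List (Formula L (fin Y ⊕ Z))) (k : ℕ) {o : Level} where

    private
      R : ParamFormula (fin X) → Ordinal o → Set _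
      R = RankAtLeast Δ Π k

    rank-mono : ∀ α {φ ψ} → (∀ x → ⊨ᵖ φ [ x ] → ⊨ᵖ ψ [ x ]) → R φ α → R ψ α
    rank-mono zero    f (lift (x , h)) = lift (x , f x h)
    rank-mono (suc α) f (δ , π , δ∈ , π∈ , z , inf , inc) =
      δ , π , δ∈ , π∈ , z
        , (λ finite → inf (finite-⊆ (λ a (p , r) → p , rank-mono α (λ x (h , h′) → f x h , h′) r) finite))
        , inc
    rank-mono (lim I α) f ((x , h) , rs) = (x , f x h) , λ i → rank-mono (α i) f (rs i)

    rank⇒consistent : ∀ α {φ} → R φ α → Consistent φ
    rank⇒consistent zero      (lift h) = h
    rank⇒consistent (suc α)   (_ , _ , _ , _ , _ , inf , _) =
      let _ , (_ , r) , _ = infinite-∖ {Q = λ _ → ⊥} inf ([] , λ _ ())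
          x , h , _ = rank⇒consistent α r
      in x , h
    rank⇒consistent (lim I α) (h , _) = h

    -- Ordinals are trees, but the thresholds that they impose on ranks are comparable, uniformly in
    -- the formula. For a limit, either some member already implies the other side or the other side
    -- implies all members.
    rank-total : ∀ (α β : Ordinal o) → (∀ φ → R φ α → R φ β) ⊎ (∀ φ → R φ β → R φ α)
    rank-total zero β = inj₂ λ φ r → lift (rank⇒consistent β r)
    rank-total α zero = inj₁ λ φ r → lift (rank⇒consistent α r)
    rank-total (suc α) (suc β) with rank-total α β
    ... | inj₁ f = inj₁ λ { φ (δ , π , δ∈ , π∈ , z , inf , inc) → δ , π , δ∈ , π∈ , z
                          , (λ finite → inf (finite-⊆ (λ a (p , r) → p , f _ r) finite)) , inc }
    ... | inj₂ f = inj₂ λ { φ (δ , π , δ∈ , π∈ , z , inf , inc) → δ , π , δ∈ , π∈ , z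
                          , (λ finite → inf (finite-⊆ (λ a (p , r) → p , f _ r) finite)) , inc }
    rank-total (lim I α) β with em {P = ∃[ i ] (∀ φ → R φ (α i) → R φ β)}
    ... | yes (i , f) = inj₁ λ φ (_ , rs) → f φ (rs i)
    ... | no none = inj₂ λ φ r → rank⇒consistent β r , λ i → case rank-total (α i) β of λ
      { (inj₁ f) → contradiction (i , f) none ; (inj₂ f) → f φ r }
    rank-total α@(suc _) (lim J β) with em {P = ∃[ j ] (∀ φ → R φ (β j) → R φ α)}
    ... | yes (j , f) = inj₂ λ φ (_ , rs) → f φ (rs j)
    ... | no none = inj₁ λ φ r → rank⇒consistent α r , λ j → case rank-total α (β j) of λ
      { (inj₁ f) → f φ r ; (inj₂ f) → contradiction (j , f) none }

    private
      greatest : ∀ {I : Set o} (α : I → Ordinal o) → I → ∀ {r} (f : Fin r → I) →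
                 ∃[ i ] (∀ j φ → R φ (α i) → R φ (α (f j)))
      greatest α i₀ {zero}  f = i₀ , λ ()
      greatest α i₀ {suc r} f with greatest α i₀ (f ∘ suc)
      ... | i , g with rank-total (α i) (α (f zero))
      ...   | inj₁ h = i , λ { zero → h ; (suc j) → g j }
      ...   | inj₂ h = f zero , λ { zero φ x → x ; (suc j) φ x → g j φ (h φ x) }

    -- At a successor, an infinite set of nodes is a union of finitely many. At a limit, each
    -- disjunct would fail at some stage; the disjunct that attains the greatest of these stages
    -- also attains the one at which it fails.
    rank-⋁ : ∀ α {r φ} {ψ : Fin r → ParamFormula (fin X)} →
             (∀ x → ⊨ᵖ φ [ x ] → ∃[ j ] (⊨ᵖ ψ j [ x ])) → R φ α → ∃[ j ] R (ψ j) α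
    rank-⋁ zero f (lift (x , h)) = let j , h′ = f x h in j , lift (x , h′)
    rank-⋁ (suc α) {ψ = ψ} f (δ , π , δ∈ , π∈ , z , inf , inc) = by-contradiction em λ none →
      inf (finite-⊆ {Q = λ a → ∃[ j ] (⊨ π [ a ++ z ]) × R (ψ j ∧ᵖ δ ⟨ a ⟩) α}
        (λ a (p , r) → let j , r′ = rank-⋁ α {ψ = λ j → ψ j ∧ᵖ δ ⟨ a ⟩}
                                      (λ x (h , h′) → let j , k = f x h in j , k , h′) r
                       in j , p , r′)
        (finite-⋃ λ j → by-contradiction em λ inf′ → none (j , δ , π , δ∈ , π∈ , z , inf′ , inc)))
    rank-⋁ (lim I α) {φ = φ} {ψ} f ((x , h) , rs) with em {P = I}
    ... | no empty = let j , h′ = f x h in j , (x , h′) , λ i → contradiction i empty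
    ... | yes i₀ = by-contradiction em λ none →
      let fails : ∀ j → ∃[ i ] ¬ R (ψ j) (α i)
          fails j = by-contradiction em λ none′ → none (j ,
            let rs′ = λ i → by-contradiction em λ ¬r → none′ (i , ¬r)
            in rank⇒consistent (α i₀) (rs′ i₀) , rs′)
          i , g = greatest α i₀ (proj₁ ∘ fails)
          j , r = rank-⋁ (α i) {ψ = ψ} f (rs i)
      in proj₂ (fails j) (g j (ψ j) r)

    consistent-invariant : ∀ {P : Ctx κ Sort} (χ : Formula L (fin X ⊕ P)) {q q′ : Tuple P} → q ≼ q′ →
      ∀ {φ φ′} → (∀ x → ⊨ᵖ φ [ x ] → ⊨ χ [ x ++ q ]) → (∀ x → ⊨ χ [ x ++ q′ ] → ⊨ᵖ φ′ [ x ]) →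
      Consistent φ → Consistent φ′
    consistent-invariant χ e f f′ (x , h) =
      let x′ , h′ = transport (∃ᵈ ⟦ sub χ exchange ⟧ enumerate-Fin) e (x , from (⊨-exchange χ) (f x h))
      in x′ , f′ x′ (to (⊨-exchange χ) h′)

    -- The parameters inside `φ` and `φ′` need not correspond; it suffices to place a formula `χ`
    -- with conjugate parameters between them. If `φ′` had fewer than `k` nodes, `k` distinct nodes
    -- of `φ` could be moved to it at once.
    rank-invariant : ∀ α {P : Ctx κ Sort} (χ : Formula L (fin X ⊕ P)) {q q′ : Tuple P} → q ≼ q′ →
      ∀ {φ φ′} → (∀ x → ⊨ᵖ φ [ x ] → ⊨ χ [ x ++ q ]) → (∀ x → ⊨ χ [ x ++ q′ ] → ⊨ᵖ φ′ [ x ]) →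
      R φ α → R φ′ α
    rank-invariant zero χ e {φ} {φ′} f f′ (lift h) = lift (consistent-invariant χ e {φ} {φ′} f f′ h)
    rank-invariant (suc α) {P} χ {q} {q′} e {φ} {φ′} f f′ (δ , π , δ∈ , π∈ , z , inf , inc) =
      let z′ , e₁ = homogeneous e z in
      δ , π , δ∈ , π∈ , z′
        , (λ finite → copies finite inf e₁)
        , transport (subᵈ (kInconsistentᵈ π k δ) (var ∘ inj₂) λ v x → refl) e₁ inc
      where
      conjunctionᵈ : Def (fin X ⊕ (P ⊕ fin Y)) (λ v →
        (⊨ χ [ (v ∘ inj₁) ++ (v ∘ inj₂ ∘ inj₁) ]) × (⊨ δ [ (v ∘ inj₁) ++ (v ∘ inj₂ ∘ inj₂) ]))
      conjunctionᵈ =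
        subᵈ ⟦ χ ⟧ (λ { (inj₁ x) → var (inj₁ x) ; (inj₂ y) → var (inj₂ (inj₁ y)) })
          (λ { v (inj₁ x) → refl ; v (inj₂ x) → refl })
        ×ᵈ subᵈ ⟦ δ ⟧ (λ { (inj₁ x) → var (inj₁ x) ; (inj₂ y) → var (inj₂ (inj₂ y)) })
          λ { v (inj₁ x) → refl ; v (inj₂ x) → refl }
      distinctᵈ′ : ∀ k → Def ((P ⊕ Z) ⊕ Copies (Fin k) (fin Y)) (λ v → Distinct λ j q → v (inj₂ (j , q)))
      distinctᵈ′ k = distinctᵈ (sub (sentence π) (var ∘ inj₁ ∘ inj₂)) λ j q → var (inj₂ (j , q))
      copies : ∀ {z z′} → Finite (λ a → (⊨ π [ a ++ z′ ]) × R (φ′ ∧ᵖ δ ⟨ a ⟩) α) →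
               Infinite (λ a → (⊨ π [ a ++ z ]) × R (φ ∧ᵖ δ ⟨ a ⟩) α) → ¬ (q ++ z ≼ q′ ++ z′)
      copies {z} finite inf e₁ =
        let k , fewer = finite⇒fewer finite
            ys , ps , distinct = infinite⇒many {P = λ a → (⊨ π [ a ++ z ]) × R (φ ∧ᵖ δ ⟨ a ⟩) α} inf k
            ys′ , e₂ = homogeneous₀ e₁ {Z = Copies (Fin k) (fin Y)} (λ (j , q) → ys j q)
        in fewer (λ j q → ys′ (j , q))
             (λ j →
               transport (subᵈ ⟦ π ⟧ (λ { (inj₁ q) → var (inj₂ (j , q)) ; (inj₂ x) → var (inj₁ (inj₂ x)) })
                 {λ v → (λ q → v (inj₂ (j , q))) ++ (v ∘ inj₁ ∘ inj₂)}
                 λ { v (inj₁ q) → refl ; v (inj₂ x) → refl }) e₂ (proj₁ (ps j))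
               , rank-invariant α {P ⊕ fin Y} (formula conjunctionᵈ)
                   (≼-sub (λ { (inj₁ x) → var (inj₁ (inj₁ x)) ; (inj₂ q) → var (inj₂ (j , q)) })
                     {p = q ++ ys j} {q′ ++ (λ q → ys′ (j , q))}
                     (λ { (inj₁ x) → refl ; (inj₂ q) → refl }) (λ { (inj₁ x) → refl ; (inj₂ q) → refl }) e₂)
                   (λ x (h , h′) → holds conjunctionᵈ (f x h , h′))
                   (λ x h → let h₁ , h₂ = meaning conjunctionᵈ h in f′ x h₁ , h₂)
                   (proj₂ (ps j)))
             (transport (distinctᵈ′ k) e₂ distinct)
    rank-invariant (lim I α) χ e {φ} {φ′} f f′ (h , rs) =
      consistent-invariant χ e {φ} {φ′} f f′ h , λ i → rank-invariant (α i) χ e f f′ (rs i)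

-- The sequence of independent realisations

module Morley (em : Classical) (κ : Level) {ℓ c} {L : Language ℓ}
  (M : Structure L c) (sat : κ-Saturated κ M) where
  open Language L
  open Structure M
  open Semantics M
  open Sub-semantics M
  open Definability em M
  open Compactness em κ M sat
  open Counting em κ M
  open Forking em κ M sat
  open Algebraicity em κ M sat
  open Thorn κ M

  module Blocks {r} {n : Fin r → ℕ} (Y : ∀ j → Fin (n j) → Sort) (Z : Fin r → Ctx κ Sort) (X : Ctx κ Sort) where

    Ŷ : Ctx 0ℓ Sort
    Ŷ = ctx (Σ[ j ∈ Fin r ] Fin (n j)) λ (j , q) → Y j q

    Ẑ : Ctx κ Sort
    Ẑ = ctx (Σ[ j ∈ Fin r ] Index (Z j)) λ (j , x) → sort (Z j) x

    W : Ctx κ Sort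
    W = X ⊕ (Ŷ ⊕ Ẑ)

    divisor : Tuple W → ∀ j → Tuple (fin (Y j))
    divisor w j q = w (inj₂ (inj₁ (j , q)))

    base : Tuple W → ∀ j → Tuple (Z j)
    base w j x = w (inj₂ (inj₂ (j , x)))

    below : (ℕ → Tuple W) → ∀ i → Tuple (Copies (Fin i) X)
    below s i (l , x) = s (Fin.toℕ l) (inj₁ x)

    module _ {Θ : Ctx κ Sort} (A : Tuple Θ) where

      Free : (ℕ → Tuple W) → ℕ → Set _
      Free s i = ∀ j → NonAlgebraic (divisor (s i) j) (A ++ (base (s i) j ++ below s i))

  -- The realisations are constructed by prepending: the new one is thorn-
  -- independent from all the others, so the divisors of the others stay
  -- non-algebraic over it.
  module _ {r} {n : Fin r → ℕ} {Y : ∀ j → Fin (n j) → Sort} {Z : Fin r → Ctx κ Sort} {X V Θ : Ctx κ Sort}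
           (w₀ : Tuple (Blocks.W Y Z X)) {A : Tuple Θ} {b : Tuple V}
           (nf : ¬ TypeThornForks (tp (w₀ ∘ inj₁) (A ++ b)) A)
           (na : ∀ j → NonAlgebraic (Blocks.divisor Y Z X w₀ j) (A ++ Blocks.base Y Z X w₀ j)) where
    open Blocks Y Z X

    -- Over `b` only the realisation itself is kept, which preserves `ψ`; divisors and bases matter
    -- up to their type over `A`.
    Realises : (ℕ → Tuple W) → Set _
    Realises s = ∀ i → (A ++ w₀ ≼ A ++ s i) ×
                       (∀ φ → ⊨ φ [ (w₀ ∘ inj₁) ++ (A ++ b) ] → ⊨ φ [ (s i ∘ inj₁) ++ (A ++ b) ])

    private
      infixr 5 _∷ˢ_
      _∷ˢ_ : Tuple W → (ℕ → Tuple W) → ℕ → Tuple W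
      (w ∷ˢ s) zero    = w
      (w ∷ˢ s) (suc i) = s i

      σ : Sub L (Θ ⊕ X) (X ⊕ (Θ ⊕ V))
      σ (inj₁ x) = var (inj₂ (inj₁ x))
      σ (inj₂ x) = var (inj₁ x)
      restrict : ∀ {a : Tuple X} x → eval (σ x) (a ++ (A ++ b)) ≡ (A ++ a) x
      restrict (inj₁ x) = refl
      restrict (inj₂ x) = refl
      assoc : Sub L (Θ ⊕ W) ((Θ ⊕ X) ⊕ (Ŷ ⊕ Ẑ))
      assoc (inj₁ x) = var (inj₁ (inj₁ x))
      assoc (inj₂ (inj₁ x)) = var (inj₁ (inj₂ x))
      assoc (inj₂ (inj₂ x)) = var (inj₂ x)
      divisor-base : ∀ j → Sub L (fin (Y j) ⊕ (Θ ⊕ Z j)) (Θ ⊕ W)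
      divisor-base j (inj₁ q) = var (inj₂ (inj₂ (inj₁ (j , q))))
      divisor-base j (inj₂ (inj₁ x)) = var (inj₁ x)
      divisor-base j (inj₂ (inj₂ x)) = var (inj₂ (inj₂ (inj₂ (j , x))))
      divisor-base-eval : ∀ j w x → eval (divisor-base j x) (A ++ w) ≡ (divisor w j ++ (A ++ base w j)) x
      divisor-base-eval j w (inj₁ q) = refl
      divisor-base-eval j w (inj₂ (inj₁ x)) = refl
      divisor-base-eval j w (inj₂ (inj₂ x)) = refl
      shift : ∀ i j → Sub L (Θ ⊕ (Z j ⊕ Copies (Fin (suc i)) X)) ((Θ ⊕ (Z j ⊕ Copies (Fin i) X)) ⊕ X)
      shift i j (inj₁ x) = var (inj₁ (inj₁ x))
      shift i j (inj₂ (inj₁ x)) = var (inj₁ (inj₂ (inj₁ x)))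
      shift i j (inj₂ (inj₂ (zero , x))) = var (inj₂ x)
      shift i j (inj₂ (inj₂ (suc l , x))) = var (inj₁ (inj₂ (inj₂ (l , x))))
      locate : ∀ i j → Sub L (fin (Y j) ⊕ (Θ ⊕ (Z j ⊕ Copies (Fin i) X))) ((Θ ⊕ V) ⊕ Copies ℕ W)
      locate i j (inj₁ q) = var (inj₂ (i , inj₂ (inj₁ (j , q))))
      locate i j (inj₂ (inj₁ x)) = var (inj₁ (inj₁ x))
      locate i j (inj₂ (inj₂ (inj₁ x))) = var (inj₂ (i , inj₂ (inj₂ (j , x))))
      locate i j (inj₂ (inj₂ (inj₂ (l , x)))) = var (inj₂ (Fin.toℕ l , inj₁ x))

      module _ (s : ℕ → Tuple W) (real : Realises s) (a : Tuple X)
               (same : ∀ φ → ⊨ φ [ (w₀ ∘ inj₁) ++ (A ++ b) ] → ⊨ φ [ a ++ (A ++ b) ])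
               (nf′ : NotForking {X = X} a ((A ++ b) ++ (λ ((i , x) : ℕ × Index W) → s i x)) A) where

        same-type : A ++ (w₀ ∘ inj₁) ≼ A ++ a
        same-type φ h = to (⊨-sub φ (restrict {a})) (same (sub φ σ) (from (⊨-sub φ (restrict {w₀ ∘ inj₁})) h))

        module _ (g : Tuple (Ŷ ⊕ Ẑ)) (≼g : (A ++ (w₀ ∘ inj₁)) ++ (w₀ ∘ inj₂) ≼ (A ++ a) ++ g) where

          w : Tuple W
          w = a ++ g

          w₀≼w : A ++ w₀ ≼ A ++ w
          w₀≼w = ≼-sub {P = (Θ ⊕ X) ⊕ (Ŷ ⊕ Ẑ)} {R = Θ ⊕ W} assoc
                   (λ { (inj₁ x) → refl ; (inj₂ (inj₁ x)) → refl ; (inj₂ (inj₂ x)) → refl })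
                   (λ { (inj₁ x) → refl ; (inj₂ (inj₁ x)) → refl ; (inj₂ (inj₂ x)) → refl }) ≼g

          realises : Realises (w ∷ˢ s)
          realises zero    = w₀≼w , same
          realises (suc i) = real i

          free₀ : Free A (w ∷ˢ s) 0
          free₀ j = nonAlgebraic-sub {P = Θ ⊕ (Z j ⊕ Copies (Fin 0) X)} {R = Θ ⊕ Z j}
            (λ { (inj₁ x) → var (inj₁ x) ; (inj₂ (inj₁ x)) → var (inj₂ x) ; (inj₂ (inj₂ (() , _))) })
            {C = A ++ (base w j ++ below (w ∷ˢ s) 0)} {A ++ base w j}
            (λ { (inj₁ x) → refl ; (inj₂ (inj₁ x)) → refl ; (inj₂ (inj₂ (() , _))) })
            (nonAlgebraic-≼ {P = Θ ⊕ Z j} {C = A ++ base w₀ j} {A ++ base w j}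
              (≼-sub {P = Θ ⊕ W} {R = fin (Y j) ⊕ (Θ ⊕ Z j)} (divisor-base j)
                (divisor-base-eval j w) (divisor-base-eval j w₀) (≼-sym w₀≼w))
              (na j))

          free₊ : ∀ i → Free A s i → Free A (w ∷ˢ s) (suc i)
          free₊ i free j = nonAlgebraic-sub {P = Θ ⊕ (Z j ⊕ Copies (Fin (suc i)) X)}
            {R = (Θ ⊕ (Z j ⊕ Copies (Fin i) X)) ⊕ X} (shift i j)
            {C = A ++ (base (s i) j ++ below (w ∷ˢ s) (suc i))} {(A ++ (base (s i) j ++ below s i)) ++ a}
            (λ { (inj₁ x) → refl ; (inj₂ (inj₁ x)) → refl
               ; (inj₂ (inj₂ (zero , x))) → refl ; (inj₂ (inj₂ (suc l , x))) → refl })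
            (nonAlgebraic-extend {Z = Z j ⊕ Copies (Fin i) X} {X} {A} {base (s i) j ++ below s i}
              {d = divisor (s i) j} {a} {Q = (Θ ⊕ V) ⊕ Copies ℕ W} (free j) nf′ (locate i j)
              λ { (inj₁ x) → refl ; (inj₂ (inj₁ x)) → refl
                ; (inj₂ (inj₂ (inj₁ x))) → refl ; (inj₂ (inj₂ (inj₂ (l , x)))) → refl })

      Prepended : (ℕ → Tuple W) → Set _
      Prepended s = ∃[ w ] Realises (w ∷ˢ s) × Free A (w ∷ˢ s) 0 × (∀ i → Free A s i → Free A (w ∷ˢ s) (suc i))

      prepend : ∀ s → Realises s → Prepended s
      prepend s real = divide (extension nf _)
        where
        complete : ∀ a same nf′ → _ → Prepended s
        complete a same nf′ (g , ≼g) = w s real a same nf′ g ≼g , realises s real a same nf′ g ≼g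
          , free₀ s real a same nf′ g ≼g , free₊ s real a same nf′ g ≼g
        divide : _ → Prepended s
        divide (a , same , nf′) = complete a same nf′ (homogeneous (same-type s real a same nf′) (w₀ ∘ inj₂))

      Sequence : ℕ → Set _
      Sequence N = ∃[ s ] Realises s × (∀ i → i < N → Free A s i)

      finite-sequence : ∀ N → Sequence N
      -- The sequence is constantly `w₀`: no entry has to be free yet.
      finite-sequence zero    = (λ _ → w₀) , (λ i → (λ φ h → h) , λ φ h → h) , λ i ()
      finite-sequence (suc N) = grow (finite-sequence N)
        where
        attach : ∀ s → (∀ i → i < N → Free A s i) → Prepended s → Sequence (suc N)
        attach s free (w , real , free₀ , free₊) =
          w ∷ˢ s , real , λ { zero _ → free₀ ; (suc i) (s≤s i<N) → free₊ i (free i i<N) }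
        grow : Sequence N → Sequence (suc N)
        grow (s , real , free) = attach s free (prepend s real)

      locate′ : ∀ i j → Sub L (fin (Y j) ⊕ (Θ ⊕ (Z j ⊕ Copies (Fin i) X))) (Copies ℕ W ⊕ (Θ ⊕ V))
      locate′ i j (inj₁ q) = var (inj₁ (i , inj₂ (inj₁ (j , q))))
      locate′ i j (inj₂ (inj₁ x)) = var (inj₂ (inj₁ x))
      locate′ i j (inj₂ (inj₂ (inj₁ x))) = var (inj₁ (i , inj₂ (inj₂ (j , x))))
      locate′ i j (inj₂ (inj₂ (inj₂ (l , x)))) = var (inj₁ (Fin.toℕ l , inj₁ x))

      Approximation : ℕ → Tuple (Copies ℕ W) → Set _
      Approximation N ξ = Realises (λ i x → ξ (i , x)) × (∀ i → i < N → Free A (λ i x → ξ (i , x)) i)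

      module _ (ξ : Tuple (Copies ℕ W)) (adh : ∀ N → Adherent (A ++ b) (Approximation N) ξ) where

        limit-realises : Realises λ i x → ξ (i , x)
        limit-realises i =
          (λ φ h → closed (adh 0)
            (subᵈ ⟦ φ ⟧ (λ { (inj₁ x) → var (inj₂ (inj₁ x)) ; (inj₂ x) → var (inj₁ (i , x)) })
              {λ v → (v ∘ inj₂ ∘ inj₁) ++ (λ x → v (inj₁ (i , x)))}
              λ { v (inj₁ x) → refl ; v (inj₂ x) → refl })
            λ _ (real , _) → proj₁ (real i) φ h)
          , λ φ h → closed (adh 0)
            (subᵈ ⟦ φ ⟧ (λ { (inj₁ x) → var (inj₁ (i , inj₁ x)) ; (inj₂ x) → var (inj₂ x) })
              {λ v → (λ x → v (inj₁ (i , inj₁ x))) ++ (v ∘ inj₂)}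
              λ { v (inj₁ x) → refl ; v (inj₂ x) → refl })
            λ _ (real , _) → proj₂ (real i) φ h

        limit-free : ∀ i → Free A (λ i x → ξ (i , x)) i
        limit-free i j θ k h f =
          -- Entry `i` is constrained from approximation `suc i` on, and a failure of its freeness
          -- is one formula in the limit.
          let ξ′ , (_ , free) , h′ , f′ = approximate (adh (suc i))
                (subᵈ (algebraicᵈ θ k) (locate′ i j)
                  {λ v → (λ q → v (inj₁ (i , inj₂ (inj₁ (j , q))))) ++
                         ((v ∘ inj₂ ∘ inj₁) ++ ((λ x → v (inj₁ (i , inj₂ (inj₂ (j , x))))) ++
                                                 λ (l , x) → v (inj₁ (Fin.toℕ l , inj₁ x))))}
                  λ { v (inj₁ q) → refl ; v (inj₂ (inj₁ x)) → refl
                    ; v (inj₂ (inj₂ (inj₁ x))) → refl ; v (inj₂ (inj₂ (inj₂ (l , x)))) → refl })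
                (h , f)
          in free i (ℕ.n<1+n i) j θ k h′ f′

        limit-sequence : ∃[ s ] Realises s × (∀ i → Free A s i)
        limit-sequence = (λ i x → ξ (i , x)) , limit-realises , limit-free

    -- Prepending renumbers the entries, so the finite sequences do not extend one another; a limit
    -- provides one sequence for all stages, as infinite ranks require.
    infinite-sequence : ∃[ s ] Realises s × (∀ i → Free A s i)
    infinite-sequence = conclude (compactness (A ++ b) Approximation 0 _⊔ⁿ_
      (λ N M ξ (real , free) → (real , λ i i<N → free i (ℕ.≤-trans i<N (ℕ.m≤m⊔n N M)))
                             , (real , λ i i<M → free i (ℕ.≤-trans i<M (ℕ.m≤n⊔m N M))))
      λ N → flatten (finite-sequence N))
      where
      flatten : ∀ {N} → Sequence N → ∃ (Approximation N)
      flatten (s , real , free) = (λ (i , x) → s i x) , real , free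
      conclude : ∃[ ξ ] (∀ N → Adherent (A ++ b) (Approximation N) ξ) → _
      conclude (ξ , adh) = limit-sequence ξ adh

-- Unbounded rank from a free sequence

module Descent (em : Classical) (κ : Level) {ℓ c} {L : Language ℓ}
  (M : Structure L c) (sat : κ-Saturated κ M) where
  open Language L
  open Structure M
  open Semantics M
  open Sub-semantics M
  open Definability em M
  open Compactness em κ M sat
  open Counting em κ M
  open Forking em κ M sat
  open Thorn κ M
  open Morley em κ M sat
  open Rank em κ M sat

  finitizeᵈ : ∀ {i j t} {Γ : Ctx i Sort} {P : Ctx j Sort} {D : Tuple (Γ ⊕ P) → Set t}
              (S : Selection (Index P)) (all : ∀ x → x ∈ˢ S) → Def (Γ ⊕ P) D →
              Σ[ φ ∈ Formula L (Γ ⊕ P ↾ S) ] (∀ {v t z} → (∀ q → t q ≈ z (pick S q)) → (⊨ φ [ v ++ t ]) ⇔ D (v ++ z))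
  finitizeᵈ S all d = finitize S (formula d) (λ x _ → all x)
                    , λ e → defines d _ ⇔-∘ ⊨-finitize S (formula d) (λ x _ → all x) e

  module Merge {r} {n : Fin r → ℕ} {Y : ∀ j → Fin (n j) → Sort} {Z : Fin r → Ctx κ Sort} {X′ Θ : Ctx κ Sort}
           {m} {X : Fin m → Sort} (ψ : Formula L (fin X ⊕ (Θ ⊕ X′))) (δ : ∀ j → Formula L (fin X ⊕ fin (Y j)))
           (π : ∀ j → Formula L (fin (Y j) ⊕ (Θ ⊕ Z j))) (k : ℕ) {A : Tuple Θ}
           (s : ℕ → Tuple (Blocks.W Y Z X′)) where
    open Blocks Y Z X′

    -- The divisors of all blocks are merged into a single tuple y, because a
    -- rank has only one tuple of variables y.  The formula for block j leaves
    -- the other blocks of y constant, at values kept among the parameters.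

    blocks : Enumeration (Index Ŷ)
    blocks = enumerate-Σ enumerate-Fin λ _ → enumerate-Fin

    S : Selection (Index Ŷ)
    S = proj₁ blocks

    expand : Tuple (Ŷ ↾ S) → Tuple Ŷ
    expand t = extend S t λ x x∉S → contradiction (proj₂ blocks x) x∉S

    expand-pick : ∀ t p → t p ≈ expand t (pick S p)
    expand-pick t p = ≡⇒≈ (sym (extend-in S t _ p))

    expand-injective : ∀ {t t′} → (∀ x → expand t x ≈ expand t′ x) → t ≈ₜ t′
    expand-injective {t} {t′} e p = ≈-trans (expand-pick t p) (≈-trans (e (pick S p)) (≈-sym (expand-pick t′ p)))

    expand-of : ∀ {t} {z : Tuple Ŷ} → (∀ p → z (pick S p) ≈ t p) → ∀ x → z x ≈ expand t x
    expand-of {t} {z} e x = go (proj₂ blocks x)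
      where
      go : ∀ {x} → x ∈ˢ S → z x ≈ expand t x
      go (p , refl) = ≈-trans (e p) (expand-pick t p)

    Parameters : Ctx κ Sort
    Parameters = (Θ ⊕ Ẑ) ⊕ Ŷ

    δᵈ : ∀ j → Def (fin X ⊕ Ŷ) (λ v → ⊨ δ j [ (v ∘ inj₁) ++ (λ q → v (inj₂ (j , q))) ])
    δᵈ j = subᵈ ⟦ δ j ⟧ (λ { (inj₁ x) → var (inj₁ x) ; (inj₂ q) → var (inj₂ (j , q)) })
      λ { v (inj₁ x) → refl ; v (inj₂ q) → refl }

    Condition : ∀ j → Tuple (Parameters ⊕ Ŷ) → Set _
    Condition j v =
      (⊨ π j [ (λ q → v (inj₂ (j , q))) ++ ((v ∘ inj₁ ∘ inj₁ ∘ inj₁) ++ (λ x → v (inj₁ (inj₁ (inj₂ (j , x)))))) ]) ×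
      (∀ (x : Index Ŷ) → ¬ proj₁ x ≡ j → v (inj₂ x) ≈ v (inj₁ (inj₂ x)))

    conditionᵈ : ∀ j → Def (Parameters ⊕ Ŷ) (Condition j)
    conditionᵈ j = πᵈ ×ᵈ Πᵈ blocks (formula πᵈ) λ x → →ᵈ (formula πᵈ) λ _ → ≈ᵈ (var (inj₂ x)) (var (inj₁ (inj₂ x)))
      where
      πᵈ : Def (Parameters ⊕ Ŷ) (λ v →
           ⊨ π j [ (λ q → v (inj₂ (j , q))) ++ ((v ∘ inj₁ ∘ inj₁ ∘ inj₁) ++ (λ x → v (inj₁ (inj₁ (inj₂ (j , x)))))) ])
      πᵈ = subᵈ ⟦ π j ⟧ (λ { (inj₁ q) → var (inj₂ (j , q)) ; (inj₂ (inj₁ x)) → var (inj₁ (inj₁ (inj₁ x)))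
                           ; (inj₂ (inj₂ x)) → var (inj₁ (inj₁ (inj₂ (j , x)))) })
        λ { v (inj₁ q) → refl ; v (inj₂ (inj₁ x)) → refl ; v (inj₂ (inj₂ x)) → refl }

    abstract
      δ̂-definition : ∀ j → Σ[ φ ∈ Formula L (fin X ⊕ Ŷ ↾ S) ]
        (∀ {x : Tuple (fin X)} {t : Tuple (Ŷ ↾ S)} {z : Tuple Ŷ} → (∀ q → t q ≈ z (pick S q)) →
          (⊨ φ [ x ++ t ]) ⇔ (⊨ δ j [ x ++ (λ q → z (j , q)) ]))
      δ̂-definition j = let φ , e = finitizeᵈ S (proj₂ blocks) (δᵈ j) in φ , e

      π̂-definition : ∀ j → Σ[ φ ∈ Formula L (Ŷ ↾ S ⊕ Parameters) ]
        (∀ {v : Tuple Parameters} {t : Tuple (Ŷ ↾ S)} {z : Tuple Ŷ} → (∀ q → t q ≈ z (pick S q)) →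
          (⊨ φ [ t ++ v ]) ⇔ Condition j (v ++ z))
      π̂-definition j = let φ , e = finitizeᵈ S (proj₂ blocks) (conditionᵈ j) in
        sub φ exchange , λ h → e h ⇔-∘ ⊨-exchange φ

    δ̂ : ∀ j → Formula L (fin X ⊕ Ŷ ↾ S)
    δ̂ j = proj₁ (δ̂-definition j)

    π̂ : ∀ j → Formula L (Ŷ ↾ S ⊕ Parameters)
    π̂ j = proj₁ (π̂-definition j)

    ⊨δ̂ : ∀ j {x : Tuple (fin X)} {t : Tuple (Ŷ ↾ S)} {z : Tuple Ŷ} → (∀ q → t q ≈ z (pick S q)) →
         (⊨ δ̂ j [ x ++ t ]) ⇔ (⊨ δ j [ x ++ (λ q → z (j , q)) ])
    ⊨δ̂ j = proj₂ (δ̂-definition j)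

    ⊨π̂ : ∀ j {v : Tuple Parameters} {t : Tuple (Ŷ ↾ S)} {z : Tuple Ŷ} → (∀ q → t q ≈ z (pick S q)) →
         (⊨ π̂ j [ t ++ v ]) ⇔ Condition j (v ++ z)
    ⊨π̂ j = proj₂ (π̂-definition j)

    parameters-at : ℕ → Tuple Parameters
    parameters-at i = (A ++ (s i ∘ inj₂ ∘ inj₂)) ++ (s i ∘ inj₂ ∘ inj₁)

    χᵈ : ∀ i → Def (fin X ⊕ (Θ ⊕ Copies (Fin (suc i)) X′)) (λ v →
         ∀ l → ⊨ ψ [ (v ∘ inj₁) ++ ((v ∘ inj₂ ∘ inj₁) ++ (λ x → v (inj₂ (inj₂ (l , x))))) ])
    χᵈ i = ∀ᵈ (formula (ψᵈ zero)) ψᵈ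
      where
      ψᵈ : ∀ l → Def (fin X ⊕ (Θ ⊕ Copies (Fin (suc i)) X′)) (λ v →
           ⊨ ψ [ (v ∘ inj₁) ++ ((v ∘ inj₂ ∘ inj₁) ++ (λ x → v (inj₂ (inj₂ (l , x))))) ])
      ψᵈ l = subᵈ ⟦ ψ ⟧ (λ { (inj₁ x) → var (inj₁ x) ; (inj₂ (inj₁ x)) → var (inj₂ (inj₁ x))
                           ; (inj₂ (inj₂ x)) → var (inj₂ (inj₂ (l , x))) })
        λ { v (inj₁ x) → refl ; v (inj₂ (inj₁ x)) → refl ; v (inj₂ (inj₂ x)) → refl }

    abstract
      Ψ-definition : ∀ i → Σ[ φ ∈ ParamFormula (fin X) ]
        (∀ x → (⊨ᵖ φ [ x ]) ⇔ (∀ (l : Fin (suc i)) → ⊨ ψ [ x ++ (A ++ (s (Fin.toℕ l) ∘ inj₁)) ]))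
      Ψ-definition i = let φ , e = to-parameters (formula (χᵈ i)) (A ++ below s (suc i)) in
        φ , λ x → defines (χᵈ i) _ ⇔-∘ e x

    Ψ : ℕ → ParamFormula (fin X)
    Ψ i = proj₁ (Ψ-definition i)

    ⊨Ψ : ∀ i x → (⊨ᵖ Ψ i [ x ]) ⇔ (∀ (l : Fin (suc i)) → ⊨ ψ [ x ++ (A ++ (s (Fin.toℕ l) ∘ inj₁)) ])
    ⊨Ψ i = proj₂ (Ψ-definition i)

    module _ (free : ∀ i → Free A s i)
             (covers : ∀ i x → ⊨ ψ [ x ++ (A ++ (s i ∘ inj₁)) ] → ∃[ j ] (⊨ δ j [ x ++ divisor (s i) j ]))
             (inc : ∀ i j → KInconsistent k (δ j) (λ y → ⊨ π j [ y ++ (A ++ base (s i) j) ]))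
             (hπ : ∀ i j → ⊨ π j [ divisor (s i) j ++ (A ++ base (s i) j) ])
             (b : Tuple (fin X)) (hψ : ∀ i → ⊨ ψ [ b ++ (A ++ (s i ∘ inj₁)) ]) where

      -- Tuples satisfying `π̂ j` agree outside block `j`, so distinct ones yield distinct divisors
      -- in that block.
      inconsistent : ∀ i j → KInconsistent k (δ̂ j) (λ t → ⊨ π̂ j [ t ++ parameters-at i ])
      inconsistent i j ts hs distinct (x , sols) =
        inc i j (λ l q → expand (ts l) (j , q))
          (λ l → ⊨-≡ (π j) (λ { (inj₁ q) → refl ; (inj₂ (inj₁ x)) → refl ; (inj₂ (inj₂ x)) → refl })
            (proj₁ (conditions l)))
          (λ l₁ l₂ ne e → distinct l₁ l₂ ne (expand-injective λ y → agree l₁ l₂ e y (em {P = proj₁ y ≡ j})))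
          (x , λ l → to (⊨δ̂ j (expand-pick (ts l))) (sols l))
        where
        conditions : ∀ l → Condition j (parameters-at i ++ expand (ts l))
        conditions l = to (⊨π̂ j (expand-pick (ts l))) (hs l)
        agree : ∀ l₁ l₂ → (∀ q → expand (ts l₁) (j , q) ≈ expand (ts l₂) (j , q)) →
                ∀ y → Dec (proj₁ y ≡ j) → expand (ts l₁) y ≈ expand (ts l₂) y
        agree l₁ l₂ e (.j , q) (yes refl) = e q
        agree l₁ l₂ e y        (no ne)    = ≈-trans (proj₂ (conditions l₁) y ne) (≈-sym (proj₂ (conditions l₂) y ne))

      module _ {o : Level} where

        R : ParamFormula (fin X) → Ordinal o → Set _
        R = RankAtLeast (tabulate δ̂) (tabulate π̂) k

      merged : ℕ → Tuple (Ŷ ↾ S)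
      merged i p = s i (inj₂ (inj₁ (pick S p)))

      module Step (i : ℕ) (j : Fin r) where

        private
          d : Tuple (fin (Y j))
          d = divisor (s (suc i)) j

          -- The base makes conjugates of `d` satisfy `π j`, and the realisations up to `i` make
          -- them keep the rank of the conjunction with `Ψ i`. The realisation at `suc i` is left
          -- out, since freeness says nothing about `d` over it.
          C : Tuple (Θ ⊕ (Z j ⊕ Copies (Fin (suc i)) X′))
          C = A ++ (base (s (suc i)) j ++ below s (suc i))

        insert′ : Tuple (fin (Y j)) → ∀ x → Dec (proj₁ x ≡ j) → ∣ sort Ŷ x ∣
        insert′ d (.j , q) (yes refl) = d q
        insert′ d x        (no _)     = s (suc i) (inj₂ (inj₁ x))

        insert : Tuple (fin (Y j)) → Tuple Ŷ
        insert d x = insert′ d x (em {P = proj₁ x ≡ j})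

        insert-block : ∀ d q → insert d (j , q) ≡ d q
        insert-block d q with em {P = j ≡ j}
        ... | yes refl = refl
        ... | no ne    = contradiction refl ne

        insert-other : ∀ d x → ¬ proj₁ x ≡ j → insert d x ≡ s (suc i) (inj₂ (inj₁ x))
        insert-other d x ne with em {P = proj₁ x ≡ j}
        ... | yes e = contradiction e ne
        ... | no _  = refl

        into : Sub L (fin (Y j) ⊕ (Θ ⊕ Z j)) (fin (Y j) ⊕ (Θ ⊕ (Z j ⊕ Copies (Fin (suc i)) X′)))
        into (inj₁ q)        = var (inj₁ q)
        into (inj₂ (inj₁ x)) = var (inj₂ (inj₁ x))
        into (inj₂ (inj₂ x)) = var (inj₂ (inj₂ (inj₁ x)))

        ⊨-into : ∀ {y} → (⊨ sub (π j) into [ y ++ C ]) ⇔ (⊨ π j [ y ++ (A ++ base (s (suc i)) j) ])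
        ⊨-into = ⊨-sub (π j) λ { (inj₁ q) → refl ; (inj₂ (inj₁ x)) → refl ; (inj₂ (inj₂ x)) → refl }

        condition : ∀ {y} → y ⊨ₜ tp d C → ⊨ π̂ j [ (insert y ∘ pick S) ++ parameters-at (suc i) ]
        condition {y} type = from (⊨π̂ j {z = insert y} λ _ → ≈-refl)
          ( ⊨-≡ (π j) (λ { (inj₁ q) → sym (insert-block y q) ; (inj₂ (inj₁ x)) → refl ; (inj₂ (inj₂ x)) → refl })
              (to ⊨-into (type (sub (π j) into) (from ⊨-into (hπ (suc i) j))))
          , λ x ne → ≡⇒≈ (insert-other y x ne))

        Joint : Ctx κ Sort
        Joint = (Θ ⊕ Copies (Fin (suc i)) X′) ⊕ fin (Y j)

        joint : Tuple (fin (Y j)) → Tuple Joint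
        joint y = (A ++ below s (suc i)) ++ y

        joint-≼ : ∀ {y} → y ⊨ₜ tp d C → joint d ≼ joint y
        joint-≼ {y} type = ≼-sub {P = fin (Y j) ⊕ (Θ ⊕ (Z j ⊕ Copies (Fin (suc i)) X′))} {R = Joint}
          (λ { (inj₁ (inj₁ x)) → var (inj₂ (inj₁ x))
             ; (inj₁ (inj₂ x)) → var (inj₂ (inj₂ (inj₂ x)))
             ; (inj₂ q)        → var (inj₁ q) })
          {d ++ C} {y ++ C}
          (λ { (inj₁ (inj₁ x)) → refl ; (inj₁ (inj₂ x)) → refl ; (inj₂ q) → refl })
          (λ { (inj₁ (inj₁ x)) → refl ; (inj₁ (inj₂ x)) → refl ; (inj₂ q) → refl }) type

        abstract
          jointᵈ : Def (fin X ⊕ Joint) (λ v →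
            (∀ l → ⊨ ψ [ (v ∘ inj₁) ++ ((v ∘ inj₂ ∘ inj₁ ∘ inj₁) ++ (λ x → v (inj₂ (inj₁ (inj₂ (l , x)))))) ]) ×
            (⊨ δ j [ (v ∘ inj₁) ++ (v ∘ inj₂ ∘ inj₂) ]))
          jointᵈ =
            subᵈ (χᵈ i) (λ { (inj₁ x) → var (inj₁ x) ; (inj₂ x) → var (inj₂ (inj₁ x)) })
              {λ v → (v ∘ inj₁) ++ (v ∘ inj₂ ∘ inj₁)} (λ { v (inj₁ x) → refl ; v (inj₂ x) → refl })
            ×ᵈ subᵈ ⟦ δ j ⟧ (λ { (inj₁ x) → var (inj₁ x) ; (inj₂ q) → var (inj₂ (inj₂ q)) })
              λ { v (inj₁ x) → refl ; v (inj₂ q) → refl }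

        rank-conjugate : ∀ {o} (α : Ordinal o) {y} → y ⊨ₜ tp d C →
          R (Ψ i ∧ᵖ δ̂ j ⟨ merged (suc i) ⟩) α → R (Ψ i ∧ᵖ δ̂ j ⟨ insert y ∘ pick S ⟩) α
        rank-conjugate α {y} type = rank-invariant (tabulate δ̂) (tabulate π̂) k α (formula jointᵈ) (joint-≼ type)
          (λ x (h , h′) → holds jointᵈ {x ++ joint d}
            (to (⊨Ψ i x) h , to (⊨δ̂ j {z = s (suc i) ∘ inj₂ ∘ inj₁} λ _ → ≈-refl) h′))
          (λ x h → let h₁ , h₂ = meaning jointᵈ {x ++ joint y} h in
            from (⊨Ψ i x) h₁ , from (⊨δ̂ j {z = insert y} λ _ → ≈-refl)
              (⊨-≡ (δ j) (λ { (inj₁ x) → refl ; (inj₂ q) → sym (insert-block y q) }) h₂))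

        -- Every conjugate of `d` over `C` gives a node and can be read off its block `j`, so
        -- finitely many nodes would make `d` algebraic over `C`.
        rank-step : ∀ {o} (α : Ordinal o) → R (Ψ i ∧ᵖ δ̂ j ⟨ merged (suc i) ⟩) α → R (Ψ i) (suc α)
        rank-step α rank = δ̂ j , π̂ j , ∈-tabulate⁺ j , ∈-tabulate⁺ j , parameters-at (suc i)
          , (λ (ts , cover) → nonAlgebraic⇒¬algebraic d C (sub (π j) into) (free (suc i) j)
              (map (λ t q → expand t (j , q)) ts , λ y type → Any.map⁺ (Any.map
                (λ e q → ≈-trans (≡⇒≈ (sym (insert-block y q))) (expand-of {z = insert y} e (j , q)))
                (cover (insert y ∘ pick S) (condition type , rank-conjugate α type rank)))))
          , inconsistent (suc i) j

      rank-unbounded : ∀ {o} (α : Ordinal o) i → R (Ψ i) α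
      rank-unbounded zero      i = lift (b , from (⊨Ψ i b) λ l → hψ (Fin.toℕ l))
      rank-unbounded (lim I α) i = (b , from (⊨Ψ i b) λ l → hψ (Fin.toℕ l)) , λ j → rank-unbounded (α j) i
      rank-unbounded (suc α)   i =
        let j , rank = rank-⋁ (tabulate δ̂) (tabulate π̂) k α {φ = Ψ (suc i)} {λ j → Ψ i ∧ᵖ δ̂ j ⟨ merged (suc i) ⟩}
                         split (rank-unbounded α (suc i))
        in Step.rank-step i j α rank
        where
        split : ∀ x → ⊨ᵖ Ψ (suc i) [ x ] → ∃[ j ] (⊨ᵖ Ψ i [ x ]) × (⊨ δ̂ j [ x ++ merged (suc i) ])
        split x h =
          let hs = to (⊨Ψ (suc i) x) h
              ψ-at = λ l → ⊨ ψ [ x ++ (A ++ (s l ∘ inj₁)) ]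
              -- The last conjunct, `ψ` at entry `suc i`, selects the disjunct; the other conjuncts
              -- make up `Ψ i`.
              j , h′ = covers (suc i) x (subst ψ-at (Fin.toℕ-fromℕ (suc i)) (hs (Fin.fromℕ (suc i))))
          in j , from (⊨Ψ i x) (λ l → subst ψ-at (Fin.toℕ-inject₁ l) (hs (Fin.inject₁ l)))
               , from (⊨δ̂ j {z = s (suc i) ∘ inj₂ ∘ inj₁} λ _ → ≈-refl) h′

      not-rosy : ¬ Rosy
      not-rosy rosy =
        let α , _ , bound = rosy (tabulate δ̂) (tabulate π̂) k (Ψ 0) (b , from (⊨Ψ 0 b) λ l → hψ (Fin.toℕ l))
        in bound (rank-unbounded (suc α) 0)

-- Rosiness implies symmetry

module RosySymmetric (em : Classical) (κ : Level) {ℓ c} {L : Language ℓ}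
  (M : Structure L c) (sat : κ-Saturated κ M) where
  open Language L
  open Structure M
  open Semantics M
  open Sub-semantics M
  open Definability em M
  open Compactness em κ M sat
  open Counting em κ M
  open Forking em κ M sat
  open Thorn κ M
  open Morley em κ M sat
  open Descent em κ M sat

  finitize-left : ∀ {i j} {Γ : Ctx i Sort} {P : Ctx j Sort} (S : Selection (Index P)) (φ : Formula L (P ⊕ Γ)) →
    (∀ x → inj₂ x ∈ᶠ sub φ exchange → x ∈ˢ S) →
    Σ[ φ′ ∈ Formula L (P ↾ S ⊕ Γ) ] (∀ {t z v} → (∀ q → t q ≈ z (pick S q)) → (⊨ φ′ [ t ++ v ]) ⇔ (⊨ φ [ z ++ v ]))
  finitize-left S φ cover = sub (finitize S (sub φ exchange) cover) exchange , λ e →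
    ⊨-exchange φ ⇔-∘ (⊨-finitize S (sub φ exchange) cover e ⇔-∘ ⊨-exchange (finitize S (sub φ exchange) cover))

  bound : ∀ {r} (f : Fin r → ℕ) → ∃[ k ] (∀ j → f j ≤ k)
  bound {zero}  f = 0 , λ ()
  bound {suc r} f = let k , h = bound (f ∘ suc) in
    f zero + k , λ { zero → ℕ.m≤m+n _ k ; (suc j) → ℕ.≤-trans (h j) (ℕ.m≤n+m k _) }

  module _ {X V Θ : Ctx κ Sort} {a : Tuple X} {b : Tuple V} {A : Tuple Θ}
           (nf : ¬ TypeThornForks (tp a (A ++ b)) A)
           (ψ : Formula L (V ⊕ (Θ ⊕ X))) (hψ : ⊨ ψ [ b ++ (A ++ a) ])
           (ds : List (ThornDividing {X = V} A)) (cover : ∀ x → ⊨ ψ [ x ++ (A ++ a) ] → Covers ds x) where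

    private
      J : Set
      J = Fin (length ds)

      module D (j : J) = ThornDividing (lookup ds j)

      Z : J → Ctx κ Sort
      Z j = proj₁ (D.divides j)

      z : ∀ j → Tuple (Z j)
      z j = proj₁ (proj₂ (D.divides j))

      open Blocks D.Y Z X

      w₀ : Tuple W
      w₀ = a ++ ((λ (j , q) → D.a j q) ++ (λ (j , x) → z j x))

      ¬algebraic : ∀ j → ¬ Algebraic (tp (D.a j) (A ++ z j))
      ¬algebraic j = proj₁ (proj₂ (proj₂ (D.divides j)))

      bounded : ∃[ k ] (∀ j → proj₁ (proj₂ (proj₂ (proj₂ (D.divides j)))) ≤ k)
      bounded = bound _

      k : ℕ
      k = proj₁ bounded

      abstract
        dividing-formula : ∀ j → Σ[ π ∈ Formula L (fin (D.Y j) ⊕ (Θ ⊕ Z j)) ]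
          (⊨ π [ D.a j ++ (A ++ z j) ]) × KInconsistent k (D.δ j) (λ y → ⊨ π [ y ++ (A ++ z j) ])
        dividing-formula j =
          let π , h , inc = inconsistency-formula (D.a j) (A ++ z j) (some-formula (lookup ds j)) (D.δ j) _
                              (proj₂ (proj₂ (proj₂ (proj₂ (D.divides j)))))
          in π , h , kInconsistent-≤ {δ = D.δ j} {λ y → ⊨ π [ y ++ (A ++ z j) ]} (proj₂ bounded j) inc

      π : ∀ j → Formula L (fin (D.Y j) ⊕ (Θ ⊕ Z j))
      π j = proj₁ (dividing-formula j)

      variables-of : ∀ {i} {Γ : Ctx i Sort} → Formula L (V ⊕ Γ) → List (Index V)
      variables-of φ = inj₂s (proj₁ (variables (sub φ exchange)))

      -- The rank needs finitely many object variables, whereas `V` may be infinite. Those that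
      -- occur in `ψ` or in some dividing formula suffice; the others stay at the values of `b`.
      selection : Σ[ S ∈ Selection (Index V) ]
        (∀ x → x ∈ variables-of ψ ++ˡ concat (tabulate λ j → variables-of (D.δ j)) → x ∈ˢ S)
      selection = select em _

      S : Selection (Index V)
      S = proj₁ selection

      abstract
        ψ-finite : Σ[ φ ∈ Formula L (V ↾ S ⊕ (Θ ⊕ X)) ]
          (∀ {t z v} → (∀ q → t q ≈ z (pick S q)) → (⊨ φ [ t ++ v ]) ⇔ (⊨ ψ [ z ++ v ]))
        ψ-finite = finitize-left S ψ λ x p → proj₂ selection x
          (∈-++⁺ˡ (∈-inj₂s (proj₂ (variables (sub ψ exchange)) (inj₂ x) p)))

        δ-finite : ∀ j → Σ[ φ ∈ Formula L (V ↾ S ⊕ fin (D.Y j)) ]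
          (∀ {t z v} → (∀ q → t q ≈ z (pick S q)) → (⊨ φ [ t ++ v ]) ⇔ (⊨ D.δ j [ z ++ v ]))
        δ-finite j = finitize-left S (D.δ j) λ x p → proj₂ selection x
          (∈-++⁺ʳ (variables-of ψ) (∈-concat⁺′ (∈-inj₂s (proj₂ (variables (sub (D.δ j) exchange)) (inj₂ x) p))
            (∈-tabulate⁺ j)))

      ψᶠ : Formula L (V ↾ S ⊕ (Θ ⊕ X))
      ψᶠ = proj₁ ψ-finite

      δᶠ : ∀ j → Formula L (V ↾ S ⊕ fin (D.Y j))
      δᶠ j = proj₁ (δ-finite j)

      expand : Tuple (V ↾ S) → Tuple V
      expand t = extend S t λ x _ → b x

      expand-pick : ∀ t p → t p ≈ expand t (pick S p)
      expand-pick t p = ≡⇒≈ (sym (extend-in S t _ p))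

      from-base : ∀ j → Sub L (Θ ⊕ Z j) (Θ ⊕ W)
      from-base j (inj₁ x) = var (inj₁ x)
      from-base j (inj₂ x) = var (inj₂ (inj₂ (inj₂ (j , x))))

      from-block : ∀ j → Sub L (fin (D.Y j) ⊕ (Θ ⊕ Z j)) (Θ ⊕ W)
      from-block j (inj₁ q) = var (inj₂ (inj₂ (inj₁ (j , q))))
      from-block j (inj₂ x) = from-base j x

      dividesᵈ : ∀ j → Def (Θ ⊕ W) (λ v →
        ⊨ π j [ divisor (v ∘ inj₂) j ++ ((v ∘ inj₁) ++ base (v ∘ inj₂) j) ])
      dividesᵈ j = subᵈ ⟦ π j ⟧ (from-block j)
        λ { v (inj₁ q) → refl ; v (inj₂ (inj₁ x)) → refl ; v (inj₂ (inj₂ x)) → refl }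

      inconsistentᵈ : ∀ j → Def (Θ ⊕ W) (λ v →
        KInconsistent k (δᶠ j) (λ y → ⊨ π j [ y ++ ((v ∘ inj₁) ++ base (v ∘ inj₂) j) ]))
      inconsistentᵈ j = subᵈ (kInconsistentᵈ (π j) k (δᶠ j)) (from-base j)
        {λ v → (v ∘ inj₁) ++ base (v ∘ inj₂) j} λ { v (inj₁ x) → refl ; v (inj₂ x) → refl }

      Uncovered : Tuple ((Θ ⊕ W) ⊕ V ↾ S) → Set _
      Uncovered v = (⊨ ψᶠ [ (v ∘ inj₂) ++ ((v ∘ inj₁ ∘ inj₁) ++ (v ∘ inj₁ ∘ inj₂ ∘ inj₁)) ]) ×
                    (∀ j → ¬ (⊨ δᶠ j [ (v ∘ inj₂) ++ divisor (v ∘ inj₁ ∘ inj₂) j ]))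

      uncoveredᵈ : Def ((Θ ⊕ W) ⊕ V ↾ S) Uncovered
      uncoveredᵈ = ψᵈ ×ᵈ ∀ᵈ (formula ψᵈ) λ j → ¬ᵈ subᵈ ⟦ δᶠ j ⟧
        (λ { (inj₁ x) → var (inj₂ x) ; (inj₂ q) → var (inj₁ (inj₂ (inj₂ (inj₁ (j , q))))) })
        λ { v (inj₁ x) → refl ; v (inj₂ q) → refl }
        where
        ψᵈ : Def ((Θ ⊕ W) ⊕ V ↾ S) (λ v → ⊨ ψᶠ [ (v ∘ inj₂) ++ ((v ∘ inj₁ ∘ inj₁) ++ (v ∘ inj₁ ∘ inj₂ ∘ inj₁)) ])
        ψᵈ = subᵈ ⟦ ψᶠ ⟧ (λ { (inj₁ x) → var (inj₂ x) ; (inj₂ (inj₁ x)) → var (inj₁ (inj₁ x))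
                            ; (inj₂ (inj₂ x)) → var (inj₁ (inj₂ (inj₁ x))) })
          λ { v (inj₁ x) → refl ; v (inj₂ (inj₁ x)) → refl ; v (inj₂ (inj₂ x)) → refl }

      -- Written as a formula, the implication from `ψ` to the disjunction passes from `w₀` to every
      -- entry of the sequence.
      coveredᵈ : Def (Θ ⊕ W) (λ v → ¬ (∃[ x ] Uncovered (v ++ x)))
      coveredᵈ = ¬ᵈ ∃ᵈ uncoveredᵈ enumerate-Fin

      covered : ¬ (∃[ x ] Uncovered ((A ++ w₀) ++ x))
      covered (x , h , none) =
        let p = cover (expand x) (to (proj₂ ψ-finite (expand-pick x)) h)
        in none (index p) (from (proj₂ (δ-finite (index p)) (expand-pick x)) (Any.lookup-index p))

      module _ (s : ℕ → Tuple W)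
               (real : ∀ i → (A ++ w₀ ≼ A ++ s i) ×
                             (∀ φ → ⊨ φ [ a ++ (A ++ b) ] → ⊨ φ [ (s i ∘ inj₁) ++ (A ++ b) ]))
               (free : ∀ i → Free A s i) where

        same-ψ : ∀ i → ⊨ ψ [ b ++ (A ++ (s i ∘ inj₁)) ]
        same-ψ i = to (⊨-sub ψ (at-b (s i ∘ inj₁))) (proj₂ (real i) (sub ψ σ) (from (⊨-sub ψ (at-b a)) hψ))
          where
          σ : Sub L (V ⊕ (Θ ⊕ X)) (X ⊕ (Θ ⊕ V))
          σ (inj₁ x) = var (inj₂ (inj₂ x))
          σ (inj₂ (inj₁ x)) = var (inj₂ (inj₁ x))
          σ (inj₂ (inj₂ x)) = var (inj₁ x)
          at-b : ∀ a x → eval (σ x) (a ++ (A ++ b)) ≡ (b ++ (A ++ a)) x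
          at-b a (inj₁ x) = refl
          at-b a (inj₂ (inj₁ x)) = refl
          at-b a (inj₂ (inj₂ x)) = refl

        sequence-not-rosy : ¬ Rosy
        sequence-not-rosy = Merge.not-rosy ψᶠ δᶠ π k s free
          (λ i x h → by-contradiction em λ none →
            transport coveredᵈ (proj₁ (real i)) covered (x , h , λ j h′ → none (j , h′)))
          (λ i j → transport (inconsistentᵈ j) (proj₁ (real i)) λ ys hs distinct (x , sols) →
            proj₂ (proj₂ (dividing-formula j)) ys hs distinct
              (expand x , λ l → to (proj₂ (δ-finite j) (expand-pick x)) (sols l)))
          (λ i j → transport (dividesᵈ j) (proj₁ (real i)) (proj₁ (proj₂ (dividing-formula j))))
          (b ∘ pick S) (λ i → from (proj₂ ψ-finite λ _ → ≈-refl) (same-ψ i))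

    forking-not-rosy : ¬ Rosy
    forking-not-rosy = conclude (infinite-sequence w₀ nf λ j → ¬algebraic⇒nonAlgebraic (¬algebraic j))
      where
      conclude : _ → ¬ Rosy
      conclude (s , real , free) = sequence-not-rosy s real free

  rosy⇒symmetric : Rosy → ThornForkingSymmetric
  rosy⇒symmetric rosy X Y Θ a b A = mk⇔ (symmetric a b) (symmetric b a)
    where
    symmetric : ∀ {X Y} (a : Tuple X) (b : Tuple Y) →
                ¬ TypeThornForks (tp a (A ++ b)) A → ¬ TypeThornForks (tp b (A ++ a)) A
    symmetric a b nf forks = let ψ , hψ , ds , cover = forking-formula forks in
      forking-not-rosy nf ψ hψ ds cover rosy

-- Symmetry implies rosiness

module SymmetricRosy (em : Classical) (κ : Level) {ℓ c} {L : Language ℓ}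
  (M : Structure L c) (sat : κ-Saturated κ M) where
  open Language L
  open Structure M
  open Semantics M
  open Sub-semantics M
  open Definability em M
  open Compactness em κ M sat
  open Counting em κ M
  open Forking em κ M sat
  open Thorn κ M
  open Rank em κ M sat

  -- Pigeonhole for infinitely many stages: a value that stops recurring from `N` on is dropped, and
  -- the stages are counted from `N`.
  infinitely-often : ∀ {a p} {I : Set a} {P : ℕ → I → Set p} (l : List I) → (∀ i → ∃[ y ] y ∈ l × P i y) →
                     ∃[ y ] y ∈ l × (∀ N → ∃[ i ] N ≤ i × P i y)
  infinitely-often [] h = case h 0 of λ { (_ , () , _) }
  infinitely-often {P = P} (y ∷ l) h with em {P = ∀ N → ∃[ i ] N ≤ i × P i y}
  ... | yes often = y , here refl , often
  ... | no ¬often =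
    let N , none = by-contradiction em λ h′ → ¬often λ N → by-contradiction em λ none → h′ (N , none)
        z , z∈l , often = infinitely-often {P = λ i → P (N + i)} l λ i → case h (N + i) of λ
          { (_ , here refl , p) → contradiction (N + i , ℕ.m≤m+n N i , p) none
          ; (z , there z∈l , p) → z , z∈l , p }
    in z , there z∈l , λ N′ → let i , N′≤i , p = often N′ in N + i , ℕ.≤-trans N′≤i (ℕ.m≤n+m i N) , p

  finite-ordinal : ∀ {o} → ℕ → Ordinal o
  finite-ordinal zero    = zero
  finite-ordinal (suc n) = suc (finite-ordinal n)

  finite-Any : ∀ {a i r} {I : Set a} {X : Ctx i Sort} {P : I → Pred (Tuple X) r} (l : List I) →
               (∀ e → Finite (P e)) → Finite (λ x → Any (λ e → P e x) l)
  finite-Any []      f = [] , λ _ ()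
  finite-Any (e ∷ l) f =
    let xs , cover = f e ; ys , cover′ = finite-Any l f
    in xs ++ˡ ys , λ { x (here p) → Any.++⁺ˡ (cover x p) ; x (there p) → Any.++⁺ʳ xs (cover′ x p) }

  module Chain {m n} {X : Fin m → Sort} {Y : Fin n → Sort} {Z : Ctx κ Sort}
               (Δ : List (Formula L (fin X ⊕ fin Y))) (Π : List (Formula L (fin Y ⊕ Z))) (k : ℕ) where

    B : Ctx κ Sort
    B = fin Y ⊕ Z

    below : (ℕ → Tuple B) → ∀ i → Tuple (Copies (Fin i) B)
    below h i (l , x) = h (Fin.toℕ l) x

    Divides : Tuple (fin X) → Tuple B → Formula L (fin X ⊕ fin Y) × Formula L (fin Y ⊕ Z) → Set _
    Divides x β (δ , π) = (⊨ δ [ x ++ (β ∘ inj₁) ]) × (⊨ π [ β ]) × KInconsistent k δ (λ y → ⊨ π [ y ++ (β ∘ inj₂) ])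

    Good : Tuple (fin X) → Tuple B → Set _
    Good x β = Σ[ p ∈ Formula L (fin X ⊕ fin Y) × Formula L (fin Y ⊕ Z) ]
               (proj₁ p ∈ Δ × proj₂ p ∈ Π) × Divides x β p

    -- A possible reason for the divisor at `i` to be algebraic: a formula over its base and the
    -- earlier entries, with a bound on the number of solutions.
    Constraint : Set _
    Constraint = Σ[ i ∈ ℕ ] Formula L (fin Y ⊕ (Z ⊕ Copies (Fin i) B)) × ℕ

    Small : (ℕ → Tuple B) → Tuple Z → Constraint → Tuple (fin Y) → Set _
    Small h c (i , θ , l) y = (⊨ θ [ y ++ (c ++ below h i) ]) × Fewer l (λ y → ⊨ θ [ y ++ (c ++ below h i) ])

    Avoids : (ℕ → Tuple B) → Constraint → Set _
    Avoids h e = ¬ Small h (h (proj₁ e) ∘ inj₂) e (h (proj₁ e) ∘ inj₁)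

    small-finite : ∀ h c e → Finite (Small h c e)
    small-finite h c (i , θ , l) with em {P = Fewer l (λ y → ⊨ θ [ y ++ (c ++ below h i) ])}
    ... | yes few = finite-⊆ (λ _ → proj₁) (fewer⇒finite l few)
    ... | no many = [] , λ y (_ , few) → contradiction few many

    update : ℕ → Tuple B → (ℕ → Tuple B) → ℕ → Tuple B
    update i β h l with l ℕ.≟ i
    ... | yes _ = β
    ... | no _  = h l

    update-same : ∀ i β h → update i β h i ≡ β
    update-same i β h with i ℕ.≟ i
    ... | yes _ = refl
    ... | no ne = contradiction refl ne

    update-below : ∀ i β h {l} → l < i → update i β h l ≡ h l
    update-below i β h {l} l<i with l ℕ.≟ i
    ... | yes refl = contradiction l<i (ℕ.n≮n i)
    ... | no _     = refl

    private
      R : ParamFormula (fin X) → ℕ → Set _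
      R φ r = RankAtLeast Δ Π k φ (finite-ordinal {κ ⊔ ℓ ⊔ c} r)

    module _ (Φ : List Constraint) (N : ℕ) where

      Continuation : ℕ → (ℕ → Tuple B) → ParamFormula (fin X) → Set _
      Continuation i h χ = ∃[ x ] ∃[ h′ ] (⊨ᵖ χ [ x ]) × (∀ {l} → l < i → h′ l ≡ h l) ×
        (∀ l → i ≤ l → l < N → Good x (h′ l) × (∀ e → e ∈ Φ → proj₁ e ≡ l → Avoids h′ e))

      module _ {i : ℕ} {h : ℕ → Tuple B} {χ : ParamFormula (fin X)}
               (δ : Formula L (fin X ⊕ fin Y)) (π : Formula L (fin Y ⊕ Z)) (δ∈Δ : δ ∈ Δ) (π∈Π : π ∈ Π)
               (c : Tuple Z) (inc : KInconsistent k δ (λ y → ⊨ π [ y ++ c ]))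
               (d : Tuple (fin Y)) (p : ⊨ π [ d ++ c ]) (avoids : ¬ Any (λ e → Small h c e d) Φ) where

        prolong : Continuation (suc i) (update i (d ++ c) h) (χ ∧ᵖ δ ⟨ d ⟩) → Continuation i h χ
        prolong (x , h′ , (hχ , hδ) , fixed , rest) = x , h′ , hχ , earlier , λ l i≤l l<N →
          case ℕ.m≤n⇒m<n∨m≡n i≤l of λ { (inj₁ i<l) → rest l i<l l<N ; (inj₂ refl) → good , avoid }
          where
          earlier : ∀ {l} → l < i → h′ l ≡ h l
          earlier l<i = trans (fixed (ℕ.m<n⇒m<1+n l<i)) (update-below i (d ++ c) h l<i)
          current : h′ i ≡ d ++ c
          current = trans (fixed (ℕ.n<1+n i)) (update-same i (d ++ c) h)
          good : Good x (h′ i)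
          good = subst (Good x) (sym current)
            ((δ , π) , (δ∈Δ , π∈Π) , ⊨-≡ δ (λ { (inj₁ x) → refl ; (inj₂ q) → refl }) hδ , p , inc)
          avoid : ∀ e → e ∈ Φ → proj₁ e ≡ i → Avoids h′ e
          avoid e@(.i , θ , l) e∈Φ refl (t , few) = avoids (Any.map (λ { refl → small }) e∈Φ)
            where
            same : ∀ z → ((h′ i ∘ inj₂) ++ below h′ i) z ≡ (c ++ below h i) z
            same (inj₁ z)       = cong (λ β → β (inj₂ z)) current
            same (inj₂ (q , z)) = cong (λ β → β z) (earlier (Fin.toℕ<n q))
            small : Small h c e d
            small = ⊨-≡ θ (λ { (inj₁ q) → cong (λ β → β (inj₁ q)) current ; (inj₂ z) → same z }) t
                  , fewer-resp θ {v = (h′ i ∘ inj₂) ++ below h′ i} {c ++ below h i} (λ z → ≡⇒≈ (same z)) few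

      -- Each entry costs one unit of rank, so the rank left and the number of entries chosen add up
      -- to `N`. The point `x` is found at the leaf only, where it satisfies all instances of `δ`
      -- collected on the way.
      path : ∀ r i h χ → r + i ≡ N → R χ r → Continuation i h χ
      path zero i h χ refl (lift (x , hχ)) =
        x , h , hχ , (λ _ → refl) , λ l i≤l l<i → contradiction l<i (ℕ.≤⇒≯ i≤l)
      path (suc r) i h χ e (δ , π , δ∈Δ , π∈Π , c , inf , inc) =
        let d , (p , rank) , avoids = infinite-∖ inf (finite-Any {P = λ e → Small h c e} Φ (small-finite h c))
        in prolong {i} {h} {χ} δ π δ∈Δ π∈Π c inc d p avoids
             (path r (suc i) (update i (d ++ c) h) (χ ∧ᵖ δ ⟨ d ⟩) (trans (ℕ.+-suc r i) e) rank)

    module _ (x : Tuple (fin X)) (h : ℕ → Tuple B) (good : ∀ i → Good x (h i)) (avoids : ∀ e → Avoids h e) where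

      private
        A : Tuple (Copies ℕ B)
        A (i , y) = h i y

        x̂ : Tuple (fin X ⊕ εκ)
        x̂ = pad x

        frequent : Σ[ p ∈ Formula L (fin X ⊕ fin Y) × Formula L (fin Y ⊕ Z) ]
                   p ∈ cartesianProduct Δ Π × (∀ N → ∃[ i ] N ≤ i × Divides x (h i) p)
        frequent = infinitely-often {P = λ i p → Divides x (h i) p} (cartesianProduct Δ Π) λ i →
          let p , (δ∈ , π∈) , divides = good i in p , ∈-cartesianProduct⁺ δ∈ π∈ , divides

        δ : Formula L (fin X ⊕ fin Y)
        δ = proj₁ (proj₁ frequent)

        π : Formula L (fin Y ⊕ Z)
        π = proj₂ (proj₁ frequent)

        -- The stages are those at which one fixed pair `δ`, `π` recurs, and late ones, so that the
        -- approximating stage lies beyond all entries that a given formula over `A` mentions.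
        Tail : ℕ → Tuple B → Set _
        Tail N β = ∃[ i ] N ≤ i × Divides x (h i) (δ , π) × (∀ y → β y ≡ h i y)

        Q : Ctx κ Sort
        Q = Copies ℕ B ⊕ (fin X ⊕ εκ)

        -- As entry `i` belongs to the base, the fact that it satisfies the dividing formula is part
        -- of the type of the divisor; infinitely many conjugates would share it as a solution.
        not-in-base : ∀ {A : Tuple (Copies ℕ B)} {i} (td : ThornDividing {X = B} A) →
                      ¬ (⊨ ThornDividing.δ td [ (λ y → A (i , y)) ++ ThornDividing.a td ])
        not-in-base {A} {i} td h =
          let Z , c , ¬alg , l , inc = ThornDividing.divides td
              ys , types , distinct = infinite⇒many {P = _⊨ₜ tp (ThornDividing.a td) (A ++ c)} ¬alg l
          in inc ys types distinct ((λ y → A (i , y)) , λ j →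
               to (⊨-sub (ThornDividing.δ td) λ { (inj₁ x) → refl ; (inj₂ q) → refl })
                 (types j (sub (ThornDividing.δ td) (σ Z))
                   (from (⊨-sub (ThornDividing.δ td) λ { (inj₁ x) → refl ; (inj₂ q) → refl }) h)))
          where
          σ : ∀ Z → Sub L (B ⊕ fin (ThornDividing.Y td)) (fin (ThornDividing.Y td) ⊕ (Copies ℕ B ⊕ Z))
          σ Z (inj₁ y) = var (inj₂ (inj₁ (i , y)))
          σ Z (inj₂ q) = var (inj₁ q)

        bounded : (φ : Formula L (fin Y ⊕ (Copies ℕ B ⊕ Z))) →
                  ∃[ N ] (∀ l y → inj₂ (inj₁ (l , y)) ∈ᶠ φ → l < N)
        bounded φ = let l , vars = variables φ ; N , h = go l in N , λ i y p → h i y (vars _ p)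
          where
          go : (l : List (Index (fin Y ⊕ (Copies ℕ B ⊕ Z)))) → ∃[ N ] (∀ i y → inj₂ (inj₁ (i , y)) ∈ l → i < N)
          go [] = 0 , λ _ _ ()
          go (inj₁ q ∷ l) = let N , h = go l in N , λ { i y (there p) → h i y p }
          go (inj₂ (inj₂ z) ∷ l) = let N , h = go l in N , λ { i y (there p) → h i y p }
          go (inj₂ (inj₁ (i , y)) ∷ l) = let N , h = go l in
            suc i + N , λ { i′ y′ (here refl) → ℕ.m≤m+n _ N
                          ; i′ y′ (there p) → ℕ.≤-trans (h i′ y′ p) (ℕ.m≤n+m N (suc i)) }

        tail-divides : ∀ {N β} → Tail N β → Divides x β (δ , π)
        tail-divides (i , _ , (hδ , hπ , inc) , e) =
          ⊨-≡ δ (λ { (inj₁ x) → refl ; (inj₂ q) → sym (e (inj₁ q)) }) hδ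
          , ⊨-≡ π (λ y → sym (e y)) hπ
          , λ ys ps → inc ys λ j → ⊨-≡ π (λ { (inj₁ q) → refl ; (inj₂ z) → e (inj₂ z) }) (ps j)

        module _ (β : Tuple B) (adh : ∀ N → Adherent (A ++ x̂) (Tail N) β) where

          d : Tuple (fin Y)
          d = β ∘ inj₁

          c′ : Tuple Z
          c′ = β ∘ inj₂

          not-forking : ¬ TypeThornForks (tp β (A ++ x̂)) A
          not-forking forks = refute (forking-formula forks)
            where
            realised : ∀ φ (ds : List (ThornDividing {X = B} A)) →
              (∀ y → ⊨ φ [ y ++ (A ++ x̂) ] → Covers ds y) → ¬ (∃[ y ] Tail 0 y × (⊨ φ [ y ++ (A ++ x̂) ]))
            realised φ ds cover (y , (i , _ , _ , e) , h) =
              let p = cover (λ y → A (i , y)) (⊨-≡ φ (λ { (inj₁ y) → e y ; (inj₂ y) → refl }) h)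
              in not-in-base (lookup ds (index p)) (Any.lookup-index p)
            refute : _ → ⊥
            refute (φ , hφ , ds , cover) = realised φ ds cover (approximate (adh 0) ⟦ φ ⟧ hφ)

          limit-δ : ⊨ δ [ x ++ d ]
          limit-δ = closed (adh 0)
            (subᵈ ⟦ δ ⟧ (λ { (inj₁ x) → var (inj₂ (inj₂ (inj₁ x))) ; (inj₂ q) → var (inj₁ (inj₁ q)) })
              {λ v → (λ x → v (inj₂ (inj₂ (inj₁ x)))) ++ (λ q → v (inj₁ (inj₁ q)))}
              λ { v (inj₁ x) → refl ; v (inj₂ q) → refl })
            λ _ t → proj₁ (tail-divides t)

          limit-π : ⊨ π [ d ++ c′ ]
          limit-π = closed (adh 0)
            (subᵈ ⟦ π ⟧ (λ { (inj₁ q) → var (inj₁ (inj₁ q)) ; (inj₂ z) → var (inj₁ (inj₂ z)) })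
              {λ v → (λ q → v (inj₁ (inj₁ q))) ++ (λ z → v (inj₁ (inj₂ z)))}
              λ { v (inj₁ x) → refl ; v (inj₂ q) → refl })
            λ _ t → ⊨-≡ π (λ { (inj₁ q) → refl ; (inj₂ z) → refl }) (proj₁ (proj₂ (tail-divides t)))

          limit-inconsistent : KInconsistent k δ (λ y → ⊨ π [ y ++ c′ ])
          limit-inconsistent = closed (adh 0)
            (subᵈ (kInconsistentᵈ π k δ) (λ z → var (inj₁ (inj₂ z))) {λ v z → v (inj₁ (inj₂ z))} λ v z → refl)
            λ _ t → proj₂ (proj₂ (tail-divides t))

          -- A formula `θ` making `d` algebraic mentions entries below some `N` only. At an
          -- approximating stage `i ≥ N` it becomes a formula over the base and the entries below
          -- `i`, hence one of the constraints avoided there.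
          limit-nonAlgebraic : NonAlgebraic d (A ++ c′)
          limit-nonAlgebraic θ l hθ few =
            let N , below-N = bounded θ
                β′ , (i , N≤i , _ , e) , hθ′ , few′ = approximate (adh N)
                  (subᵈ (algebraicᵈ θ l) σ
                    {λ v → (λ q → v (inj₁ (inj₁ q))) ++ ((λ y → v (inj₂ (inj₁ y))) ++ (λ z → v (inj₁ (inj₂ z))))}
                    λ { v (inj₁ q) → refl ; v (inj₂ (inj₁ y)) → refl ; v (inj₂ (inj₂ z)) → refl })
                  (hθ , few)
            in truncated i (λ j y p → ℕ.≤-trans (below-N j y p) N≤i) β′ e hθ′ few′
            where
            σ : Sub L (fin Y ⊕ (Copies ℕ B ⊕ Z)) (B ⊕ Q)
            σ (inj₁ q)        = var (inj₁ (inj₁ q))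
            σ (inj₂ (inj₁ y)) = var (inj₂ (inj₁ y))
            σ (inj₂ (inj₂ z)) = var (inj₁ (inj₂ z))
            truncated : ∀ i → (∀ j y → inj₂ (inj₁ (j , y)) ∈ᶠ θ → j < i) → ∀ β′ → (∀ y → β′ y ≡ h i y) →
              ⊨ θ [ (β′ ∘ inj₁) ++ (A ++ (β′ ∘ inj₂)) ] →
              ¬ Fewer l (λ y → ⊨ θ [ y ++ (A ++ (β′ ∘ inj₂)) ])
            truncated i below-i β′ e hθ few = avoids (i , subᶠ θ τ , l)
              ( from (⊨-τ {h i ∘ inj₁}) (⊨-≡ θ (λ { (inj₁ q) → e (inj₁ q) ; (inj₂ y) → same y }) hθ)
              , fewer-⊆ {Q = λ y → ⊨ θ [ y ++ (A ++ (h i ∘ inj₂)) ]} (λ y → to (⊨-τ {y}))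
                  (fewer-resp θ {v = A ++ (β′ ∘ inj₂)} {A ++ (h i ∘ inj₂)} (λ z → ≡⇒≈ (same z)) few))
              where
              same : ∀ z → (A ++ (β′ ∘ inj₂)) z ≡ (A ++ (h i ∘ inj₂)) z
              same (inj₁ y) = refl
              same (inj₂ z) = e (inj₂ z)
              τ : ∀ y → y ∈ᶠ θ → Term L (fin Y ⊕ (Z ⊕ Copies (Fin i) B)) (sort (fin Y ⊕ (Copies ℕ B ⊕ Z)) y)
              τ (inj₁ q)              p = var (inj₁ q)
              τ (inj₂ (inj₁ (j , y))) p = var (inj₂ (inj₂ (Fin.fromℕ< (below-i j y p) , y)))
              τ (inj₂ (inj₂ z))       p = var (inj₂ (inj₁ z))
              ⊨-τ : ∀ {y} → (⊨ subᶠ θ τ [ y ++ ((h i ∘ inj₂) ++ below h i) ]) ⇔ (⊨ θ [ y ++ (A ++ (h i ∘ inj₂)) ])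
              ⊨-τ = ⊨-subᶠ θ λ
                { (inj₁ q) p → ≈-refl
                ; (inj₂ (inj₁ (j , y))) p → ≡⇒≈ (cong (λ j → h j y) (Fin.toℕ-fromℕ< (below-i j y p)))
                ; (inj₂ (inj₂ z)) p → ≈-refl }

          δ̂ : Formula L ((fin X ⊕ εκ) ⊕ fin Y)
          δ̂ = sub δ λ { (inj₁ x) → var (inj₁ (inj₁ x)) ; (inj₂ q) → var (inj₂ q) }

          ⊨δ̂ : ∀ {w y} → (⊨ δ̂ [ w ++ y ]) ⇔ (⊨ δ [ (w ∘ inj₁) ++ y ])
          ⊨δ̂ = ⊨-sub δ λ { (inj₁ x) → refl ; (inj₂ q) → refl }

          into : Sub L (fin Y ⊕ Z) (fin Y ⊕ (Copies ℕ B ⊕ Z))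
          into (inj₁ q) = var (inj₁ q)
          into (inj₂ z) = var (inj₂ (inj₂ z))

          ⊨-into : ∀ {y} → (⊨ sub π into [ y ++ (A ++ c′) ]) ⇔ (⊨ π [ y ++ c′ ])
          ⊨-into = ⊨-sub π λ { (inj₁ q) → refl ; (inj₂ z) → refl }

          thorn-dividing : ThornDividing {X = fin X ⊕ εκ} A
          thorn-dividing = record
            { δ = δ̂ ; a = d
            ; divides = Z , c′ , nonAlgebraic⇒¬algebraic d (A ++ c′) (sub π into) limit-nonAlgebraic , k ,
                λ ys types distinct (w , sols) → limit-inconsistent ys
                  (λ j → to ⊨-into (types j (sub π into) (from ⊨-into limit-π))) distinct
                  (w ∘ inj₁ , λ j → to (⊨δ̂ {w}) (sols j)) }

          forking : TypeThornForks (tp x̂ (A ++ β)) A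
          forking = δ̂ ⟨ d ⟩
            , (λ w type → to (⊨-sub δ̂ λ { (inj₁ x) → refl ; (inj₂ q) → refl })
                (type (sub δ̂ ρ) (from (⊨-sub δ̂ λ { (inj₁ x) → refl ; (inj₂ q) → refl }) (from (⊨δ̂ {x̂}) limit-δ))))
            , thorn-dividing ∷ [] , λ w → here
            where
            ρ : Sub L ((fin X ⊕ εκ) ⊕ fin Y) ((fin X ⊕ εκ) ⊕ (Copies ℕ B ⊕ B))
            ρ (inj₁ x) = var (inj₁ x)
            ρ (inj₂ q) = var (inj₂ (inj₂ (inj₁ q)))

      chain-asymmetric : ¬ ThornForkingSymmetric
      chain-asymmetric symmetric = conclude (compactness {V = B} (A ++ x̂) Tail 0 _⊔ⁿ_
        (λ N M β (i , le , t) → (i , ℕ.≤-trans (ℕ.m≤m⊔n N M) le , t) , (i , ℕ.≤-trans (ℕ.m≤n⊔m N M) le , t))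
        λ N → let i , N≤i , t = proj₂ (proj₂ frequent) N in h i , i , N≤i , t , λ _ → refl)
        where
        conclude : ∃[ β ] (∀ N → Adherent (A ++ x̂) (Tail N) β) → ⊥
        conclude (β , adh) = to (symmetric B (fin X ⊕ εκ) (Copies ℕ B) β x̂ A) (not-forking β adh) (forking β adh)

    module _ (φ : ParamFormula (fin X)) (unbounded : ∀ r → R φ r) where

      private
        empty : Tuple εκ
        empty ()

        x-of : Tuple (fin X ⊕ Copies ℕ B) → Tuple (fin X)
        x-of ξ = ξ ∘ inj₁

        chain-of : Tuple (fin X ⊕ Copies ℕ B) → ℕ → Tuple B
        chain-of ξ i y = ξ (inj₂ (i , y))

        Approximation : ℕ × List Constraint → Tuple (fin X ⊕ Copies ℕ B) → Set _
        Approximation (N , Φ) ξ =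
          (∀ i → i < N → Good (x-of ξ) (chain-of ξ i)) × (∀ e → e ∈ Φ → proj₁ e < N → Avoids (chain-of ξ) e)

        -- Entries beyond the chosen ones need some value, and sorts may be empty; rank 1 provides
        -- one.
        initial : Tuple B
        initial = extract (unbounded 1)
          where
          extract : R φ 1 → Tuple B
          extract (δ , π , _ , _ , c , inf , _) = proj₁ (infinite-∖ {Q = λ _ → ⊥} inf ([] , λ _ ())) ++ c

        approximation : ∀ i → ∃ (Approximation i)
        approximation (N , Φ) = flatten (path Φ N N 0 (λ _ → initial) φ (ℕ.+-identityʳ N) (unbounded N))
          where
          flatten : Continuation Φ N 0 (λ _ → initial) φ → ∃ (Approximation (N , Φ))
          flatten (x , h , _ , _ , rest) = (x ++ λ (i , y) → h i y)
            , (λ i i<N → proj₁ (rest i z≤n i<N)) , λ e e∈Φ e<N → proj₂ (rest (proj₁ e) z≤n e<N) e e∈Φ refl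

        dividesᵈ : ∀ i ((δ , π) : Formula L (fin X ⊕ fin Y) × Formula L (fin Y ⊕ Z)) →
                   Def ((fin X ⊕ Copies ℕ B) ⊕ εκ) (λ v →
                     Divides (v ∘ inj₁ ∘ inj₁) (λ y → v (inj₁ (inj₂ (i , y)))) (δ , π))
        dividesᵈ i (δ , π) =
          subᵈ ⟦ δ ⟧ (λ { (inj₁ x) → var (inj₁ (inj₁ x)) ; (inj₂ q) → var (inj₁ (inj₂ (i , inj₁ q))) })
            (λ { v (inj₁ x) → refl ; v (inj₂ q) → refl })
          ×ᵈ subᵈ ⟦ π ⟧ (λ y → var (inj₁ (inj₂ (i , y)))) (λ v y → refl)
          ×ᵈ subᵈ (kInconsistentᵈ π k δ) (λ z → var (inj₁ (inj₂ (i , inj₂ z)))) (λ v y → refl)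

        module _ (ξ : Tuple (fin X ⊕ Copies ℕ B)) (adh : ∀ i → Adherent empty (Approximation i) ξ) where

          -- `Good` ranges over the finitely many pairs from `Δ` and `Π`, so its failure is a finite
          -- list of formulas, which an approximation would satisfy, too.
          limit-good : ∀ i → Good (x-of ξ) (chain-of ξ i)
          limit-good i = by-contradiction em λ bad → refute (adh (suc i , []) negations
            (All.map⁺ (All.tabulate λ {p} p∈ h → bad (p , ∈-cartesianProduct⁻ Δ Π p∈ , meaning (dividesᵈ i p) h))))
            where
            negations : List (Formula L ((fin X ⊕ Copies ℕ B) ⊕ εκ))
            negations = map (λ p → ¬′ formula (dividesᵈ i p)) (cartesianProduct Δ Π)
            fails : ∀ {ξ} → All (λ ψ → ⊨ ψ [ ξ ++ empty ]) negations → ¬ Good (x-of ξ) (chain-of ξ i)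
            fails none (p , (δ∈ , π∈) , h) =
              All.lookup (All.map⁻ none) (∈-cartesianProduct⁺ δ∈ π∈) (holds (dividesᵈ i p) h)
            refute : ¬ (∃[ ξ ] Approximation (suc i , []) ξ × All (λ ψ → ⊨ ψ [ ξ ++ empty ]) negations)
            refute (ξ , (good , _) , none) = fails none (good i (ℕ.n<1+n i))

          limit-avoids : ∀ e → Avoids (chain-of ξ) e
          limit-avoids e@(i , θ , l) small =
            let ξ′ , (_ , avoids) , small′ = approximate (adh (suc i , e ∷ []))
                  (subᵈ (algebraicᵈ θ l) σ
                    {λ v → (λ q → v (inj₁ (inj₂ (i , inj₁ q)))) ++
                           ((λ z → v (inj₁ (inj₂ (i , inj₂ z)))) ++ (λ (j , y) → v (inj₁ (inj₂ (Fin.toℕ j , y)))))}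
                    λ { v (inj₁ q) → refl ; v (inj₂ (inj₁ z)) → refl ; v (inj₂ (inj₂ y)) → refl })
                  small
            in avoids e (here refl) (ℕ.n<1+n i) small′
            where
            σ : Sub L (fin Y ⊕ (Z ⊕ Copies (Fin i) B)) ((fin X ⊕ Copies ℕ B) ⊕ εκ)
            σ (inj₁ q)              = var (inj₁ (inj₂ (i , inj₁ q)))
            σ (inj₂ (inj₁ z))       = var (inj₁ (inj₂ (i , inj₂ z)))
            σ (inj₂ (inj₂ (j , y))) = var (inj₁ (inj₂ (Fin.toℕ j , y)))

      unbounded-asymmetric : ¬ ThornForkingSymmetric
      unbounded-asymmetric = conclude (compactness {V = fin X ⊕ Copies ℕ B} {εκ} empty Approximation (0 , [])
        (λ (N , Φ) (M , Ψ) → N ⊔ⁿ M , Φ ++ˡ Ψ)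
        (λ { (N , Φ) (M , Ψ) ξ (good , avoids) →
          ((λ i i<N → good i (ℕ.≤-trans i<N (ℕ.m≤m⊔n N M)))
            , λ e e∈ e<N → avoids e (∈-++⁺ˡ e∈) (ℕ.≤-trans e<N (ℕ.m≤m⊔n N M)))
          , ((λ i i<M → good i (ℕ.≤-trans i<M (ℕ.m≤n⊔m N M)))
            , λ e e∈ e<M → avoids e (∈-++⁺ʳ Φ e∈) (ℕ.≤-trans e<M (ℕ.m≤n⊔m N M))) })
        approximation)
        where
        conclude : ∃[ ξ ] (∀ i → Adherent empty (Approximation i) ξ) → ¬ ThornForkingSymmetric
        conclude (ξ , adh) = chain-asymmetric (x-of ξ) (chain-of ξ) (limit-good ξ adh) (limit-avoids ξ adh)

  -- Without a rank, a formula that reaches `r` also reaches `suc r`, for otherwise its rank would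
  -- be `r`; hence it reaches every finite ordinal.
  symmetric⇒rosy : ThornForkingSymmetric → Rosy
  symmetric⇒rosy symmetric Δ Π k φ consistent = by-contradiction em λ none →
    Chain.unbounded-asymmetric Δ Π k φ (unbounded none) symmetric
    where
    unbounded : ¬ (Σ[ α ∈ Ordinal (κ ⊔ ℓ ⊔ c) ] RankEquals Δ Π k φ α) →
                ∀ r → RankAtLeast Δ Π k φ (finite-ordinal {κ ⊔ ℓ ⊔ c} r)
    unbounded none zero    = lift consistent
    unbounded none (suc r) = by-contradiction em λ bounded →
      none (finite-ordinal r , unbounded none r , bounded)

-- Formulas of the language of imaginaries translate to the original language
-- by replacing every variable for a class with a tuple of variables for a
-- representative.

module Saturation-ᵉᑫ (em : Classical) {ℓ c} {L : Language ℓ} (M : Structure L c) where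
  open Language L
  open Structure M
  open Semantics M
  open Sub-semantics M
  open Imaginaries M
  open DefinableEquivalence
  module ᵉᑫ = Semantics (M ᵉᑫ)
  Sortᵉᑫ = Language.Sort eqLanguage

  private
    width : Sortᵉᑫ → ℕ
    width (inj₁ σ) = 1
    width (inj₂ e) = arity e

    parts : ∀ σ → Fin (width σ) → Sort
    parts (inj₁ σ) q = σ
    parts (inj₂ e) q = dom e q

    Flat : ∀ {i} → Ctx i Sortᵉᑫ → Ctx i Sort
    Flat Γ = ctx (Σ[ x ∈ Index Γ ] Fin (width (sort Γ x))) λ (x , q) → parts (sort Γ x) q

    flat : ∀ σ → Structure.∣_∣ (M ᵉᑫ) σ → Tuple (fin (parts σ))
    flat (inj₁ σ) a q = a
    flat (inj₂ e) a q = a q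

    unflat : ∀ σ → Tuple (fin (parts σ)) → Structure.∣_∣ (M ᵉᑫ) σ
    unflat (inj₁ σ) a = a zero
    unflat (inj₂ e) a = a

    flat-unflat : ∀ σ (a : Tuple (fin (parts σ))) q → flat σ (unflat σ a) q ≡ a q
    flat-unflat (inj₁ σ) a zero = refl
    flat-unflat (inj₂ e) a q    = refl

    flatten : ∀ {i} {Γ : Ctx i Sortᵉᑫ} → ᵉᑫ.Tuple Γ → Tuple (Flat Γ)
    flatten {Γ = Γ} v (x , q) = flat (sort Γ x) (v x) q

    unbind : ∀ {i} {Γ : Ctx i Sortᵉᑫ} {σ} → Sub L (Flat (Γ ▹ σ)) (Flat Γ ⊕ fin (parts σ))
    unbind (just x , q)  = var (inj₁ (x , q))
    unbind (nothing , q) = var (inj₂ q)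

    -- The projection to classes is the identity on representatives, so it leaves no trace in the
    -- translated terms.
    translateᵗ : ∀ {i} {Γ : Ctx i Sortᵉᑫ} {σ} → Term eqLanguage Γ σ → ∀ q → Term L (Flat Γ) (parts σ q)
    translateᵗ (var x)           q = var (x , q)
    translateᵗ (app (inj₁ f) ts) q = app f λ j → translateᵗ (ts j) zero
    translateᵗ (app (inj₂ e) ts) q = translateᵗ (ts q) zero

    representatives : ∀ {i} {Γ : Ctx i Sortᵉᑫ} e → Term eqLanguage Γ (inj₂ e) → Term eqLanguage Γ (inj₂ e) →
                      Sub L (fin (dom e) ⊕ fin (dom e)) (Flat Γ)
    representatives e t u (inj₁ q) = translateᵗ t q
    representatives e t u (inj₂ q) = translateᵗ u q

    translate : ∀ {i} {Γ : Ctx i Sortᵉᑫ} → Formula eqLanguage Γ → Formula L (Flat Γ)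
    translate (_≐_ {inj₁ σ} t u) = translateᵗ t zero ≐ translateᵗ u zero
    translate (_≐_ {inj₂ e} t u) = sub (E e) (representatives e t u)
    translate (rel (lift R) ts)  = rel R λ j → translateᵗ (ts j) zero
    translate (¬′ φ)             = ¬′ translate φ
    translate (φ ∧′ ψ)           = translate φ ∧′ translate ψ
    translate (∃′ σ φ)           = ∃ᵇ (width σ) (sub (translate φ) (unbind {σ = σ}))

    eval-translate : ∀ {i} {Γ : Ctx i Sortᵉᑫ} {σ} (t : Term eqLanguage Γ σ) (v : ᵉᑫ.Tuple Γ) q →
                     eval (translateᵗ t q) (flatten {Γ = Γ} v) ≈ flat σ (ᵉᑫ.eval {Γ = Γ} t v) q
    eval-translate (var x)           v q = ≈-refl
    eval-translate (app (inj₁ f) ts) v q = ⟦⟧ᶠ-cong f λ j → eval-translate (ts j) v zero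
    eval-translate (app (inj₂ e) ts) v q = eval-translate (ts q) v zero

    ⊨-translate : ∀ {i} {Γ : Ctx i Sortᵉᑫ} (φ : Formula eqLanguage Γ) (v : ᵉᑫ.Tuple Γ) →
                  (⊨ translate φ [ flatten {Γ = Γ} v ]) ⇔ (ᵉᑫ.⊨_[_] {Γ = Γ} φ v)
    ⊨-translate (_≐_ {inj₁ σ} t u) v = mk⇔
      (λ h → ≈-trans (≈-sym (eval-translate t v zero)) (≈-trans h (eval-translate u v zero)))
      (λ h → ≈-trans (eval-translate t v zero) (≈-trans h (≈-sym (eval-translate u v zero))))
    ⊨-translate (_≐_ {inj₂ e} t u) v = ⊨-subᶠ (E e) λ
      { (inj₁ q) _ → eval-translate t v q ; (inj₂ q) _ → eval-translate u v q }
    ⊨-translate (rel (lift R) ts) v = mk⇔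
      (⟦⟧ᴿ-resp R λ j → eval-translate (ts j) v zero)
      (⟦⟧ᴿ-resp R λ j → ≈-sym (eval-translate (ts j) v zero))
    ⊨-translate (¬′ φ)   v = ¬-cong-⇔ (⊨-translate φ v)
    ⊨-translate (φ ∧′ ψ) v = ⊨-translate φ v ×-⇔ ⊨-translate ψ v
    ⊨-translate {Γ = Γ} (∃′ σ φ) v = mk⇔
      (λ h → let w , h′ = to (⊨-∃ᵇ (width σ) _) h in
        unflat σ w , to (⊨-translate φ _) (to (⊨-sub (translate φ) λ
          { (just x , q) → refl ; (nothing , q) → sym (flat-unflat σ w q) }) h′))
      (λ { (m , h) → from (⊨-∃ᵇ (width σ) _) (flat σ m , from (⊨-sub (translate φ) λ
          { (just x , q) → refl ; (nothing , q) → refl }) (from (⊨-translate φ _) h)) })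

  saturated-ᵉᑫ : Saturated M → κ-Saturated ℓ (M ᵉᑫ)
  saturated-ᵉᑫ sat X Θ A p finite =
    let ξ , h = sat (Flat X) (Flat Θ) (flatten {Γ = Θ} A) p′ λ ψs hs →
          let φs , ks , f = pull ψs hs ; x , h = finite φs ks in flatten {Γ = X} x , f x h
    in (λ x → unflat (sort X x) λ q → ξ (x , q)) , λ φ k →
         to (⊨-split φ) (⊨-≡ (sub (translate φ) split)
           (λ { (inj₁ (x , q)) → sym (flat-unflat (sort X x) (λ q → ξ (x , q)) q) ; (inj₂ y) → refl })
           (h _ (lift (fromWitness {a? = em} (φ , k , refl)))))
    where
    split : Sub L (Flat (X ⊕ Θ)) (Flat X ⊕ Flat Θ)
    split (inj₁ x , q) = var (inj₁ (x , q))
    split (inj₂ y , q) = var (inj₂ (y , q))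
    ⊨-split : ∀ φ {x : ᵉᑫ.Tuple X} →
      (⊨ sub (translate φ) split [ flatten {Γ = X} x ++ flatten {Γ = Θ} A ]) ⇔
      (ᵉᑫ.⊨_[_] {Γ = X ⊕ Θ} φ (ᵉᑫ._++_ {Γ = X} {Θ} x A))
    ⊨-split φ {x} = ⊨-translate φ (ᵉᑫ._++_ {Γ = X} {Θ} x A) ⇔-∘ ⊨-sub (translate φ) λ
      { (inj₁ x , q) → refl ; (inj₂ y , q) → refl }
    p′ : Pred (Formula L (Flat X ⊕ Flat Θ)) ℓ
    -- Formulas with imaginaries live at level `ℓ ⊔ c`; `True` of a decision brings the image of `p`
    -- down to the level at which `Saturated` applies.
    p′ ψ = Lift ℓ (True (em {P = ∃[ φ ] p φ × ψ ≡ sub (translate φ) split}))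
    pull : ∀ ψs → All p′ ψs → Σ[ φs ∈ List (Formula eqLanguage (X ⊕ Θ)) ] All p φs ×
      (∀ x → All (λ φ → ᵉᑫ.⊨_[_] {Γ = X ⊕ Θ} φ (ᵉᑫ._++_ {Γ = X} {Θ} x A)) φs →
             All (λ ψ → ⊨ ψ [ flatten {Γ = X} x ++ flatten {Γ = Θ} A ]) ψs)
    pull [] [] = [] , [] , λ _ _ → []
    pull (ψ ∷ ψs) (lift k ∷ ks) with toWitness {a? = em} k | pull ψs ks
    ... | φ , k′ , refl | φs , ks′ , f = φ ∷ φs , k′ ∷ ks′ , λ { x (h ∷ hs) → from (⊨-split φ) h ∷ f x hs }

theorem2p1p2 : (∀ {p : Level} → ExcludedMiddle p) →
    (∀ {a b : Level} → Extensionality a b) →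
    ∀ {ℓ c : Level} {L : Language ℓ} (T : Theory L) (𝒞 : MonsterModel T c) →
    let open Thorn ℓ (MonsterModel.structure 𝒞 ᵉᑫ) in
    Rosy ⇔ ThornForkingSymmetric
theorem2p1p2 em _ {ℓ} T 𝒞 = mk⇔
  (RosySymmetric.rosy⇒symmetric em ℓ (structure ᵉᑫ) sat)
  (SymmetricRosy.symmetric⇒rosy em ℓ (structure ᵉᑫ) sat)
  where
  open MonsterModel 𝒞
  sat = Saturation-ᵉᑫ.saturated-ᵉᑫ em structure saturated
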